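{- For each $d \in \mathbb{N}_0$, let $\mathcal{N}_d$ denote the set of all $n \in \mathbb{N}$ for which there exists a $d$-regular circulant nut graph of order $n$. Then \[ \mathcal{N}_d = \begin{cases} \varnothing,& d = 0 \text{ or } 4 \nmid d,\\ \{ n \in \mathbb{N} \colon 2 \mid n \text{ and } n \ge d + 4 \},& d \equiv 4 \pmod 8,\\ \{14\} \cup \{ n \in \mathbb{N} \colon 2 \mid n \text{ and } n \ge 18 \},& d = 8,\\ \{ n \in \mathbb{N} \colon 2 \mid n \text{ and } n \ge d + 6 \},& 8 \mid d \text{ and } d \ge 16 . \end{cases} \]
   Context: All graphs are finite, simple, undirected and have at least one vertex; a graph of order $n$ has vertex set $\{0,1,\ldots,n-1\}$. A circulant graph is a graph whose adjacency matrix is a circulant matrix, i.e. whose $(i,j)$ entry depends only on $(j-i) \bmod n$. A nut graph is a graph with at least two vertices whose adjacency matrix has nullity exactly one and such that a (any) nonzero vector spanning its null space has no zero entries. A circulant nut graph is a nut graph that is a circulant graph. -}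

module Defs where

open import Data.Nat using (ℕ; zero; suc; _+_; _≤_)
open import Data.Fin using (Fin; toℕ) renaming (zero to fzero; suc to fsuc)
open import Data.Bool using (Bool; true; false; if_then_else_)
open import Data.Integer as ℤ using (ℤ; +_)
open import Data.Integer.Divisibility as ℤD using ()
open import Data.Rational as ℚ using (ℚ; 0ℚ; 1ℚ)
open import Data.Product using (Σ; _×_; ∃)
open import Relation.Binary.PropositionalEquality using (_≡_; _≢_)
open import Relation.Nullary using (¬_)

∑ℕ : (n : ℕ) → (Fin n → ℕ) → ℕ
∑ℕ zero    f = 0
∑ℕ (suc n) f = f fzero + ∑ℕ n (λ i → f (fsuc i))

∑ℚ : (n : ℕ) → (Fin n → ℚ) → ℚ
∑ℚ zero    f = 0ℚ
∑ℚ (suc n) f = f fzero ℚ.+ ∑ℚ n (λ i → f (fsuc i))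

record Graph (n : ℕ) : Set where
  field
    adj     : Fin n → Fin n → Bool
    adj-sym : ∀ i j → adj i j ≡ adj j i
    adj-irr : ∀ i → adj i i ≡ false
open Graph public

A : ∀ {n} → Graph n → Fin n → Fin n → ℚ
A G i j = if adj G i j then 1ℚ else 0ℚ

degree : ∀ {n} → Graph n → Fin n → ℕ
degree {n} G i = ∑ℕ n (λ j → if adj G i j then 1 else 0)

Regular : ∀ {n} → ℕ → Graph n → Set
Regular d G = ∀ i → degree G i ≡ d

diff : ∀ {n} → Fin n → Fin n → ℤ
diff i j = (+ toℕ j) ℤ.- (+ toℕ i)

Circulant : ∀ {n} → Graph n → Set
Circulant {n} G = ∀ i j k l → (+ n) ℤD.∣ (diff i j ℤ.- diff k l) → adj G i j ≡ adj G k l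

InKernel : ∀ {n} → Graph n → (Fin n → ℚ) → Set
InKernel {n} G x = ∀ i → ∑ℚ n (λ j → A G i j ℚ.* x j) ≡ 0ℚ

NonZeroVec : ∀ {n} → (Fin n → ℚ) → Set
NonZeroVec {n} x = Σ (Fin n) λ i → x i ≢ 0ℚ

-- x spans the null space: x is a nonzero kernel vector and every kernel vector
-- is a scalar multiple of x  (i.e. nullity exactly one, with x a basis)
SpansKernel : ∀ {n} → Graph n → (Fin n → ℚ) → Set
SpansKernel G x = InKernel G x × NonZeroVec x
                × (∀ y → InKernel G y → ∃ λ c → ∀ i → y i ≡ c ℚ.* x i)

Nut : ∀ {n} → Graph n → Set
Nut {n} G = 2 ≤ n × Σ (Fin n → ℚ) λ x → SpansKernel G x × (∀ i → x i ≢ 0ℚ)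

InN : ℕ → ℕ → Set
InN d n = 1 ≤ n × Σ (Graph n) λ G → Circulant G × Regular d G × Nut G

-- Write x for the shift of sequences of period n, and c s = xˢ + x⁻ˢ.
--
-- Necessity.  The spanning kernel vector is an eigenvector of x and invariant under reflection, so
-- it is constant or alternating, and d ≠ 0 excludes the constant one.  Hence n = 2h is even, h is
-- not in the connection set, and the half set in {1, …, h - 1} has as many odd as even elements,
-- whence 4 ∣ d.  If n = d + 2, or n = d + 4 and 8 ∣ d, or (d , n) = (8 , 16), the kernel contains
-- every sequence with a certain antiperiod p ≥ 2; one of these has a zero entry.
--
-- Sufficiency.  The half set is a core of two or four elements together with pairs s, h - s.
-- Where xʰ = -1 the pairs cancel and the core factors into an injective product such as
-- (1 + x^δ) (1 + x^κ) or c e * (1 + c ρ).  Where xʰ = 1 the pairs count twice, so modulo 2 only the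
-- core is left, which is a power of 1 + x times a unit.  An integral kernel vector is therefore
-- even, and by descent zero, unless some kernel vector has odd entries only.  Splitting off the
-- antiperiods ρ, 2ρ, 4ρ, … (ρ the odd part of h), odd vectors are excluded by summation or modulo 4;
-- for the fourth and eighth roots of unity this depends on the parity of the numbers of pairs,
-- which dictates the choice of the core.
module Submission where

open import Data.Bool using (Bool; _∧_; _∨_; false; if_then_else_; not; true)
open import Data.Empty using (⊥; ⊥-elim)
open import Data.Fin using (Fin; fromℕ<; toℕ) renaming (zero to fzero; suc to fsuc)
import Data.Integer.Properties as ℤₚ
import Data.Integer.Tactic.RingSolver as ℤ-Solver
import Data.List.Relation.Unary.All.Properties as Allₚ
import Data.List.Relation.Unary.Unique.Propositional.Properties as Uniqueₚ
open import Data.Nat as ℕ using (ℕ; zero; suc; s≤s; z≤n)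
import Data.Nat.Coprimality as Coprimality
import Data.Nat.DivMod as ℕ/
import Data.Nat.Divisibility as ℕ∣
import Data.Nat.Properties as ℕₚ
import Data.Nat.Tactic.RingSolver as ℕ-Solver
open import Data.Product using (_,_; _×_; proj₁; proj₂; ∃; ∃₂)
import Data.Rational.Properties as ℚₚ
import Data.Rational.Unnormalised.Properties as ℚᵘₚ
open import Data.Sum using (_⊎_; inj₁; inj₂)
open import Defs
open import Relation.Binary.PropositionalEquality
open import Relation.Nullary using (Dec; no; yes; ¬_)

-- Modulo 2 the argument can never finish alone: for every half set, `Λ` sends an all-odd vector to
-- an even one, since each `c s` adds two entries. The all-odd vectors are thus the obstacle, and
-- each antiperiod needs its own reason against them. The second obstacle is parity. For even h, the
-- elements s and h - s have the same parity, so the pairs contribute an even number of odd and an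
-- even number of even elements, while the half set must have d/4 odd ones. For d ≡ 4 modulo 8 a
-- core of one odd and one even element fits. For 8 ∣ d the core must contain an even number of
-- each, which rules out the convenient core {h/2, h/2 - 1} and calls for a family of cores, chosen
-- by the power of 2 in h. No root of unity appears: antiperiod p stands for x^p = -1. All sequences
-- are integral and indexed by ℤ, so polynomial identities in x become identities between indices.

module Kernels where

  open import Data.Integer hiding (suc)
  open import Data.Integer.DivMod using (a≡a%ℕn+[a/ℕn]*n; n%ℕd<d)
  open import Data.Integer.Divisibility.Signed
  open import Data.Integer.Properties
  open import Data.Integer.Tactic.RingSolver using (solve-∀)
  open import Data.List using (List; []; _∷_; _++_; length; map)
  open import Data.List.Relation.Unary.All using (All; []; _∷_)

  -- Sequences and periods

  Seq : Set
  Seq = ℤ → ℤ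

  ∣-resp : ∀ {m x y} → x ≡ y → m ∣ x → m ∣ y
  ∣-resp {m} = subst (m ∣_)

  Even : ℤ → Set
  Even x = + 2 ∣ x

  record Odd (x : ℤ) : Set where
    constructor odd
    field 2∣x-1 : + 2 ∣ x - + 1
  open Odd public

  double-even : ∀ x → Even (+ 2 * x)
  double-even x = divides x (*-comm (+ 2) x)

  even⊎odd : ∀ x → Even x ⊎ Odd x
  even⊎odd x with x %ℕ 2 | a≡a%ℕn+[a/ℕn]*n x 2 | n%ℕd<d x 2
  ... | 0 | eq | _ = inj₁ (divides (x /ℕ 2) (trans eq (+-identityˡ _)))
  ... | 1 | eq | _ = inj₂ (odd (divides (x /ℕ 2) (trans (cong (_- + 1) eq) (cancel (x /ℕ 2 * + 2)))))
    where
    cancel : ∀ y → + 1 + y - + 1 ≡ y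
    cancel = solve-∀
  ... | suc (suc _) | _ | s≤s (s≤s ())

  2∤1 : ¬ (+ 2 ∣ + 1)
  2∤1 d with ℕ∣.∣⇒≤ (∣⇒∣ᵤ d)
  ... | s≤s ()

  4∤2 : ¬ (+ 4 ∣ + 2)
  4∤2 d with ℕ∣.∣⇒≤ (∣⇒∣ᵤ d)
  ... | s≤s (s≤s ())

  ¬even×odd : ∀ {x} → Even x → ¬ Odd x
  ¬even×odd {x} e (odd o) = 2∤1 (∣-resp (eq x) (∣m∣n⇒∣m-n e o))
    where
    eq : ∀ x → x - (x - + 1) ≡ + 1
    eq = solve-∀

  odd≢0 : ∀ {x} → Odd x → x ≢ + 0
  odd≢0 o refl = ¬even×odd (divides (+ 0) refl) o

  odd+odd : ∀ {x y} → Odd x → Odd y → Even (x + y)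
  odd+odd {x} {y} (odd p) (odd q) = ∣-resp (eq x y) (∣m∣n⇒∣m+n (∣m∣n⇒∣m+n p q) (double-even (+ 1)))
    where
    eq : ∀ x y → x - + 1 + (y - + 1) + + 2 * + 1 ≡ x + y
    eq = solve-∀

  2[odd+odd] : ∀ {x y} → Odd x → Odd y → + 4 ∣ + 2 * (x + y)
  2[odd+odd] p q = *-monoʳ-∣ (+ 2) (odd+odd p q)

  4∣2odd-2 : ∀ {x} → Odd x → + 4 ∣ + 2 * x - + 2
  4∣2odd-2 {x} (odd o) = ∣-resp (eq x) (*-monoʳ-∣ (+ 2) o)
    where
    eq : ∀ x → + 2 * (x - + 1) ≡ + 2 * x - + 2
    eq = solve-∀

  2*x≡0⇒x≡0 : ∀ {x} → + 2 * x ≡ + 0 → x ≡ + 0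
  2*x≡0⇒x≡0 {x} = *-cancelˡ-≡ (+ 2) x (+ 0)

  double≡0⇒≡0 : ∀ {x} → x + x ≡ + 0 → x ≡ + 0
  double≡0⇒≡0 {x} e = 2*x≡0⇒x≡0 (trans (eq x) e)
    where
    eq : ∀ x → + 2 * x ≡ x + x
    eq = solve-∀

  ≡-neg⇒≡0 : ∀ {x} → x ≡ - x → x ≡ + 0
  ≡-neg⇒≡0 {x} e = double≡0⇒≡0 (trans (cong (_+_ x) e) (+-inverseʳ x))

  i+j≡0⇒i≡-j : ∀ {i j} → i + j ≡ + 0 → i ≡ - j
  i+j≡0⇒i≡-j {i} {j} e = trans (eq i j) (trans (cong (_- j) e) (+-identityˡ (- j)))
    where
    eq : ∀ i j → i ≡ i + j - j
    eq = solve-∀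

  private
    n<2^n : ∀ n → n ℕ.< 2 ℕ.^ n
    n<2^n zero = s≤s z≤n
    n<2^n (suc n) = subst (suc n ℕ.<_) (cong (2 ℕ.^ n ℕ.+_) (sym (ℕₚ.+-identityʳ _)))
      (ℕₚ.+-mono-≤-< (ℕₚ.≤-trans (s≤s z≤n) (n<2^n n)) (n<2^n n))

  ∣-powers-of-2⇒≡0 : ∀ x → (∀ k → + (2 ℕ.^ k) ∣ x) → x ≡ + 0
  ∣-powers-of-2⇒≡0 x f = ∣i∣≡0⇒i≡0 (small ∣ x ∣ (∣⇒∣ᵤ (f ∣ x ∣)))
    where
    small : ∀ n → 2 ℕ.^ n ℕ∣.∣ n → n ≡ 0
    small zero _ = refl
    small (suc n) d = ⊥-elim (ℕₚ.<⇒≱ (n<2^n (suc n)) (ℕ∣.∣⇒≤ d))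

  infixl 6 _⊞_
  _⊞_ : Seq → Seq → Seq
  (w ⊞ v) i = w i + v i

  infixr 7 _⊡_
  _⊡_ : ℤ → Seq → Seq
  (k ⊡ w) i = k * w i

  shift : ℤ → Seq → Seq
  shift k w i = w (i + k)

  T c : ℤ → Seq → Seq
  T k w i = w (i + k) + w i
  c s w i = w (i + s) + w (i - s)

  -- The adjacency operator of the circulant graph with connection set ±L, on all sequences over ℤ.
  -- No order enters, so one operator serves every period and antiperiod; a repeated element of L
  -- counts twice.
  Λ : List ℕ → Seq → Seq
  Λ [] w i = + 0
  Λ (s ∷ L) w i = c (+ s) w i + Λ L w i

  Λ-ext : ∀ L {w v} → w ≗ v → Λ L w ≗ Λ L v
  Λ-ext [] e i = refl
  Λ-ext (s ∷ L) e i = cong₂ _+_ (cong₂ _+_ (e (i + + s)) (e (i - + s))) (Λ-ext L e i)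

  Λ-⊞ : ∀ L w v i → Λ L (w ⊞ v) i ≡ Λ L w i + Λ L v i
  Λ-⊞ [] w v i = refl
  Λ-⊞ (s ∷ L) w v i = trans (cong (_+_ (c (+ s) (w ⊞ v) i)) (Λ-⊞ L w v i))
      (eq (w (i + + s)) (v (i + + s)) (w (i - + s)) (v (i - + s)) (Λ L w i) (Λ L v i))
    where
    eq : ∀ a b c d e f → a + b + (c + d) + (e + f) ≡ a + c + e + (b + d + f)
    eq = solve-∀

  Λ-⊡ : ∀ L k w i → Λ L (k ⊡ w) i ≡ k * Λ L w i
  Λ-⊡ [] k w i = sym (*-zeroʳ k)
  Λ-⊡ (s ∷ L) k w i = trans (cong (_+_ (c (+ s) (k ⊡ w) i)) (Λ-⊡ L k w i))
      (eq k (w (i + + s)) (w (i - + s)) (Λ L w i))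
    where
    eq : ∀ k a b e → k * a + k * b + k * e ≡ k * (a + b + e)
    eq = solve-∀

  Λ-shift : ∀ L k w i → Λ L (shift k w) i ≡ Λ L w (i + k)
  Λ-shift [] k w i = refl
  Λ-shift (s ∷ L) k w i = cong₂ _+_
      (cong₂ _+_ (cong w (eq₁ i (+ s) k)) (cong w (eq₁ i (- + s) k))) (Λ-shift L k w i)
    where
    eq₁ : ∀ i s k → i + s + k ≡ i + k + s
    eq₁ = solve-∀

  Λ-++ : ∀ L L′ w i → Λ (L ++ L′) w i ≡ Λ L w i + Λ L′ w i
  Λ-++ [] L′ w i = sym (+-identityˡ _)
  Λ-++ (s ∷ L) L′ w i = trans (cong (_+_ (c (+ s) w i)) (Λ-++ L L′ w i)) (sym (+-assoc (c (+ s) w i) _ _))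

  record Ker (L : List ℕ) (w : Seq) : Set where
    constructor mk
    field Λ≡0 : ∀ i → Λ L w i ≡ + 0
  open Ker public

  Ker-⊞ : ∀ {L w v} → Ker L w → Ker L v → Ker L (w ⊞ v)
  Ker-⊞ {L} {w} {v} (mk p) (mk q) = mk λ i → trans (Λ-⊞ L w v i) (cong₂ _+_ (p i) (q i))

  Ker-⊡ : ∀ {L w} k → Ker L w → Ker L (k ⊡ w)
  Ker-⊡ {L} {w} k (mk p) = mk λ i → trans (Λ-⊡ L k w i) (trans (cong (k *_) (p i)) (*-zeroʳ k))

  Ker-shift : ∀ {L w} k → Ker L w → Ker L (shift k w)
  Ker-shift {L} {w} k (mk p) = mk λ i → trans (Λ-shift L k w i) (p (i + k))

  Ker-T : ∀ {L w} k → Ker L w → Ker L (T k w)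
  Ker-T k p = Ker-⊞ (Ker-shift k p) p

  Ker-half : ∀ {L w v} → (∀ i → w i ≡ v i * + 2) → Ker L w → Ker L v
  Ker-half {L} {w} {v} e (mk p) = mk λ i → 2*x≡0⇒x≡0
    (trans (sym (Λ-⊡ L (+ 2) v i)) (trans (Λ-ext L (λ j → trans (*-comm (+ 2) (v j)) (sym (e j))) i) (p i)))

  record Per (p : ℤ) (w : Seq) : Set where
    constructor mk
    field per : ∀ i → w (i + p) ≡ w i
  open Per public

  record Anti (p : ℤ) (w : Seq) : Set where
    constructor mk
    field anti : ∀ i → w (i + p) ≡ - w i
  open Anti public

  Per-shift : ∀ {p w} k → Per p w → Per p (shift k w)
  Per-shift {p} {w} k (mk f) = mk λ i → trans (cong w (eq i p k)) (f (i + k))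
    where
    eq : ∀ i p k → i + p + k ≡ i + k + p
    eq = solve-∀

  Per-⊞ : ∀ {p w v} → Per p w → Per p v → Per p (w ⊞ v)
  Per-⊞ (mk f) (mk g) = mk λ i → cong₂ _+_ (f i) (g i)

  Per-T : ∀ {p w} k → Per p w → Per p (T k w)
  Per-T k f = Per-⊞ (Per-shift k f) f

  Per-half : ∀ {p w v} → (∀ i → w i ≡ v i * + 2) → Per p w → Per p v
  Per-half {p} {w} {v} e (mk f) = mk λ i → *-cancelʳ-≡ (v (i + p)) (v i) (+ 2)
    (trans (sym (e (i + p))) (trans (f i) (e i)))

  Anti-shift : ∀ {p w} k → Anti p w → Anti p (shift k w)
  Anti-shift {p} {w} k (mk f) = mk λ i → trans (cong w (eq i p k)) (f (i + k))
    where
    eq : ∀ i p k → i + p + k ≡ i + k + p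
    eq = solve-∀

  Anti-⊞ : ∀ {p w v} → Anti p w → Anti p v → Anti p (w ⊞ v)
  Anti-⊞ {p} {w} {v} (mk f) (mk g) = mk λ i → trans (cong₂ _+_ (f i) (g i)) (sym (neg-distrib-+ (w i) (v i)))

  Anti-⊡ : ∀ {p w} k → Anti p w → Anti p (k ⊡ w)
  Anti-⊡ {p} {w} k (mk f) = mk λ i → trans (cong (k *_) (f i)) (sym (neg-distribʳ-* k (w i)))

  Anti-T : ∀ {p w} k → Anti p w → Anti p (T k w)
  Anti-T k f = Anti-⊞ (Anti-shift k f) f

  Anti-half : ∀ {p w v} → (∀ i → w i ≡ v i * + 2) → Anti p w → Anti p v
  Anti-half {p} {w} {v} e (mk f) = mk λ i → *-cancelʳ-≡ (v (i + p)) (- v i) (+ 2)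
    (trans (sym (e (i + p))) (trans (f i) (trans (cong -_ (e i)) (neg-distribˡ-* (v i) (+ 2)))))

  Anti⇒Per : ∀ {p w} → Anti p w → Per (p + p) w
  Anti⇒Per {p} {w} (mk f) = mk λ i → trans (cong w (sym (+-assoc i p p)))
    (trans (f (i + p)) (trans (cong -_ (f i)) (neg-involutive (w i))))

  -- m = 0 is exact periodicity.
  record Cong (m p : ℤ) (w : Seq) : Set where
    constructor mk
    field cng : ∀ i → m ∣ w (i + p) - w i
  open Cong public

  Per⇒Cong : ∀ {m p w} → Per p w → Cong m p w
  Per⇒Cong {m} {p} {w} (mk f) = mk λ i → ∣-resp (sym (trans (cong (_- w i) (f i)) (+-inverseʳ (w i)))) (divides (+ 0) refl)

  Cong⇒Per : ∀ {p w} → Cong (+ 0) p w → Per p w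
  Cong⇒Per {p} {w} (mk f) = mk λ i → i-j≡0⇒i≡j (w (i + p)) (w i) (0∣⇒≡0 (f i))

  Cong-+ : ∀ {m p q w} → Cong m p w → Cong m q w → Cong m (p + q) w
  Cong-+ {m} {p} {q} {w} (mk f) (mk g) = mk λ i → ∣-resp
      (trans (eq (w (i + p + q)) (w (i + p)) (w i)) (cong (λ j → w j - w i) (+-assoc i p q)))
      (∣m∣n⇒∣m+n (g (i + p)) (f i))
    where
    eq : ∀ a b c → a - b + (b - c) ≡ a - c
    eq = solve-∀

  Cong-neg : ∀ {m p w} → Cong m p w → Cong m (- p) w
  Cong-neg {m} {p} {w} (mk f) = mk λ i → ∣-resp
      (trans (cong (λ j → - (w j - w (i - p))) (back i p)) (eq (w i) (w (i - p))))
      (∣m⇒∣-m (f (i - p)))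
    where
    back : ∀ i p → i - p + p ≡ i
    back = solve-∀
    eq : ∀ a b → - (a - b) ≡ b - a
    eq = solve-∀

  Cong-0 : ∀ {m w} → Cong m (+ 0) w
  Cong-0 {m} {w} = Per⇒Cong (mk λ i → cong w (+-identityʳ i))

  Cong-* : ∀ {m p w} k → Cong m p w → Cong m (k * p) w
  Cong-* {m} {p} {w} (+ n) f = nat n
    where
    nat : ∀ n → Cong m (+ n * p) w
    nat zero = subst (λ q → Cong m q w) (sym (*-zeroˡ p)) Cong-0
    nat (suc n) = subst (λ q → Cong m q w) (eq (+ n) p) (Cong-+ f (nat n))
      where
      eq : ∀ k p → p + k * p ≡ (+ 1 + k) * p
      eq = solve-∀
  Cong-* {m} {p} {w} -[1+ n ] f =
    subst (λ q → Cong m q w) (neg-distribˡ-* (+ suc n) p) (Cong-neg (Cong-* (+ suc n) f))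

  Per-* : ∀ {p w} k → Per p w → Per (k * p) w
  Per-* k f = Cong⇒Per (Cong-* k (Per⇒Cong f))

  Per-≡ : ∀ {p q w} → p ≡ q → Per p w → Per q w
  Per-≡ refl f = f

  Anti-≡ : ∀ {p q w} → p ≡ q → Anti p w → Anti q w
  Anti-≡ refl f = f

  Cong-≡ : ∀ {m p q w} → p ≡ q → Cong m p w → Cong m q w
  Cong-≡ refl f = f

  Per-Anti : ∀ {p q w} → Per p w → Anti q w → Anti (p + q) w
  Per-Anti {p} {q} {w} (mk f) (mk g) = mk λ i →
    trans (cong w (sym (+-assoc i p q))) (trans (g (i + p)) (cong -_ (f i)))

  Anti-odd : ∀ {p w} k → Anti p w → Anti (k * (p + p) + p) w
  Anti-odd k f = Per-Anti (Per-* k (Anti⇒Per f)) f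

  Per×Anti⇒0 : ∀ {p w} → Per p w → Anti p w → ∀ i → w i ≡ + 0
  Per×Anti⇒0 (mk f) (mk g) i = ≡-neg⇒≡0 (trans (sym (f i)) (g i))

  Cong-lin : ∀ {m p q w} a b → Cong m p w → Cong m q w → Cong m (a * p + b * q) w
  Cong-lin a b f g = Cong-+ (Cong-* a f) (Cong-* b g)

  -- Descent modulo 2

  -- The sum of σ^j w(i + jp) over j < k: sums over a period for σ = 1, alternating sums for σ = -1.
  Fold : ℤ → ℤ → ℕ → Seq → Seq
  Fold σ p zero w i = + 0
  Fold σ p (suc k) w i = w i + σ * Fold σ p k w (i + p)

  Ker-Fold : ∀ {L w} σ p k → Ker L w → Ker L (Fold σ p k w)
  Ker-Fold {L} {w} σ p zero f = mk λ i → Λ-⊡ L (+ 0) w i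
  Ker-Fold σ p (suc k) f = Ker-⊞ f (Ker-⊡ σ (Ker-shift p (Ker-Fold σ p k f)))

  Anti-Fold : ∀ {q w} σ p k → Anti q w → Anti q (Fold σ p k w)
  Anti-Fold σ p zero f = mk λ i → refl
  Anti-Fold σ p (suc k) f = Anti-⊞ f (Anti-⊡ σ (Anti-shift p (Anti-Fold σ p k f)))

  Fold-T : ∀ σ p k m w i → Fold σ p k (T m w) i ≡ T m (Fold σ p k w) i
  Fold-T σ p zero m w i = refl
  Fold-T σ p (suc k) m w i = trans
      (cong (λ x → T m w i + σ * x) (Fold-T σ p k m w (i + p)))
      (trans (cong (λ j → T m w i + σ * (F j + F (i + p))) (swap i p m))
        (eq (w (i + m)) (w i) σ (F (i + m + p)) (F (i + p))))
    where
    F = Fold σ p k w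
    swap : ∀ i p m → i + p + m ≡ i + m + p
    swap = solve-∀
    eq : ∀ a b s c d → a + b + s * (c + d) ≡ a + s * c + (b + s * d)
    eq = solve-∀

  Fold-half : ∀ σ p k {w v} → (∀ i → w i ≡ v i * + 2) → ∀ i → Fold σ p k w i ≡ Fold σ p k v i * + 2
  Fold-half σ p zero e i = refl
  Fold-half σ p (suc k) {w} {v} e i = trans
      (cong₂ (λ x y → x + σ * y) (e i) (Fold-half σ p k e (i + p)))
      (eq (v i) σ (Fold σ p k v (i + p)))
    where
    eq : ∀ a s b → a * + 2 + s * (b * + 2) ≡ (a + s * b) * + 2
    eq = solve-∀

  -- Telescoping of the geometric sum in σ x^p.
  Fold-step : ∀ σ p k w i → σ * Fold σ p k w (i + p) ≡ Fold σ p k w i - w i + σ ^ k * w (i + + k * p)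
  Fold-step σ p zero w i = trans (*-zeroʳ σ) (trans (eq (w i)) (cong (λ j → + 0 - w i + + 1 * w j) (base i p)))
    where
    eq : ∀ a → + 0 ≡ + 0 - a + + 1 * a
    eq = solve-∀
    base : ∀ i p → i ≡ i + + 0 * p
    base = solve-∀
  Fold-step σ p (suc k) w i = trans
      (cong (λ x → σ * (w (i + p) + x)) (Fold-step σ p k w (i + p)))
      (trans (eq (w (i + p)) (F (i + p)) (σ ^ k) σ (w (i + p + + k * p)) (w i))
        (cong (λ j → w i + σ * F (i + p) - w i + σ ^ suc k * w j) (next i p (+ k))))
    where
    F = Fold σ p k w
    next : ∀ i p k → i + p + k * p ≡ i + (+ 1 + k) * p
    next = solve-∀
    eq : ∀ a f t s b x → s * (a + (f - a + t * b)) ≡ x + s * f - x + s * t * b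
    eq = solve-∀

  Per-Fold : ∀ {w} p k → Per (+ k * p) w → Per p (Fold (+ 1) p k w)
  Per-Fold {w} p k (mk f) = mk λ i → trans (sym (*-identityˡ _)) (trans (Fold-step (+ 1) p k w i)
      (trans (cong₂ (λ s x → Fold (+ 1) p k w i - w i + s * x) (^-zeroˡ k) (f i)) (eq (Fold (+ 1) p k w i) (w i))))
    where
    eq : ∀ a b → a - b + + 1 * b ≡ a
    eq = solve-∀

  -1^odd : ∀ r → (- + 1) ^ suc (2 ℕ.* r) ≡ - + 1
  -1^odd zero = refl
  -1^odd (suc r) = trans (cong (λ k → (- + 1) ^ suc k) (ℕₚ.*-suc 2 r))
    (trans (eq ((- + 1) ^ suc (2 ℕ.* r))) (-1^odd r))
    where
    eq : ∀ a → - + 1 * (- + 1 * a) ≡ a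
    eq = solve-∀

  -- For odd k, (1 + x)(1 - x + x² - ... + x^(k-1)) = 1 + x^k, which is zero on antiperiod k.
  alternating-Fold : ∀ {w} r → Anti (+ suc (2 ℕ.* r)) w → ∀ i → T (+ 1) (Fold (- + 1) (+ 1) (suc (2 ℕ.* r)) w) i ≡ + 0
  alternating-Fold {w} r (mk f) i = trans (eq₁ (F (i + + 1)) (F i))
      (trans (cong (λ x → F i + - x) (trans (Fold-step (- + 1) (+ 1) k w i)
        (cong₂ (λ s x → F i - w i + s * x) (-1^odd r) (trans (cong (λ j → w (i + j)) (*-identityʳ (+ k))) (f i)))))
      (eq₂ (F i) (w i)))
    where
    k = suc (2 ℕ.* r)
    F = Fold (- + 1) (+ 1) k w
    eq₁ : ∀ a b → a + b ≡ b + - (- + 1 * a)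
    eq₁ = solve-∀
    eq₂ : ∀ a b → a + - (a - b + - + 1 * - b) ≡ + 0
    eq₂ = solve-∀

  Fold-parity : ∀ {w} σ p k → Odd σ → (∀ i → Odd (w i)) → ∀ i → Even (Fold σ p k w i - + k)
  Fold-parity σ p zero oσ o i = divides (+ 0) refl
  Fold-parity {w} σ p (suc k) oσ o i = ∣-resp (eq (w i) σ F (+ k))
      (∣m∣n⇒∣m+n (∣m∣n⇒∣m+n (2∣x-1 (o i)) (∣m⇒∣m*n F (2∣x-1 oσ))) (Fold-parity σ p k oσ o (i + p)))
    where
    F = Fold σ p k w (i + p)
    eq : ∀ a s f k → a - + 1 + (s - + 1) * f + (f - k) ≡ a + s * f - (+ 1 + k)
    eq = solve-∀

  odd-1 : Odd (+ 1)
  odd-1 = odd (divides (+ 0) refl)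

  odd--1 : Odd (- + 1)
  odd--1 = odd (divides (- + 1) refl)

  Fold-odd : ∀ {w} σ p r → Odd σ → (∀ i → Odd (w i)) → ∀ i → Odd (Fold σ p (suc (2 ℕ.* r)) w i)
  Fold-odd {w} σ p r oσ o i = odd (∣-resp (trans (cong (λ x → F - (+ 1 + x) + + 2 * + r) (pos-* 2 r)) (eq F (+ r)))
      (∣m∣n⇒∣m+n (Fold-parity σ p (suc (2 ℕ.* r)) oσ o i) (double-even (+ r))))
    where
    F = Fold σ p (suc (2 ℕ.* r)) w i
    eq : ∀ f r → f - (+ 1 + + 2 * r) + + 2 * r ≡ f - + 1
    eq = solve-∀

  Closed-T Closed-half : (Seq → Set) → Set
  Closed-T 𝓛 = ∀ {w} k → 𝓛 w → 𝓛 (T k w)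
  Closed-half 𝓛 = ∀ {w v} → (∀ i → w i ≡ v i * + 2) → 𝓛 w → 𝓛 v

  -- Halving can be repeated, so every entry is divisible by every power of 2. A class 𝓛 is needed
  -- instead of a single vector because half of w must qualify again.
  descent : ∀ {𝓛} → Closed-half 𝓛 → (∀ {w} → 𝓛 w → ∀ i → Even (w i)) → ∀ {w} → 𝓛 w → ∀ i → w i ≡ + 0
  descent {𝓛} half even l i = ∣-powers-of-2⇒≡0 _ λ k → pow k l i
    where
    pow : ∀ k {w} → 𝓛 w → ∀ i → + (2 ℕ.^ k) ∣ w i
    pow zero {w} l i = divides (w i) (sym (*-identityʳ (w i)))
    pow (suc k) {w} l i = ∣-resp (trans (*-comm (+ 2) _) (sym (_∣_.equality (even l i))))
      (subst (_∣ + 2 * v i) (sym (pos-* 2 (2 ℕ.^ k))) (*-monoʳ-∣ (+ 2) (pow k (half {w} {v} (λ j → _∣_.equality (even l j)) l) i)))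
      where
      v : Seq
      v j = _∣_.quotient (even l j)

  Cong-to-0 : ∀ {m w} → Cong m (+ 1) w → ∀ i → m ∣ w i - w (+ 0)
  Cong-to-0 {m} {w} f i = ∣-resp (cong (λ j → w j - w (+ 0)) (eq i)) (cng (Cong-* i f) (+ 0))
    where
    eq : ∀ i → + 0 + i * + 1 ≡ i
    eq = solve-∀

  -- 1 + x is nilpotent modulo 2 on sequences with T (2 ^ b) w ≡ 0, and a nonzero sequence killed
  -- modulo 2 by 1 + x is all odd.
  even-from-T : ∀ {𝓛} → Closed-T 𝓛 → (∀ {w} → 𝓛 w → (∀ i → Odd (w i)) → ⊥) →
    ∀ b {w} → 𝓛 w → (∀ i → Even (T (+ (2 ℕ.^ b)) w i)) → ∀ i → Even (w i)
  even-from-T {𝓛} closed no-odd zero {w} l e = conclude (even⊎odd (w (+ 0)))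
    where
    near : Cong (+ 2) (+ 1) w
    near = mk λ i → ∣-resp (eq (w (i + + 1)) (w i)) (∣m∣n⇒∣m-n (e i) (double-even (w i)))
      where
      eq : ∀ a b → a + b - + 2 * b ≡ a - b
      eq = solve-∀
    conclude : Even (w (+ 0)) ⊎ Odd (w (+ 0)) → ∀ i → Even (w i)
    conclude (inj₁ p) i = ∣-resp (eq (w i) (w (+ 0))) (∣m∣n⇒∣m+n (Cong-to-0 near i) p)
      where
      eq : ∀ a b → a - b + b ≡ a
      eq = solve-∀
    conclude (inj₂ (odd p)) = ⊥-elim (no-odd l λ i → odd (∣-resp (eq (w i) (w (+ 0))) (∣m∣n⇒∣m+n (Cong-to-0 near i) p)))
      where
      eq : ∀ a b → a - b + (b - + 1) ≡ a - + 1
      eq = solve-∀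
  even-from-T {𝓛} closed no-odd (suc b) {w} l e = rec l (rec (closed k l) twice)
    where
    k = + (2 ℕ.^ b)
    rec : ∀ {v} → 𝓛 v → (∀ i → Even (T k v i)) → ∀ i → Even (v i)
    rec = even-from-T {𝓛} closed no-odd b
    -- Modulo 2, (1 + x^k)² = 1 + x^(2k).
    twice : ∀ i → Even (T k (T k w) i)
    twice i = ∣-resp (trans (cong (λ j → w j + w i + + 2 * w (i + k)) idx) (eq (w (i + k + k)) (w i) (w (i + k))))
        (∣m∣n⇒∣m+n (e i) (double-even (w (i + k))))
      where
      idx : i + + (2 ℕ.^ suc b) ≡ i + k + k
      idx = trans (cong (λ n → i + + (2 ℕ.^ b ℕ.+ n)) (ℕₚ.+-identityʳ (2 ℕ.^ b))) (sym (+-assoc i k k))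
      eq : ∀ a b c → a + b + + 2 * c ≡ a + c + (c + b)
      eq = solve-∀

  -- Two exponents, because the cores become (1 + x^(2^b)) (1 + x^(2^c)) modulo 2; each use of
  -- `even-from-T` removes one factor.
  kill : ∀ {𝓛} → Closed-T 𝓛 → Closed-half 𝓛 → (∀ {w} → 𝓛 w → (∀ i → Odd (w i)) → ⊥) →
    ∀ b c → (∀ {w} → 𝓛 w → ∀ i → Even (T (+ (2 ℕ.^ b)) (T (+ (2 ℕ.^ c)) w) i)) →
    ∀ {w} → 𝓛 w → ∀ i → w i ≡ + 0
  kill {𝓛} closed half no-odd b c nil = descent {𝓛} half λ l →
    even-from-T {𝓛} closed no-odd c l (even-from-T {𝓛} closed no-odd b (closed _ l) (nil l))

  Λ-const : ∀ L {w} → Per (+ 1) w → ∀ i → Λ L w i ≡ + (2 ℕ.* length L) * w i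
  Λ-const [] f i = refl
  Λ-const (s ∷ L) {w} f i = trans (cong₂ _+_ (cong₂ _+_ (at (+ s)) (at (- + s))) (Λ-const L f i))
      (trans (eq (w i) (+ (2 ℕ.* length L)))
        (cong (λ n → + n * w i) (sym (ℕₚ.*-suc 2 (length L)))))
    where
    at : ∀ k → w (i + k) ≡ w i
    at k = trans (cong (λ j → w (i + j)) (sym (*-identityʳ k))) (per (Per-* k f) i)
    eq : ∀ a n → a + a + n * a ≡ (+ 2 + n) * a
    eq = solve-∀

  ⊞-Per : ∀ {n w} → Per (+ (n ℕ.+ n)) w → Per (+ n) (shift (+ n) w ⊞ w)
  ⊞-Per {n} {w} (mk f) = mk λ i → trans
    (cong (λ j → w j + w (i + + n)) (+-assoc i (+ n) (+ n)))
    (trans (cong (_+ w (i + + n)) (f i)) (+-comm (w i) _))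

  ⊟-Anti : ∀ {n w} → Per (+ (n ℕ.+ n)) w → Anti (+ n) (shift (+ n) w ⊞ (- + 1 ⊡ w))
  ⊟-Anti {n} {w} (mk f) = mk λ i → trans
    (cong (λ j → w j + - + 1 * w (i + + n)) (+-assoc i (+ n) (+ n)))
    (trans (cong (_+ - + 1 * w (i + + n)) (f i)) (eq (w i) (w (i + + n))))
    where
    eq : ∀ a b → a + - + 1 * b ≡ - (b + - + 1 * a)
    eq = solve-∀

  -- The half set is nonempty by its form, so that 2 |M| can be cancelled; b and c are the exponents
  -- for `kill`.
  module Kernel (s : ℕ) (M′ : List ℕ) (r b c : ℕ) where
    M = s ∷ M′
    ρ = suc (2 ℕ.* r)

    Nil : ℕ → Set
    Nil n = ∀ {w} → Per (+ n) w → Ker M w → ∀ i → Even (T (+ (2 ℕ.^ b)) (T (+ (2 ℕ.^ c)) w) i)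

    NoOdd : ℕ → Set
    NoOdd n = ∀ {w} → Anti (+ n) w → Ker M w → (∀ i → Odd (w i)) → ⊥

    Nil-half : ∀ n → Nil (n ℕ.+ n) → Nil n
    Nil-half n nil f = nil (Per-≡ (eq (+ n)) (Per-* (+ 2) f))
      where
      eq : ∀ x → + 2 * x ≡ x + x
      eq = solve-∀

    periodic-ρ : Nil ρ → ∀ {w} → Per (+ ρ) w → Ker M w → ∀ i → w i ≡ + 0
    periodic-ρ nil f g = kill {λ w → Per (+ ρ) w × Ker M w}
        (λ k (f , g) → Per-T k f , Ker-T k g)
        (λ e (f , g) → Per-half e f , Ker-half e g)
        (λ (f , g) o → no-odd f g o) b c (λ (f , g) → nil f g) (f , g)
      where
      no-odd : ∀ {w} → Per (+ ρ) w → Ker M w → (∀ i → Odd (w i)) → ⊥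
      -- A period consists of ρ odd entries with ρ odd, so its sum is odd. The sum does not depend
      -- on i and lies in the kernel, where `Λ` is multiplication by 2 |M|.
      no-odd {w} f g o = odd≢0 (Fold-odd (+ 1) (+ 1) r odd-1 o (+ 0)) (zero-sum (trans
          (sym (Λ-const M (Per-Fold (+ 1) ρ (Per-≡ (sym (*-identityʳ (+ ρ))) f)) (+ 0)))
          (Λ≡0 (Ker-Fold (+ 1) (+ 1) ρ g) (+ 0))))
        where
        zero-sum : ∀ {x} → + (2 ℕ.* length M) * x ≡ + 0 → x ≡ + 0
        zero-sum {x} e = *-cancelˡ-≡ (+ (2 ℕ.* length M)) x (+ 0) (trans e (sym (*-zeroʳ (+ (2 ℕ.* length M)))))

    -- The alternating sequence lies in the kernel; it is removed by requiring a zero alternating sum.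
    antiperiodic-ρ : Nil (ρ ℕ.+ ρ) → ∀ {w} → Anti (+ ρ) w → Ker M w → ∀ i → T (+ 1) w i ≡ + 0
    antiperiodic-ρ nil {w} f g = kill {𝓛}
        (λ {v} k (f , g , z) → Anti-T k f , Ker-T k g , λ i → trans (Fold-T (- + 1) (+ 1) ρ k v i) (cong₂ _+_ (z (i + k)) (z i)))
        (λ {w} {v} e (f , g , z) → Anti-half e f , Ker-half e g ,
          λ i → 2*x≡0⇒x≡0 (trans (*-comm (+ 2) _) (trans (sym (Fold-half (- + 1) (+ 1) ρ {w} {v} e i)) (z i))))
        (λ (f , g , z) o → odd≢0 (Fold-odd (- + 1) (+ 1) r odd--1 o (+ 0)) (z (+ 0)))
        b c (λ (f , g , z) → nil (Anti⇒Per f) g)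
        -- `w` itself may be alternating, but (1 + x) w has alternating sum zero because x^ρ = -1 on
        -- w.
        (Anti-T (+ 1) f , Ker-T (+ 1) g , λ i → trans (Fold-T (- + 1) (+ 1) ρ (+ 1) w i) (alternating-Fold r f i))
      where
      𝓛 : Seq → Set
      𝓛 w = Anti (+ ρ) w × Ker M w × (∀ i → Fold (- + 1) (+ 1) ρ w i ≡ + 0)

    antiperiodic-even : ∀ n → Nil (n ℕ.+ n) → NoOdd n → ∀ {w} → Anti (+ n) w → Ker M w → ∀ i → w i ≡ + 0
    antiperiodic-even n nil no-odd f g = kill {λ w → Anti (+ n) w × Ker M w}
      (λ k (f , g) → Anti-T k f , Ker-T k g)
      (λ e (f , g) → Anti-half e f , Ker-half e g)
      (λ (f , g) → no-odd f g) b c (λ (f , g) → nil (Anti⇒Per f) g) (f , g)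

    -- The antiperiods 2ʲρ correspond to the roots of unity with 2-part of the order 2ʲ⁺¹.
    kernel : ∀ a → Nil (2 ℕ.^ a ℕ.* ρ) → (∀ j → suc (suc j) ℕ.≤ a → NoOdd (2 ℕ.^ suc j ℕ.* ρ)) →
      ∀ {w} → Per (+ (2 ℕ.^ a ℕ.* ρ)) w → Ker M w → ∀ i → T (+ 1) w i ≡ + 0
    kernel zero nil no-odd {w} f g i = cong₂ _+_ (z (i + + 1)) (z i)
      where
      z = periodic-ρ (subst Nil (ℕₚ.*-identityˡ ρ) nil) (subst (λ n → Per (+ n) w) (ℕₚ.*-identityˡ ρ) f) g
    kernel (suc zero) nil no-odd {w} f g = antiperiodic-ρ nil′ anti′ g
      where
      nil′ = subst Nil (cong (ρ ℕ.+_) (ℕₚ.+-identityʳ ρ)) nil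
      f′ : Per (+ (ρ ℕ.+ ρ)) w
      f′ = subst (λ n → Per (+ n) w) (cong (ρ ℕ.+_) (ℕₚ.+-identityʳ ρ)) f
      anti′ : Anti (+ ρ) w
      anti′ = mk λ i → i+j≡0⇒i≡-j (periodic-ρ (Nil-half ρ nil′) (⊞-Per {ρ} f′) (Ker-T (+ ρ) g) i)
    -- The antiperiodic part x^n w - w vanishes, so w already has period n.
    kernel (suc (suc a)) nil no-odd {w} f g = kernel (suc a) (Nil-half n nil′) (λ j p → no-odd j (ℕₚ.m≤n⇒m≤1+n p)) per′ g
      where
      n = 2 ℕ.^ suc a ℕ.* ρ
      double : 2 ℕ.^ suc (suc a) ℕ.* ρ ≡ n ℕ.+ n
      double = trans (ℕₚ.*-assoc 2 (2 ℕ.^ suc a) ρ) (cong (n ℕ.+_) (ℕₚ.+-identityʳ n))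
      nil′ = subst Nil double nil
      f′ : Per (+ (n ℕ.+ n)) w
      f′ = subst (λ n → Per (+ n) w) double f
      per′ : Per (+ n) w
      per′ = mk λ i → x+-y≡0 (antiperiodic-even n nil′ (no-odd a ℕₚ.≤-refl) (⊟-Anti {n} f′)
          (Ker-⊞ (Ker-shift (+ n) g) (Ker-⊡ (- + 1) g)) i)
        where
        x+-y≡0 : ∀ {x y} → x + - + 1 * y ≡ + 0 → x ≡ y
        x+-y≡0 {x} {y} e = i-j≡0⇒i≡j x y (trans (cong (_+_ x) (sym (-1*i≡-i y))) e)

  -- Cores with two elements

  module Reflected (h : ℕ) where

    pos-∸ : ∀ {s} → s ℕ.≤ h → + (h ℕ.∸ s) ≡ + h - + s
    pos-∸ {s} p = trans (sym (⊖-≥ p)) (sym (m-n≡m⊖n h s))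

    back : ∀ i h s → i + (h - s) ≡ i - s + h
    back = solve-∀
    forth : ∀ i h s → i - (h - s) + h ≡ i + s
    forth = solve-∀

    Λ-reflect-Per : ∀ {X w} → All (ℕ._≤ h) X → Per (+ h) w → ∀ i → Λ (map (h ℕ.∸_) X) w i ≡ Λ X w i
    Λ-reflect-Per [] f i = refl
    Λ-reflect-Per {s ∷ X} {w} (p ∷ ps) f i = cong₂ _+_ step (Λ-reflect-Per ps f i)
      where
      step : c (+ (h ℕ.∸ s)) w i ≡ c (+ s) w i
      step rewrite pos-∸ p = trans (cong₂ _+_
        (trans (cong w (back i (+ h) (+ s))) (per f (i - + s)))
        (trans (sym (per f (i - (+ h - + s)))) (cong w (forth i (+ h) (+ s)))))
        (+-comm (w (i - + s)) (w (i + + s)))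

    Λ-reflect-Anti : ∀ {X w} → All (ℕ._≤ h) X → Anti (+ h) w → ∀ i → Λ (map (h ℕ.∸_) X) w i ≡ - Λ X w i
    Λ-reflect-Anti [] f i = refl
    Λ-reflect-Anti {s ∷ X} {w} (p ∷ ps) f i =
      trans (cong₂ _+_ step (Λ-reflect-Anti ps f i)) (sym (neg-distrib-+ (c (+ s) w i) _))
      where
      flip : ∀ {a b} → a ≡ - b → b ≡ - a
      flip {a} {b} e = trans (sym (neg-involutive b)) (cong -_ (sym e))
      eq : ∀ a b → - a + - b ≡ - (b + a)
      eq = solve-∀
      step : c (+ (h ℕ.∸ s)) w i ≡ - c (+ s) w i
      step rewrite pos-∸ p = trans (cong₂ _+_
        (trans (cong w (back i (+ h) (+ s))) (anti f (i - + s)))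
        (flip (trans (cong w (sym (forth i (+ h) (+ s)))) (anti f (i - (+ h - + s))))))
        (eq (w (i - + s)) (w (i + + s)))

    -- A sequence of period 2h is half the sum of an h-periodic and an h-antiperiodic one; the pairs
    -- s, h - s count twice on the former and cancel on the latter.
    split-kernel : ∀ core X → All (ℕ._≤ h) X →
      (∀ {w} → Anti (+ h) w → Ker core w → ∀ i → T (+ 1) w i ≡ + 0) →
      (∀ {w} → Per (+ h) w → Ker (core ++ X ++ X) w → ∀ i → T (+ 1) w i ≡ + 0) →
      ∀ {z} → Per (+ h + + h) z → Ker (core ++ X ++ map (h ℕ.∸_) X) z → ∀ i → T (+ 1) z i ≡ + 0
    split-kernel core X p E⁻ E⁺ {z} f g i = double≡0⇒≡0 (trans
        (eq (z (i + + 1 + + h)) (z (i + + 1)) (z (i + + h)) (z i))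
        (cong₂ (λ x y → x + - + 1 * y) (E⁺ per-u ker-u i) (E⁻ anti-w ker-w i)))
      where
      L = core ++ X ++ map (h ℕ.∸_) X
      u w : Seq
      u = shift (+ h) z ⊞ z
      w = shift (+ h) z ⊞ (- + 1 ⊡ z)
      eq : ∀ a b c d → b + d + (b + d) ≡ a + b + (c + d) + - + 1 * ((a + - + 1 * b) + (c + - + 1 * d))
      eq = solve-∀
      per-u : Per (+ h) u
      per-u = ⊞-Per {h} f
      anti-w : Anti (+ h) w
      anti-w = ⊟-Anti {h} f
      ker-L-u : Ker L u
      ker-L-u = Ker-⊞ (Ker-shift (+ h) g) g
      ker-L-w : Ker L w
      ker-L-w = Ker-⊞ (Ker-shift (+ h) g) (Ker-⊡ (- + 1) g)
      ker-u : Ker (core ++ X ++ X) u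
      ker-u = mk λ i → trans (trans (Λ-++ core (X ++ X) u i) (cong (_+_ (Λ core u i)) (trans (Λ-++ X X u i)
        (trans (cong (_+_ (Λ X u i)) (sym (Λ-reflect-Per p per-u i))) (sym (Λ-++ X _ u i))))))
        (trans (sym (Λ-++ core _ u i)) (Λ≡0 ker-L-u i))
      ker-w : Ker core w
      ker-w = mk λ i → trans (trans (sym (+-identityʳ (Λ core w i))) (cong (_+_ (Λ core w i)) (trans (sym (+-inverseʳ (Λ X w i)))
        (trans (cong (_+_ (Λ X w i)) (sym (Λ-reflect-Anti p anti-w i))) (sym (Λ-++ X _ w i))))))
        (trans (sym (Λ-++ core _ w i)) (Λ≡0 ker-L-w i))

  core+2X : ∀ core X {w} → Ker (core ++ X ++ X) w → ∀ i → Λ core w i + + 2 * Λ X w i ≡ + 0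
  core+2X core X {w} g i = trans (cong (_+_ (Λ core w i)) (trans (eq (Λ X w i)) (sym (Λ-++ X X w i))))
      (trans (sym (Λ-++ core _ w i)) (Λ≡0 g i))
    where
    eq : ∀ a → + 2 * a ≡ a + a
    eq = solve-∀

  core-even : ∀ core X {w} → Ker (core ++ X ++ X) w → ∀ i → Even (Λ core w i)
  core-even core X {w} g i = ∣m+n∣n⇒∣m (∣-resp (sym (core+2X core X g i)) (divides (+ 0) refl)) (double-even (Λ X w i))

  Λ-even : ∀ X {w} → (∀ i → Odd (w i)) → ∀ i → Even (Λ X w i)
  Λ-even [] o i = divides (+ 0) refl
  Λ-even (s ∷ X) o i = ∣m∣n⇒∣m+n (odd+odd (o _) (o _)) (Λ-even X o i)

  -- On odd entries each `c s` is even, so the doubled pairs vanish modulo 4 and the core must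
  -- vanish by itself.
  core-mod-4 : ∀ core X {w} → Ker (core ++ X ++ X) w → (∀ i → Odd (w i)) → ∀ i → + 4 ∣ Λ core w i
  core-mod-4 core X {w} g o i = ∣m+n∣n⇒∣m (∣-resp (sym (core+2X core X g i)) (divides (+ 0) refl))
    (*-monoʳ-∣ (+ 2) (Λ-even X o i))

  4∤2odd : ∀ {x} → Odd x → ¬ (+ 4 ∣ + 2 * x)
  4∤2odd {x} o d = 4∤2 (∣-resp (eq x) (∣m∣n⇒∣m-n d (4∣2odd-2 o)))
    where
    eq : ∀ x → + 2 * x - (+ 2 * x - + 2) ≡ + 2
    eq = solve-∀

  -- Since 2b ≡ 2 for odd b, a + b + 2 ≡ a - b modulo 4.
  sum+2⇒Cong-4 : ∀ {w p} → (∀ i → Odd (w i)) → (∀ i → + 4 ∣ w (i + p) + w i + + 2) → Cong (+ 4) p w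
  sum+2⇒Cong-4 {w} {p} o d = mk λ i → ∣-resp (eq (w (i + p)) (w i))
      (∣m∣n⇒∣m-n (∣m∣n⇒∣m-n (d i) (4∣2odd-2 (o i))) (divides (+ 1) refl))
    where
    eq : ∀ a b → a + b + + 2 - (+ 2 * b - + 2) - + 4 ≡ a - b
    eq = solve-∀

  Cong-4×Anti⇒⊥ : ∀ {w p} k → (∀ i → Odd (w i)) → Cong (+ 4) p w → Anti (k * p) w → ⊥
  Cong-4×Anti⇒⊥ {w} {p} k o f g = 4∤2odd (o (+ 0)) (∣-resp (trans (cong (λ x → - (x - w (+ 0))) (anti g (+ 0))) (eq (w (+ 0))))
      (∣m⇒∣-m (cng (Cong-* k f) (+ 0))))
    where
    eq : ∀ a → - (- a - a) ≡ + 2 * a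
    eq = solve-∀

  c-antipode-Per : ∀ {m w} → Per (m + m) w → ∀ i → c m w i ≡ + 2 * w (i + m)
  c-antipode-Per {m} {w} f i = trans (cong (_+_ (w (i + m))) (trans (sym (per f (i - m))) (cong w (idx i m)))) (eq (w (i + m)))
    where
    idx : ∀ i m → i - m + (m + m) ≡ i + m
    idx = solve-∀
    eq : ∀ a → a + a ≡ + 2 * a
    eq = solve-∀

  c-antipode-Anti : ∀ {m w} → Anti (m + m) w → ∀ i → c m w i ≡ + 0
  c-antipode-Anti {m} {w} f i = trans (cong (_+ w (i - m)) (trans (cong w (sym (idx i m))) (anti f (i - m)))) (+-inverseˡ (w (i - m)))
    where
    idx : ∀ i m → i - m + (m + m) ≡ i + m
    idx = solve-∀

  module Pair (h a b : ℕ) (δ κ : ℤ) (a≡b+δ : + a ≡ + b + δ) (a+b+κ≡h : + a + + b + κ ≡ + h) where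

    -- Multiplied by x^(κ + a), the core is (1 + x^δ) (x^h + x^κ): the four exponents κ + 2a, κ, κ +
    -- a + b, κ + a - b equal h + δ, κ, h, κ + δ.
    factor : ∀ w k → Λ (a ∷ b ∷ []) w (k + κ + + a) ≡ T δ w (k + + h) + T δ w (k + κ)
    factor w k = trans (cong₂ (λ x y → x + w (k + κ + + a - + a) + (y + w (k + κ + + a - + b) + + 0)) (cong w i₁) (cong w i₂))
        (trans (cong₂ (λ x y → w (k + + h + δ) + x + (w (k + + h) + y + + 0)) (cong w i₃) (cong w i₄))
          (eq (w (k + + h + δ)) (w (k + κ)) (w (k + + h)) (w (k + κ + δ))))
      where
      e₁ : ∀ k κ b δ → k + κ + (b + δ) + (b + δ) ≡ k + ((b + δ) + b + κ) + δ
      e₁ = solve-∀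
      i₁ : k + κ + + a + + a ≡ k + + h + δ
      i₁ = trans (cong₂ (λ x y → k + κ + x + y) a≡b+δ a≡b+δ) (trans (e₁ k κ (+ b) δ)
        (cong (λ x → k + x + δ) (trans (cong (λ x → x + + b + κ) (sym a≡b+δ)) a+b+κ≡h)))
      e₂ : ∀ k κ a b → k + κ + a + b ≡ k + (a + b + κ)
      e₂ = solve-∀
      i₂ : k + κ + + a + + b ≡ k + + h
      i₂ = trans (e₂ k κ (+ a) (+ b)) (cong (_+_ k) a+b+κ≡h)
      e₃ : ∀ k a → k + a - a ≡ k
      e₃ = solve-∀
      i₃ : k + κ + + a - + a ≡ k + κ
      i₃ = e₃ (k + κ) (+ a)
      e₄ : ∀ k b δ → k + (b + δ) - b ≡ k + δ
      e₄ = solve-∀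
      i₄ : k + κ + + a - + b ≡ k + κ + δ
      i₄ = trans (cong (λ x → k + κ + x - + b) a≡b+δ) (e₄ (k + κ) (+ b) δ)
      eq : ∀ a b c d → a + b + (c + d + + 0) ≡ a + c + (d + b)
      eq = solve-∀

    nil : ∀ {w} → Per (+ h) w → (∀ i → Even (Λ (a ∷ b ∷ []) w i)) → ∀ i → Even (T κ (T δ w) i)
    nil {w} f e i = ∣-resp (trans (factor w i) (trans (cong (_+ T δ w (i + κ)) (per (Per-T δ f) i)) (+-comm (T δ w i) _))) (e (i + κ + + a))

    -- Where x^h = -1, the second factor is x^κ - 1.
    Per-κ : ∀ {w} → Anti (+ h) w → Ker (a ∷ b ∷ []) w → Per κ (T δ w)
    Per-κ {w} f g = mk λ i → i-j≡0⇒i≡j _ _ (trans (+-comm (T δ w (i + κ)) (- T δ w i))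
      (trans (cong (_+ T δ w (i + κ)) (sym (anti (Anti-T δ f) i))) (trans (sym (factor w i)) (Λ≡0 g (i + κ + + a)))))

    -- If κ divides h, then x^κ = 1 forces x^h = 1 on (1 + x^δ) w, where x^h = -1 as well; so this
    -- vector is zero.
    Anti-δ : ∀ t → t * κ ≡ + h → ∀ {w} → Anti (+ h) w → Ker (a ∷ b ∷ []) w → Anti δ w
    Anti-δ t tκ≡h {w} f g = mk λ i → i+j≡0⇒i≡-j
        (Per×Anti⇒0 (Per-≡ tκ≡h (Per-* t (Per-κ f g))) (Anti-T δ f) i)


  -- (1 + x)² w = 0 makes w(i + 2k) - w(i) grow linearly in k, against periodicity.
  T²≡0⇒T≡0 : ∀ {w} n → Per (+ suc n * + 2) w → (∀ i → T (+ 1) (T (+ 1) w) i ≡ + 0) → ∀ i → T (+ 1) w i ≡ + 0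
  T²≡0⇒T≡0 {w} n f z i = *-cancelˡ-≡ (+ 2 * + suc n) (v i) (+ 0) (trans (neg-≡0 (trans (sym (x-y≡z⇒x≡y+z _ _ _ (grow (suc n) i)))
      (trans (cong (_- w i) (per f i)) (+-inverseʳ (w i))))) (sym (*-zeroʳ (+ 2 * + suc n))))
    where
    v = T (+ 1) w
    neg-≡0 : ∀ {x} → - x ≡ + 0 → x ≡ + 0
    neg-≡0 {x} e = trans (sym (neg-involutive x)) (cong -_ e)
    x-y≡z⇒x≡y+z : ∀ x y z → x ≡ y - z → x - y ≡ - z
    x-y≡z⇒x≡y+z x y z refl = eq y z
      where
      eq : ∀ y z → y - z - y ≡ - z
      eq = solve-∀
    two : ∀ i → w (i + + 2) ≡ w i - + 2 * v i
    two i = trans (eq (w (i + + 1 + + 1)) (w (i + + 1)) (w i) (w (i + + 2)))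
        (trans (cong₂ (λ x y → x - + 2 * v i + (y - w (i + + 1 + + 1)) + w i) (z i) (cong w (idx i)))
          (eq₂ (w i) (v i) (w (i + + 1 + + 1))))
      where
      idx : ∀ i → i + + 2 ≡ i + + 1 + + 1
      idx = solve-∀
      eq : ∀ a b c d → d ≡ a + b + (b + c) - + 2 * (b + c) + (d - a) + c
      eq = solve-∀
      eq₂ : ∀ c v x → + 0 - + 2 * v + (x - x) + c ≡ c - + 2 * v
      eq₂ = solve-∀
    per-v : ∀ i → v (i + + 2) ≡ v i
    per-v i = trans (eq (v (i + + 2)) (v (i + + 1)) (v i)) (trans (cong₂ (λ x y → x - y + v i)
        (trans (cong (λ j → v j + v (i + + 1)) (idx i)) (z (i + + 1))) (z i)) (+-identityˡ (v i)))
      where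
      idx : ∀ i → i + + 2 ≡ i + + 1 + + 1
      idx = solve-∀
      eq : ∀ a b c → a ≡ a + b - (b + c) + c
      eq = solve-∀
    grow : ∀ k i → w (i + + k * + 2) ≡ w i - + 2 * + k * v i
    grow zero i = trans (cong w (+-identityʳ i)) (eq (w i) (v i))
      where
      eq : ∀ a b → a ≡ a - + 2 * + 0 * b
      eq = solve-∀
    grow (suc k) i = trans (cong w (idx i (+ k))) (trans (grow k (i + + 2))
        (trans (cong₂ (λ x y → x - + 2 * + k * y) (two i) (per-v i)) (eq (w i) (+ k) (v i))))
      where
      idx : ∀ i k → i + (+ 1 + k) * + 2 ≡ i + + 2 + k * + 2
      idx = solve-∀
      eq : ∀ a k v → a - + 2 * v - + 2 * k * v ≡ a - + 2 * (+ 1 + k) * v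
      eq = solve-∀

  Anti-1⇒T≡0 : ∀ {w} → Anti (+ 1) w → ∀ i → T (+ 1) w i ≡ + 0
  Anti-1⇒T≡0 {w} (mk f) i = trans (cong (_+ w i) (f i)) (+-inverseˡ (w i))

  T≡0-of-0 : ∀ {w} → (∀ i → w i ≡ + 0) → ∀ i → T (+ 1) w i ≡ + 0
  T≡0-of-0 z i = cong₂ _+_ (z (i + + 1)) (z i)

  module Antipodal (m′ : ℕ) where
    m h : ℕ
    m = suc m′
    h = m ℕ.+ m
    core : List ℕ
    core = m ∷ m′ ∷ []

    -- After a shift by m + 1, the element m - 1 contributes x^h + x². The other term `c m` is
    -- harmless: it is 2x^m where x^h = 1 and zero where x^h = -1.
    factor : ∀ w k → Λ core w (k + + m′ + + 2) ≡ c (+ m) w (k + + m′ + + 2) + (w (k + + h) + w (k + + 2))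
    factor w k = cong (_+_ (c (+ m) w (k + + m′ + + 2))) (trans (+-identityʳ _) (cong₂ _+_ (cong w (eq₁ k (+ m′))) (cong w (eq₂ k (+ m′)))))
      where
      eq₁ : ∀ k m → k + m + + 2 + m ≡ k + ((+ 1 + m) + (+ 1 + m))
      eq₁ = solve-∀
      eq₂ : ∀ k m → k + m + + 2 - m ≡ k + + 2
      eq₂ = solve-∀

    nil : ∀ {w} → Per (+ h) w → (∀ i → Even (Λ core w i)) → ∀ i → Even (T (+ 2) w i)
    nil {w} f e i = ∣m+n∣m⇒∣n (∣-resp (trans (factor w i) (cong₂ _+_ (c-antipode-Per {+ m} f (i + + m′ + + 2))
      (trans (cong (_+ w (i + + 2)) (per f i)) (+-comm (w i) _)))) (e (i + + m′ + + 2))) (double-even (w (i + + m′ + + 2 + + m)))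

    -- `c m` gives twice an odd entry, which is 2 modulo 4, and leaves w(i + 2) + w(i) + 2 ≡ 0. So w
    -- has period 2 modulo 4, and no multiple of 2 can be an antiperiod.
    no-odd : ∀ {w} k → Per (+ h) w → (∀ i → + 4 ∣ Λ core w i) → (∀ i → Odd (w i)) → ¬ Anti (k * + 2) w
    no-odd {w} k f d o = Cong-4×Anti⇒⊥ k o (sum+2⇒Cong-4 o λ i →
        ∣-resp (eq (w (i + + m′ + + 2 + + m)) (w (i + + 2)) (w i)) (∣m∣n⇒∣m-n
          (∣-resp (trans (factor w i) (cong₂ _+_ (c-antipode-Per {+ m} f (i + + m′ + + 2))
            (trans (cong (_+ w (i + + 2)) (per f i)) (+-comm (w i) _)))) (d (i + + m′ + + 2)))
          (4∣2odd-2 (o (i + + m′ + + 2 + + m)))))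
      where
      eq : ∀ x a b → + 2 * x + (a + b) - (+ 2 * x - + 2) ≡ a + b + + 2
      eq = solve-∀

    E⁻ : ∀ {w} → Anti (+ h) w → Ker core w → ∀ i → w i ≡ + 0
    E⁻ {w} f g = Per×Anti⇒0 (Per-≡ (eq (+ m)) (Per-* (+ m) per-2)) f
      where
      eq : ∀ m → m * + 2 ≡ m + m
      eq = solve-∀
      per-2 : Per (+ 2) w
      per-2 = mk λ i → i-j≡0⇒i≡j _ _ (trans (+-comm (w (i + + 2)) (- w i)) (trans
        (sym (trans (factor w i) (trans (cong₂ _+_ (c-antipode-Anti {+ m} f (i + + m′ + + 2)) (cong (_+ w (i + + 2)) (anti f i))) (+-identityˡ _))))
        (Λ≡0 g (i + + m′ + + 2))))

  -- Cores with four elements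

  -- From p to 2p: 3βp - 2βp = βp, so α + βp and -β are the next coefficients.
  bezout-3-2^ : ∀ k → ∃₂ λ α β → α * + 3 + β * + (2 ℕ.^ k) ≡ + 1
  bezout-3-2^ zero = + 0 , + 1 , refl
  bezout-3-2^ (suc k) with bezout-3-2^ k
  ... | α , β , e = α + β * p , - β , trans
      (trans (cong (λ x → (α + β * p) * + 3 + - β * x) (pos-* 2 (2 ℕ.^ k))) (eq α β p)) e
    where
    p = + (2 ℕ.^ k)
    eq : ∀ a b p → (a + b * p) * + 3 + - b * (+ 2 * p) ≡ a * + 3 + b * p
    eq = solve-∀

  -- v(i) + v(i + ρ) + v(i - ρ) ≡ 0 gives the period 3ρ, hence ρ once 2ᵏρ is a period too.
  three-term : ∀ {M v} k ρ → Cong M (+ (2 ℕ.^ k ℕ.* ρ)) v → (∀ i → M ∣ v i + v (i + + ρ) + v (i - + ρ)) → ∀ i → M ∣ + 3 * v i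
  three-term {M} {v} k ρ f d i with bezout-3-2^ k
  ... | α , β , e = ∣-resp (trans (cong (λ j → v i + v (i + + ρ) + v (i - + ρ) - (v (i + + ρ) - v i) + (v j - v (i - + ρ))) (idx i (+ ρ)))
        (eq (v i) (v (i + + ρ)) (v (i - + ρ)) ))
      (∣m∣n⇒∣m+n (∣m∣n⇒∣m-n (d i) (cng per-ρ i)) (cng per-ρ (i - + ρ)))
    where
    idx : ∀ i r → i - r + r ≡ i
    idx = solve-∀
    eq : ∀ a b c → a + b + c - (b - a) + (a - c) ≡ + 3 * a
    eq = solve-∀
    i₁ : ∀ i r → i + + 2 * r + r ≡ i + + 3 * r
    i₁ = solve-∀
    i₂ : ∀ i r → i + + 2 * r - r ≡ i + r
    i₂ = solve-∀
    i₃ : ∀ i r → i + r + r ≡ i + + 2 * r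
    i₃ = solve-∀
    i₄ : ∀ i r → i + r - r ≡ i
    i₄ = solve-∀
    eq₂ : ∀ a b c d → a + b + c - (c + a + d) ≡ b - d
    eq₂ = solve-∀
    per-3ρ : Cong M (+ 3 * + ρ) v
    per-3ρ = mk λ i → ∣-resp (trans
        (cong₂ _-_ (cong₂ (λ x y → v (i + + 2 * + ρ) + x + y) (cong v (i₁ i (+ ρ))) (cong v (i₂ i (+ ρ))))
          (cong₂ (λ x y → v (i + + ρ) + x + y) (cong v (i₃ i (+ ρ))) (cong v (i₄ i (+ ρ)))))
        (eq₂ (v (i + + 2 * + ρ)) (v (i + + 3 * + ρ)) (v (i + + ρ)) (v i)))
      (∣m∣n⇒∣m-n (d (i + + 2 * + ρ)) (d (i + + ρ)))
    eq₃ : ∀ a b p r → a * (+ 3 * r) + b * (p * r) ≡ (a * + 3 + b * p) * r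
    eq₃ = solve-∀
    per-ρ : Cong M (+ ρ) v
    per-ρ = Cong-≡ (trans (cong (λ x → α * (+ 3 * + ρ) + β * x) (pos-* (2 ℕ.^ k) ρ)) (trans (eq₃ α β (+ (2 ℕ.^ k)) (+ ρ))
      (trans (cong (_* + ρ) e) (*-identityˡ (+ ρ))))) (Cong-lin α β per-3ρ f)

  c-neg : ∀ s w i → c (- s) w i ≡ c s w i
  c-neg s w i = trans (cong (λ x → w (i - s) + w (i + x)) (neg-involutive s)) (+-comm (w (i - s)) _)

  -- `c` is even in its index, so the sign of a - b does not matter. This admits cores with e > ρ.
  c-∣-∣ : ∀ a b w i → c (+ ℕ.∣ a - b ∣) w i ≡ c (+ a - + b) w i
  c-∣-∣ a b w i with ℕₚ.≤-total a b
  ... | inj₁ p = trans (cong (λ s → c s w i) (trans (cong +_ (ℕₚ.m≤n⇒∣m-n∣≡n∸m p)) (trans (Reflected.pos-∸ b p) (eq (+ a) (+ b))))) (c-neg (+ a - + b) w i)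
    where
    eq : ∀ a b → b - a ≡ - (a - b)
    eq = solve-∀
  ... | inj₂ p = cong (λ s → c s w i) (trans (cong +_ (ℕₚ.m≤n⇒∣n-m∣≡n∸m p)) (Reflected.pos-∸ a p))

  Cong-c : ∀ {M p w} s → Cong M p w → Cong M p (c s w)
  Cong-c {M} {p} {w} s (mk f) = mk λ i → ∣-resp
      (trans (cong₂ (λ x y → w x - w (i + s) + (w y - w (i - s))) (idx i s p) (idx i (- s) p))
        (eq (w (i + p + s)) (w (i + s)) (w (i + p - s)) (w (i - s))))
      (∣m∣n⇒∣m+n (f (i + s)) (f (i - s)))
    where
    idx : ∀ i s p → i + s + p ≡ i + p + s
    idx = solve-∀
    eq : ∀ a b c d → a - b + (c - d) ≡ a + c - (b + d)
    eq = solve-∀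

  -- The elements e, ρ - e, ρ + e contribute c e * (1 + c ρ).
  module Progression (m e ρ : ℕ) where
    h : ℕ
    h = m ℕ.+ m
    core : List ℕ
    core = m ∷ e ∷ ℕ.∣ ρ - e ∣ ∷ ρ ℕ.+ e ∷ []

    factor : ∀ w i → Λ core w i ≡ c (+ m) w i + (c (+ e) w i + c (+ e) w (i + + ρ) + c (+ e) w (i - + ρ))
    factor w i = cong (_+_ (c (+ m) w i)) (trans
        (cong (λ x → c (+ e) w i + (x + (c (+ (ρ ℕ.+ e)) w i + + 0))) (c-∣-∣ ρ e w i))
        (trans (cong₂ (λ x y → c (+ e) w i + (x + (y + + 0))) (cong₂ (λ x y → w x + w y) (i₁ i (+ e) (+ ρ)) (i₂ i (+ e) (+ ρ)))
            (cong₂ (λ x y → w x + w y) (i₃ i (+ e) (+ ρ)) (i₄ i (+ e) (+ ρ))))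
          (eq (c (+ e) w i) (w (i + + ρ - + e)) (w (i - + ρ + + e)) (w (i + + ρ + + e)) (w (i - + ρ - + e)))))
      where
      i₁ : ∀ i e r → i + (r - e) ≡ i + r - e
      i₁ = solve-∀
      i₂ : ∀ i e r → i - (r - e) ≡ i - r + e
      i₂ = solve-∀
      i₃ : ∀ i e r → i + (r + e) ≡ i + r + e
      i₃ = solve-∀
      i₄ : ∀ i e r → i - (r + e) ≡ i - r - e
      i₄ = solve-∀
      eq : ∀ v a b c d → v + (a + b + (c + d + + 0)) ≡ v + (c + a) + (b + d)
      eq = solve-∀

    recentre : ∀ w i → c (+ e) w (i + + e) ≡ T (+ 2 * + e) w i
    recentre w i = cong₂ _+_ (cong w (i₁ i (+ e))) (cong w (i₂ i (+ e)))
      where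
      i₁ : ∀ i e → i + e + e ≡ i + + 2 * e
      i₁ = solve-∀
      i₂ : ∀ i e → i + e - e ≡ i
      i₂ = solve-∀

    module _ (a : ℕ) (h≡ : h ≡ 2 ℕ.^ a ℕ.* ρ) where

      E⁻ : ∀ {w} → Anti (+ h) w → Ker core w → Anti (+ 2 * + e) w
      E⁻ {w} f g = mk λ i → i+j≡0⇒i≡-j (trans (sym (recentre w i)) (v≡0 (i + + e)))
        where
        per-2h : Per (+ (2 ℕ.^ suc a ℕ.* ρ)) w
        per-2h = Per-≡ (cong +_ (trans (cong (λ n → n ℕ.+ n) h≡) (trans (cong (n ℕ.+_) (sym (ℕₚ.+-identityʳ n))) (sym (ℕₚ.*-assoc 2 (2 ℕ.^ a) ρ))))) (Anti⇒Per f)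
          where
          n = 2 ℕ.^ a ℕ.* ρ
        v≡0 : ∀ i → c (+ e) w i ≡ + 0
        -- Modulus 0 makes `three-term` exact. Antiperiod h only gives period 2h, hence `suc a`.
        v≡0 i = *-cancelˡ-≡ (+ 3) _ (+ 0) (0∣⇒≡0 (three-term (suc a) ρ (Cong-c (+ e) (Per⇒Cong per-2h))
          (λ i → ∣-resp (trans (sym (Λ≡0 g i)) (trans (factor w i) (trans (cong (_+ _) (c-antipode-Anti {+ m} f i)) (+-identityˡ _)))) (divides (+ 0) refl)) i))

      nil : ∀ {w} → Per (+ h) w → (∀ i → Even (Λ core w i)) → ∀ i → Even (T (+ 2 * + e) w i)
      nil {w} f d i = ∣-resp (recentre w i) (∣-resp (eq (c (+ e) w (i + + e)))
          (∣m∣n⇒∣m-n (three-term a ρ (Cong-c (+ e) (Per⇒Cong (Per-≡ (cong +_ h≡) f))) three (i + + e)) (double-even (c (+ e) w (i + + e)))))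
        where
        three : ∀ i → Even (c (+ e) w i + c (+ e) w (i + + ρ) + c (+ e) w (i - + ρ))
        three i = ∣m+n∣m⇒∣n (∣-resp (trans (factor w i) (cong (_+ _) (c-antipode-Per {+ m} f i))) (d i)) (double-even (w (i + + m)))
        eq : ∀ x → + 3 * x - + 2 * x ≡ x
        eq = solve-∀

      -- `c m` gives 2 modulo 4, and 2 ≡ 2 + 2 + 2; so it is absorbed by adding 2 to each of the
      -- three terms, and c e w + 2 is annihilated by 1 + c ρ modulo 4. Hence c e w + 2 ≡ 0, and w
      -- has period 2e modulo 4.
      no-odd-high : ∀ {w} k → Per (+ h) w → (∀ i → + 4 ∣ Λ core w i) → (∀ i → Odd (w i)) → ¬ Anti (k * (+ 2 * + e)) w
      no-odd-high {w} k f d o = Cong-4×Anti⇒⊥ k o (sum+2⇒Cong-4 o λ i → ∣-resp (cong (_+ + 2) (recentre w i)) (g≡0 (i + + e)))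
        where
        g : Seq
        g i = c (+ e) w i + + 2
        cong-g : Cong (+ 4) (+ (2 ℕ.^ a ℕ.* ρ)) g
        cong-g = mk λ i → ∣-resp (eq (c (+ e) w (i + + (2 ℕ.^ a ℕ.* ρ))) (c (+ e) w i)) (cng (Cong-c (+ e) (Per⇒Cong (Per-≡ (cong +_ h≡) f))) i)
          where
          eq : ∀ a b → a - b ≡ a + + 2 - (b + + 2)
          eq = solve-∀
        three : ∀ i → + 4 ∣ g i + g (i + + ρ) + g (i - + ρ)
        three i = ∣-resp (eq (w (i + + m)) (c (+ e) w i) (c (+ e) w (i + + ρ)) (c (+ e) w (i - + ρ)))
            (∣m∣n⇒∣m-n (∣m∣n⇒∣m-n (∣-resp (trans (factor w i) (cong (_+ _) (c-antipode-Per {+ m} f i))) (d i)) (4∣2odd-2 (o (i + + m)))) (divides (- + 1) refl))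
          where
          eq : ∀ x a b c → + 2 * x + (a + b + c) - (+ 2 * x - + 2) - - + 4 ≡ a + + 2 + (b + + 2) + (c + + 2)
          eq = solve-∀
        g≡0 : ∀ i → + 4 ∣ g i
        g≡0 i = ∣-resp (eq (g i)) (∣m∣n⇒∣m-n (∣m⇒∣m*n (g i) (divides (+ 1) refl)) (three-term a ρ cong-g three i))
          where
          eq : ∀ x → + 4 * x - + 3 * x ≡ x
          eq = solve-∀

  IsEven IsOdd : ℕ → Set
  IsEven s = ∃ λ t → s ≡ 2 ℕ.* t
  IsOdd s = ∃ λ t → s ≡ suc (2 ℕ.* t)

  parity : ∀ n → IsEven n ⊎ IsOdd n
  parity zero = inj₁ (0 , refl)
  parity (suc n) with parity n
  ... | inj₁ (t , e) = inj₂ (t , cong suc e)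
  ... | inj₂ (t , e) = inj₁ (suc t , trans (cong suc e) (sym (ℕₚ.*-suc 2 t)))

  +even : ∀ {s} ((t , _) : IsEven s) → + s ≡ + 2 * + t
  +even (t , e) = trans (cong +_ e) (pos-* 2 t)

  +odd : ∀ {s} ((t , _) : IsOdd s) → + s ≡ + 1 + + 2 * + t
  +odd (t , e) = trans (cong +_ e) (cong (_+_ (+ 1)) (pos-* 2 t))

  c-even-multiple : ∀ {p W s} k → s ≡ k * (p + p) → Anti p W → ∀ i → c s W i ≡ + 2 * W i
  c-even-multiple {p} {W} k refl f i = trans (cong₂ _+_ (per (Per-* k (Anti⇒Per f)) i)
      (trans (cong (λ x → W (i + x)) (neg-distribˡ-* k (p + p))) (per (Per-* (- k) (Anti⇒Per f)) i))) (eq (W i))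
    where
    eq : ∀ a → a + a ≡ + 2 * a
    eq = solve-∀

  c-odd-multiple : ∀ {p W s} k → s ≡ k * (p + p) + p → Anti p W → ∀ i → c s W i ≡ - + 2 * W i
  c-odd-multiple {p} {W} k refl f i = trans (cong₂ _+_ (anti (Anti-odd k f) i)
      (trans (cong (λ x → W (i + x)) (idx k p)) (anti (Anti-odd (- k - + 1) f) i))) (eq (W i))
    where
    idx : ∀ k p → - (k * (p + p) + p) ≡ (- k - + 1) * (p + p) + p
    idx = solve-∀
    eq : ∀ a → - a + - a ≡ - + 2 * a
    eq = solve-∀

  c-half-odd-multiple : ∀ {p W s} k → + 2 * s ≡ k * (p + p) + p → Anti p W → ∀ i → c s W i ≡ + 0
  c-half-odd-multiple {p} {W} {s} k e f i = trans
      (cong (_+ W (i - s)) (trans (cong W (idx i s)) (trans (cong (λ x → W (i - s + x)) e) (anti (Anti-odd k f) (i - s)))))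
      (+-inverseˡ (W (i - s)))
    where
    idx : ∀ i s → i + s ≡ i - s + + 2 * s
    idx = solve-∀

  module _ {W : Seq} (f : Anti (+ 2) W) where

    c-odd≡0 : ∀ {s} → IsOdd s → ∀ i → c (+ s) W i ≡ + 0
    c-odd≡0 {s} o@(t , _) = c-half-odd-multiple {+ 2} {W} {+ s} (+ t) (trans (cong (+ 2 *_) (+odd o)) (eq (+ t))) f
      where
      eq : ∀ t → + 2 * (+ 1 + + 2 * t) ≡ t * (+ 2 + + 2) + + 2
      eq = solve-∀

    Λ-odds≡0 : ∀ {X} → All IsOdd X → ∀ i → Λ X W i ≡ + 0
    Λ-odds≡0 [] i = refl
    Λ-odds≡0 (o ∷ os) i = cong₂ _+_ (c-odd≡0 o i) (Λ-odds≡0 os i)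

    module _ (o : ∀ i → Odd (W i)) where

      -- Where x² = -1, `c s` is ±2 for even s, and on odd entries the sign does not matter modulo
      -- 4.
      c-even-mod-4 : ∀ {s} → IsEven s → ∀ i → + 4 ∣ c (+ s) W i - + 2
      c-even-mod-4 {s} e@(t , _) i with parity t
      ... | inj₁ t₂@(k , _) = ∣-resp (cong (_- + 2) (sym (c-even-multiple {+ 2} (+ k) (trans (+even e) (trans (cong (+ 2 *_) (+even t₂)) (eq (+ k)))) f i))) (4∣2odd-2 (o i))
        where
        eq : ∀ k → + 2 * (+ 2 * k) ≡ k * (+ 2 + + 2)
        eq = solve-∀
      ... | inj₂ t₂@(k , _) = ∣-resp (trans (eq₂ (W i)) (cong (_- + 2) (sym (c-odd-multiple {+ 2} (+ k) (trans (+even e) (trans (cong (+ 2 *_) (+odd t₂)) (eq (+ k)))) f i))))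
          (∣m∣n⇒∣m-n (4∣2odd-2 (o i)) (∣m⇒∣m*n (W i) (divides (+ 1) refl)))
        where
        eq : ∀ k → + 2 * (+ 1 + + 2 * k) ≡ k * (+ 2 + + 2) + + 2
        eq = solve-∀
        eq₂ : ∀ x → + 2 * x - + 2 - + 4 * x ≡ - + 2 * x - + 2
        eq₂ = solve-∀

      Λ-evens-mod-4 : ∀ {X} → All IsEven X → ∀ i → + 4 ∣ Λ X W i - + 2 * + length X
      Λ-evens-mod-4 [] i = divides (+ 0) refl
      Λ-evens-mod-4 {s ∷ X} (e ∷ es) i = ∣-resp (eq (c (+ s) W i) (Λ X W i) (+ length X))
          (∣m∣n⇒∣m+n (c-even-mod-4 e i) (Λ-evens-mod-4 es i))
        where
        eq : ∀ a b l → a - + 2 + (b - + 2 * l) ≡ a + b - + 2 * (+ 1 + l)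
        eq = solve-∀

  module _ {W : Seq} (f : Anti (+ 4) W) (o : ∀ i → Odd (W i)) where
    private
      2W-mod : ∀ {x} j → x ≡ + 2 * W j → + 4 ∣ x - + 2
      2W-mod j e = ∣-resp (cong (_- + 2) (sym e)) (4∣2odd-2 (o j))

      i₁ : ∀ i s → i + + 2 + s ≡ i - s + (+ 2 * s + + 2)
      i₁ = solve-∀
      i₂ : ∀ i s → i + s ≡ i + + 2 - s + (+ 2 * s - + 2)
      i₂ = solve-∀

      +at : ∀ {x} k j → x ≡ k * (+ 4 + + 4) → W (j + x) ≡ W j
      +at k j refl = per (Per-* k (Anti⇒Per f)) j

      -at : ∀ {x} k j → x ≡ k * (+ 4 + + 4) + + 4 → W (j + x) ≡ - W j
      -at k j refl = anti (Anti-odd k f) j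

    -- Where x⁴ = -1, `c s` acts as ±√2 for odd s, with no fixed residue modulo 4. After
    -- multiplication by 1 + x², two of the four terms cancel and the other two coincide, leaving
    -- twice an odd entry.
    T₂-c-odd-mod-4 : ∀ {s} → IsOdd s → ∀ i → + 4 ∣ T (+ 2) (c (+ s) W) i - + 2
    T₂-c-odd-mod-4 {s} od@(t , _) i with parity t
    ... | inj₁ t₂@(k , _) = 2W-mod (i + + 2 - + s) (trans
          (cong₂ (λ x y → x + W (i + + 2 - + s) + (y + W (i - + s)))
            (trans (cong W (i₁ i (+ s))) (-at (+ k) (i - + s) (trans (cong (λ x → + 2 * x + + 2) s≡) (eq₁ (+ k)))))
            (trans (cong W (i₂ i (+ s))) (+at (+ k) (i + + 2 - + s) (trans (cong (λ x → + 2 * x - + 2) s≡) (eq₂ (+ k))))))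
          (eq (W (i - + s)) (W (i + + 2 - + s))))
      where
      s≡ : + s ≡ + 1 + + 2 * (+ 2 * + k)
      s≡ = trans (+odd od) (cong (λ x → + 1 + + 2 * x) (+even t₂))
      eq₁ : ∀ k → + 2 * (+ 1 + + 2 * (+ 2 * k)) + + 2 ≡ k * (+ 4 + + 4) + + 4
      eq₁ = solve-∀
      eq₂ : ∀ k → + 2 * (+ 1 + + 2 * (+ 2 * k)) - + 2 ≡ k * (+ 4 + + 4)
      eq₂ = solve-∀
      eq : ∀ a b → - a + b + (b + a) ≡ + 2 * b
      eq = solve-∀
    ... | inj₂ t₂@(k , _) = 2W-mod (i - + s) (trans
          (cong₂ (λ x y → x + W (i + + 2 - + s) + (y + W (i - + s)))
            (trans (cong W (i₁ i (+ s))) (+at (+ suc k) (i - + s) (trans (cong (λ x → + 2 * x + + 2) s≡) (eq₁ (+ k)))))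
            (trans (cong W (i₂ i (+ s))) (-at (+ k) (i + + 2 - + s) (trans (cong (λ x → + 2 * x - + 2) s≡) (eq₂ (+ k))))))
          (eq (W (i - + s)) (W (i + + 2 - + s))))
      where
      s≡ : + s ≡ + 1 + + 2 * (+ 1 + + 2 * + k)
      s≡ = trans (+odd od) (cong (λ x → + 1 + + 2 * x) (+odd t₂))
      eq₁ : ∀ k → + 2 * (+ 1 + + 2 * (+ 1 + + 2 * k)) + + 2 ≡ (+ 1 + k) * (+ 4 + + 4)
      eq₁ = solve-∀
      eq₂ : ∀ k → + 2 * (+ 1 + + 2 * (+ 1 + + 2 * k)) - + 2 ≡ k * (+ 4 + + 4) + + 4
      eq₂ = solve-∀
      eq : ∀ a b → a + b + (- b + a) ≡ + 2 * a
      eq = solve-∀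

    -- s ≡ 2 modulo 4 gives c s = 0; 4 ∣ s gives twice one entry, and 1 + x² adds two of these.
    T₂-c-even-mod-4 : ∀ {s} → IsEven s → ∀ i → + 4 ∣ T (+ 2) (c (+ s) W) i
    T₂-c-even-mod-4 {s} ev@(t , _) i with parity t
    ... | inj₂ t₂@(k , _) = ∣-resp (sym (cong₂ _+_ (zero′ (i + + 2)) (zero′ i))) (divides (+ 0) refl)
      where
      eq : ∀ k → + 2 * (+ 2 * (+ 1 + + 2 * k)) ≡ k * (+ 4 + + 4) + + 4
      eq = solve-∀
      zero′ : ∀ i → c (+ s) W i ≡ + 0
      zero′ = c-half-odd-multiple {+ 4} {W} {+ s} (+ k) (trans (cong (+ 2 *_) (trans (+even ev) (cong (+ 2 *_) (+odd t₂)))) (eq (+ k))) f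
    ... | inj₁ t₂@(k , _) = ∣-resp (sym (trans (cong₂ _+_ (twice (i + + 2)) (twice i)) (eq₂ (W (i + + 2 - + s)) (W (i - + s)))))
        (2[odd+odd] (o (i + + 2 - + s)) (o (i - + s)))
      where
      idx : ∀ i s → i + s ≡ i - s + + 2 * s
      idx = solve-∀
      eq : ∀ k → + 2 * (+ 2 * (+ 2 * k)) ≡ k * (+ 4 + + 4)
      eq = solve-∀
      eq₁ : ∀ a → a + a ≡ + 2 * a
      eq₁ = solve-∀
      eq₂ : ∀ a b → + 2 * a + + 2 * b ≡ + 2 * (a + b)
      eq₂ = solve-∀
      twice : ∀ i → c (+ s) W i ≡ + 2 * W (i - + s)
      twice i = trans (cong (_+ W (i - + s)) (trans (cong W (idx i (+ s)))
        (+at (+ k) (i - + s) (trans (cong (+ 2 *_) (trans (+even ev) (cong (+ 2 *_) (+even t₂)))) (eq (+ k)))))) (eq₁ (W (i - + s)))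

    T₂-Λ-odds-mod-4 : ∀ {X} → All IsOdd X → ∀ i → + 4 ∣ T (+ 2) (Λ X W) i - + 2 * + length X
    T₂-Λ-odds-mod-4 [] i = divides (+ 0) refl
    T₂-Λ-odds-mod-4 {s ∷ X} (e ∷ es) i = ∣-resp (eq (c (+ s) W (i + + 2)) (c (+ s) W i) (Λ X W (i + + 2)) (Λ X W i) (+ length X))
        (∣m∣n⇒∣m+n (T₂-c-odd-mod-4 e i) (T₂-Λ-odds-mod-4 es i))
      where
      eq : ∀ a b c d l → a + b - + 2 + (c + d - + 2 * l) ≡ a + c + (b + d) - + 2 * (+ 1 + l)
      eq = solve-∀

    T₂-Λ-evens-mod-4 : ∀ {X} → All IsEven X → ∀ i → + 4 ∣ T (+ 2) (Λ X W) i
    T₂-Λ-evens-mod-4 [] i = divides (+ 0) refl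
    T₂-Λ-evens-mod-4 {s ∷ X} (e ∷ es) i = ∣-resp (eq (c (+ s) W (i + + 2)) (c (+ s) W i) (Λ X W (i + + 2)) (Λ X W i))
        (∣m∣n⇒∣m+n (T₂-c-even-mod-4 e i) (T₂-Λ-evens-mod-4 es i))
      where
      eq : ∀ a b c d → a + b + (c + d) ≡ a + c + (b + d)
      eq = solve-∀

  -- Folding reduces the antiperiods 2ρ and 4ρ to 2 and 4, the fourth and eighth roots of unity.
  module Fold-down (r : ℕ) where
    ρ : ℕ
    ρ = suc (2 ℕ.* r)

    ρ≡ : + ρ ≡ + 1 + + 2 * + r
    ρ≡ = cong (_+_ (+ 1)) (pos-* 2 r)

    -- Summing ρ terms at distance 2p gives period 2p, and pρ ≡ p modulo 2p because ρ is odd. For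
    -- the same reason odd entries stay odd.
    fold-Anti : ∀ {w} p → Anti (+ (p ℕ.* ρ)) w → Anti (+ p) (Fold (+ 1) (+ p + + p) ρ w)
    fold-Anti {w} p f = Anti-≡ (eq (+ p) (+ r)) (Per-Anti (Per-* (- + r) (Per-Fold (+ p + + p) ρ (Per-≡ twice (Anti⇒Per f))))
        (Anti-≡ pρ (Anti-Fold (+ 1) (+ p + + p) ρ f)))
      where
      pρ : + (p ℕ.* ρ) ≡ + p * (+ 1 + + 2 * + r)
      pρ = trans (pos-* p ρ) (cong (+ p *_) ρ≡)
      twice : + (p ℕ.* ρ) + + (p ℕ.* ρ) ≡ + ρ * (+ p + + p)
      twice = trans (cong (λ x → x + x) (pos-* p ρ)) (eq₁ (+ p) (+ ρ))
        where
        eq₁ : ∀ p r → p * r + p * r ≡ r * (p + p)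
        eq₁ = solve-∀
      eq : ∀ p r → - r * (p + p) + p * (+ 1 + + 2 * r) ≡ p
      eq = solve-∀

    module _ (core Xe Xo : List ℕ) (evens : All IsEven Xe) (odds : All IsOdd Xo) where
      private
        X = Xe ++ Xo

      -- Where x² = -1, odd elements vanish and even ones give 2 modulo 4. Half of the kernel
      -- equation becomes 2τ + 2|Xe| ≡ 0 modulo 4.
      level-1 : ∀ τ → Odd (τ + + length Xe) → (∀ {W} → Anti (+ 2) W → ∀ i → Λ core W i ≡ + 2 * (+ 2 * τ * W i)) →
        ∀ {w} → Anti (+ (2 ℕ.* ρ)) w → Ker (core ++ X ++ X) w → (∀ i → Odd (w i)) → ⊥
      level-1 τ odd-τ core≡ {w} f g o = 4∤2odd odd-τ (∣-resp (eq (Λ Xe W (+ 0)) (+ length Xe) τ (W (+ 0)))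
          (∣m∣n⇒∣m-n (∣m∣n⇒∣m-n (∣-resp (sym half) (divides (+ 0) refl)) (Λ-evens-mod-4 fW oW evens (+ 0))) (∣n⇒∣m*n τ (4∣2odd-2 (oW (+ 0))))))
        where
        W = Fold (+ 1) (+ 2 + + 2) ρ w
        fW : Anti (+ 2) W
        fW = fold-Anti 2 f
        oW : ∀ i → Odd (W i)
        oW = Fold-odd (+ 1) (+ 2 + + 2) r odd-1 o
        gW : Ker (core ++ X ++ X) W
        gW = Ker-Fold (+ 1) (+ 2 + + 2) ρ g
        half : + 2 * τ * W (+ 0) + Λ Xe W (+ 0) ≡ + 0
        half = 2*x≡0⇒x≡0 (trans (eq₁ (+ 2 * τ * W (+ 0)) (Λ Xe W (+ 0))) (trans
          (cong₂ (λ x y → x + + 2 * (Λ Xe W (+ 0) + y)) (sym (core≡ fW (+ 0))) (sym (Λ-odds≡0 fW odds (+ 0))))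
          (trans (cong (λ x → Λ core W (+ 0) + + 2 * x) (sym (Λ-++ Xe Xo W (+ 0)))) (core+2X core X gW (+ 0)))))
          where
          eq₁ : ∀ a b → + 2 * (a + b) ≡ + 2 * a + + 2 * (b + + 0)
          eq₁ = solve-∀
        eq : ∀ y l t w → + 2 * t * w + y - (y - + 2 * l) - t * (+ 2 * w - + 2) ≡ + 2 * (t + l)
        eq = solve-∀

    module _ (m e : ℕ) (Xe Xo : List ℕ) (evens : All IsEven Xe) (odds : All IsOdd Xo) where
      private
        X = Xe ++ Xo
        core = Progression.core m e ρ

      -- Where x⁴ = -1, half of the kernel equation is (σ + τ) + τ c ρ + Xe + Xo = 0. Multiplied by
      -- 1 + x² and taken modulo 4, the terms σ + τ and Xe vanish, and 2 + 2|Xo| remains.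
      level-2 : ∀ σ τ → Odd σ → Odd τ → IsEven (length Xo) →
        (∀ {W} → Anti (+ 4) W → ∀ i → c (+ m) W i ≡ + 2 * σ * W i) →
        (∀ {W} → Anti (+ 4) W → ∀ i → c (+ e) W i ≡ + 2 * τ * W i) →
        ∀ {w} → Anti (+ (4 ℕ.* ρ)) w → Ker (core ++ X ++ X) w → (∀ i → Odd (w i)) → ⊥
      level-2 σ τ oσ oτ even-Xo cm≡ ce≡ {w} f g o = 4∤2odd odd-Xo (∣-resp (eq (W (+ 2)) (W (+ 0)) σ τ (c (+ ρ) W (+ 2)) (c (+ ρ) W (+ 0))
            (Λ Xe W (+ 2)) (Λ Xe W (+ 0)) (Λ Xo W (+ 2)) (Λ Xo W (+ 0)) (+ length Xo))
          (∣m∣n⇒∣m-n (∣m∣n⇒∣m-n (∣m∣n⇒∣m-n (∣m∣n⇒∣m-n (∣m∣n⇒∣m-n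
            (∣-resp (sym (cong₂ _+_ (half (+ 2)) (half (+ 0)))) (divides (+ 0) refl))
            (4∣even*even (odd+odd oσ oτ) (odd+odd (oW (+ 2)) (oW (+ 0)))))
            (∣n⇒∣m*n τ (T₂-c-odd-mod-4 fW oW (r , refl) (+ 0))))
            (*-monoʳ-∣ (+ 2) (2∣x-1 oτ)))
            (T₂-Λ-evens-mod-4 fW oW evens (+ 0)))
            (T₂-Λ-odds-mod-4 fW oW odds (+ 0))))
        where
        W = Fold (+ 1) (+ 4 + + 4) ρ w
        fW : Anti (+ 4) W
        fW = fold-Anti 4 f
        oW : ∀ i → Odd (W i)
        oW = Fold-odd (+ 1) (+ 4 + + 4) r odd-1 o
        gW : Ker (core ++ X ++ X) W
        gW = Ker-Fold (+ 1) (+ 4 + + 4) ρ g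
        4∣even*even : ∀ {x y} → Even x → Even y → + 4 ∣ x * y
        4∣even*even {_} {_} (divides p refl) (divides q refl) = divides (p * q) (eq₀ p q)
          where
          eq₀ : ∀ p q → p * + 2 * (q * + 2) ≡ p * q * + 4
          eq₀ = solve-∀
        odd-Xo : Odd (+ 1 + + length Xo)
        odd-Xo = odd (∣-resp (trans (sym (+even even-Xo)) (eq₀ (+ length Xo))) (double-even (+ proj₁ even-Xo)))
          where
          eq₀ : ∀ x → x ≡ + 1 + x - + 1
          eq₀ = solve-∀
        half : ∀ i → (σ + τ) * W i + τ * c (+ ρ) W i + (Λ Xe W i + Λ Xo W i) ≡ + 0
        half i = 2*x≡0⇒x≡0 (trans (eq₁ σ τ (W i) (W (i + + ρ)) (W (i - + ρ)) (Λ Xe W i + Λ Xo W i)) (trans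
          (cong₂ (λ x y → x + + 2 * y) (sym (trans (Progression.factor m e ρ W i)
            (cong₂ _+_ (cm≡ fW i) (cong₂ _+_ (cong₂ _+_ (ce≡ fW i) (ce≡ fW (i + + ρ))) (ce≡ fW (i - + ρ))))))
            (sym (Λ-++ Xe Xo W i)))
          (core+2X core X gW i)))
          where
          eq₁ : ∀ s t w a b x → + 2 * ((s + t) * w + t * (a + b) + x) ≡ + 2 * s * w + (+ 2 * t * w + + 2 * t * a + + 2 * t * b) + + 2 * x
          eq₁ = solve-∀
        eq : ∀ w₂ w₀ s t c₂ c₀ e₂ e₀ o₂ o₀ l → (s + t) * w₂ + t * c₂ + (e₂ + o₂) + ((s + t) * w₀ + t * c₀ + (e₀ + o₀))
          - (s + t) * (w₂ + w₀) - t * (c₂ + c₀ - + 2) - + 2 * (t - + 1) - (e₂ + e₀) - (o₂ + o₀ - + 2 * l) ≡ + 2 * (+ 1 + l)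
        eq = solve-∀

  -- Kernels of the half sets

  module Balance {W : Seq} (f : Anti (+ 1) W) where

    c-even : ∀ {s} → IsEven s → ∀ i → c (+ s) W i ≡ + 2 * W i
    c-even e@(t , _) = c-even-multiple {+ 1} (+ t) (trans (+even e) (*-comm (+ 2) (+ t))) f

    c-odd : ∀ {s} → IsOdd s → ∀ i → c (+ s) W i ≡ - + 2 * W i
    c-odd o@(t , _) = c-odd-multiple {+ 1} (+ t) (trans (+odd o) (eq (+ t))) f
      where
      eq : ∀ t → + 1 + + 2 * t ≡ t * (+ 1 + + 1) + + 1
      eq = solve-∀

    Λ-evens : ∀ {X} → All IsEven X → ∀ i → Λ X W i ≡ + 2 * + length X * W i
    Λ-evens [] i = refl
    Λ-evens {s ∷ X} (e ∷ es) i = trans (cong₂ _+_ (c-even e i) (Λ-evens es i)) (eq (W i) (+ length X))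
      where
      eq : ∀ w l → + 2 * w + + 2 * l * w ≡ + 2 * (+ 1 + l) * w
      eq = solve-∀

    Λ-odds : ∀ {X} → All IsOdd X → ∀ i → Λ X W i ≡ - + 2 * + length X * W i
    Λ-odds [] i = refl
    Λ-odds {s ∷ X} (e ∷ es) i = trans (cong₂ _+_ (c-odd e i) (Λ-odds es i)) (eq (W i) (+ length X))
      where
      eq : ∀ w l → - + 2 * w + - + 2 * l * w ≡ - + 2 * (+ 1 + l) * w
      eq = solve-∀

    -- s and h - s have opposite parity, so each pair cancels and X is free.
    odd-h : ∀ {h core X} → IsOdd h → All (ℕ._≤ h) X → Ker core W → Ker (core ++ X ++ map (h ℕ.∸_) X) W
    odd-h {h} {core} {X} o@(t , _) p g = mk λ i → trans (Λ-++ core _ W i) (cong₂ _+_ (Λ≡0 g i) (trans (Λ-++ X _ W i)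
        (trans (cong (_+_ (Λ X W i)) (Reflected.Λ-reflect-Anti h p anti-h i)) (+-inverseʳ (Λ X W i)))))
      where
      anti-h : Anti (+ h) W
      anti-h = Anti-≡ (trans (eq (+ t)) (sym (+odd o))) (Anti-odd (+ t) f)
        where
        eq : ∀ t → t * (+ 1 + + 1) + + 1 ≡ + 1 + + 2 * t
        eq = solve-∀

    -- s and h - s have the same parity, so each pair counts ±4; k is the surplus of the core in the
    -- same unit.
    even-h : ∀ {h core Xe Xo} k → IsEven h → All (ℕ._≤ h) (Xe ++ Xo) → All IsEven Xe → All IsOdd Xo →
      (∀ i → Λ core W i ≡ + 4 * k * W i) → k + + length Xe ≡ + length Xo →
      Ker (core ++ (Xe ++ Xo) ++ map (h ℕ.∸_) (Xe ++ Xo)) W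
    even-h {h} {core} {Xe} {Xo} k e@(t , _) p evens odds core≡ sizes = mk λ i → trans (Λ-++ core _ W i) (trans
        (cong₂ _+_ (core≡ i) (trans (Λ-++ (Xe ++ Xo) _ W i) (trans (cong (_+_ (Λ (Xe ++ Xo) W i)) (Reflected.Λ-reflect-Per h p per-h i))
          (cong (λ x → x + x) (trans (Λ-++ Xe Xo W i) (cong₂ _+_ (Λ-evens evens i) (trans (Λ-odds odds i)
            (cong (λ l → - + 2 * l * W i) (sym sizes)))))))))
        (eq₂ k (W i) (+ length Xe)))
      where
      per-h : Per (+ h) W
      per-h = Per-≡ (trans (eq (+ t)) (sym (+even e))) (Per-* (+ t) (Anti⇒Per f))
        where
        eq : ∀ t → t * (+ 1 + + 1) ≡ + 2 * t
        eq = solve-∀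
      eq₂ : ∀ k w l → + 4 * k * w + (+ 2 * l * w + - + 2 * (k + l) * w + (+ 2 * l * w + - + 2 * (k + l) * w)) ≡ + 0
      eq₂ = solve-∀

  T-even-T : ∀ {k w} m → (∀ i → Even (T k w i)) → ∀ i → Even (T k (T m w) i)
  T-even-T {k} {w} m e i = ∣-resp (trans (cong (λ j → w j + w (i + m) + (w (i + k) + w i)) (idx i m k))
      (eq (w (i + k + m)) (w (i + m)) (w (i + k)) (w i))) (∣m∣n⇒∣m+n (e (i + m)) (e i))
    where
    idx : ∀ i m k → i + m + k ≡ i + k + m
    idx = solve-∀
    eq : ∀ a b c d → a + b + (c + d) ≡ a + c + (b + d)
    eq = solve-∀

  2^-split : ∀ {j a} → j ℕ.≤ a → ∀ ρ → + (2 ℕ.^ a ℕ.* ρ) ≡ + (2 ℕ.^ (a ℕ.∸ j)) * + (2 ℕ.^ j ℕ.* ρ)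
  2^-split {j} {a} p ρ = trans (cong (λ n → + (n ℕ.* ρ)) (trans (cong (2 ℕ.^_) (sym (ℕₚ.m∸n+n≡m p))) (ℕₚ.^-distribˡ-+-* 2 (a ℕ.∸ j) j)))
    (trans (cong +_ (ℕₚ.*-assoc (2 ℕ.^ (a ℕ.∸ j)) (2 ℕ.^ j) ρ)) (pos-* (2 ℕ.^ (a ℕ.∸ j)) _))

  Anti⇒Per-2^ : ∀ {j a w} ρ → suc j ℕ.≤ a → Anti (+ (2 ℕ.^ j ℕ.* ρ)) w → Per (+ (2 ℕ.^ a ℕ.* ρ)) w
  Anti⇒Per-2^ {j} {a} ρ p f = Per-≡ (trans (cong (+ (2 ℕ.^ (a ℕ.∸ suc j)) *_) (cong +_ (trans (cong (n ℕ.+_) (sym (ℕₚ.+-identityʳ n)))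
      (sym (ℕₚ.*-assoc 2 (2 ℕ.^ j) ρ))))) (sym (2^-split p ρ))) (Per-* (+ (2 ℕ.^ (a ℕ.∸ suc j))) (Anti⇒Per f))
    where
    n = 2 ℕ.^ j ℕ.* ρ

  module _ (h s : ℕ) (core′ X : List ℕ) where
    private
      core = s ∷ core′
      M = core ++ X ++ X

    periodic-kernel : ∀ a r b c → h ≡ 2 ℕ.^ a ℕ.* suc (2 ℕ.* r) →
      (∀ {w} → Per (+ h) w → (∀ i → Even (Λ core w i)) → ∀ i → Even (T (+ (2 ℕ.^ b)) (T (+ (2 ℕ.^ c)) w) i)) →
      (∀ j → suc (suc j) ℕ.≤ a → ∀ {w} → Per (+ h) w → Anti (+ (2 ℕ.^ suc j ℕ.* suc (2 ℕ.* r))) w → Ker M w → (∀ i → Odd (w i)) → ⊥) →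
      ∀ {w} → Per (+ h) w → Ker M w → ∀ i → T (+ 1) w i ≡ + 0
    periodic-kernel a r b c refl nil no-odd = Kernel.kernel s (core′ ++ X ++ X) r b c a
      (λ f g → nil f (core-even core X g))
      (λ j p f g o → no-odd j p (Anti⇒Per-2^ (suc (2 ℕ.* r)) p f) f g o)

  Alternates : ℕ → List ℕ → Set
  Alternates h L = ∀ {z} → Per (+ h + + h) z → Ker L z → ∀ i → T (+ 1) z i ≡ + 0

  module OddOrder (g′ : ℕ) where
    g h : ℕ
    g = suc g′
    h = suc (2 ℕ.* g)

    private
      h≡ : + g + + g′ + + 2 ≡ + h
      h≡ = cong +_ (eq g′)
        where
        eq : ∀ g → suc g ℕ.+ g ℕ.+ 2 ≡ suc (2 ℕ.* suc g)
        eq g = trans (ℕₚ.+-comm (suc g ℕ.+ g) 2) (cong suc (trans (cong (λ n → suc (suc g ℕ.+ n)) (sym (ℕₚ.+-identityʳ g))) (sym (ℕₚ.+-suc (suc g) (g ℕ.+ 0)))))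

      module P = Pair h g g′ (+ 1) (+ 2) (cong +_ (ℕₚ.+-comm 1 g′)) h≡

    -- Where x^h = -1, the core is (1 + x) (x² - 1). Since h is odd, period 2 and antiperiod h of (1
    -- + x) w give antiperiod 1, that is (1 + x)² w = 0. The odd part of h is h, so no other
    -- antiperiod occurs.
    alternates : ∀ X → All (ℕ._≤ h) X → Alternates h (g ∷ g′ ∷ X ++ map (h ℕ.∸_) X)
    alternates X p = Reflected.split-kernel h (g ∷ g′ ∷ []) X p E⁻
        -- The exponents 1 and 0 stand for κ = 2 and δ = 1.
        (periodic-kernel h g (g′ ∷ []) X 0 g 1 0 (sym (ℕₚ.*-identityˡ h)) P.nil λ _ ())
      where
      E⁻ : ∀ {w} → Anti (+ h) w → Ker (g ∷ g′ ∷ []) w → ∀ i → T (+ 1) w i ≡ + 0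
      E⁻ {w} f k = T²≡0⇒T≡0 (2 ℕ.* g) (Per-≡ (eq (+ h)) (Anti⇒Per f)) (Anti-1⇒T≡0 anti-1)
        where
        eq : ∀ h → h + h ≡ h * + 2
        eq = solve-∀
        eq₂ : ∀ g → - g * + 2 + (+ 1 + + 2 * g) ≡ + 1
        eq₂ = solve-∀
        anti-1 : Anti (+ 1) (T (+ 1) w)
        anti-1 = Anti-≡ (trans (cong (λ x → - + g * + 2 + x) (cong (_+_ (+ 1)) (pos-* 2 g))) (eq₂ (+ g)))
          (Per-Anti (Per-* (- + g) (P.Per-κ f k)) (Anti-T (+ 1) f))

    balanced : ∀ X → All (ℕ._≤ h) X → ∀ {W} → Anti (+ 1) W → Ker (g ∷ g′ ∷ X ++ map (h ℕ.∸_) X) W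
    balanced X p {W} f = Balance.odd-h f {core = g ∷ g′ ∷ []} (g , refl) p (mk λ i →
      trans (cong (λ j → Λ (g ∷ g′ ∷ []) W j) (idx i (+ g))) (trans (P.factor W (i - + 2 - + g)) (cong₂ _+_ (z _) (z _))))
      where
      idx : ∀ i g → i ≡ i - + 2 - g + + 2 + g
      idx = solve-∀
      z : ∀ i → T (+ 1) W i ≡ + 0
      z = Anti-1⇒T≡0 f

  module EvenOrder (m′ a r : ℕ) (h≡ : suc m′ ℕ.+ suc m′ ≡ 2 ℕ.^ a ℕ.* suc (2 ℕ.* r)) where
    open Antipodal m′

    alternates : ∀ X → All (ℕ._≤ h) X → Alternates h (m ∷ m′ ∷ X ++ map (h ℕ.∸_) X)
    alternates X p = Reflected.split-kernel h core X p (λ f g → T≡0-of-0 (E⁻ f g))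
      -- The core supplies 1 + x² alone; the second factor 1 + x is padding.
      (periodic-kernel h m (m′ ∷ []) X a r 1 0 h≡ (λ {w} f e → T-even-T {+ 2} {w} (+ 1) (nil f e))
        λ j _ {w} f f′ g o → no-odd (+ n j) f (core-mod-4 core X g o) o
          (Anti-≡ (trans (cong +_ (ℕₚ.*-assoc 2 (2 ℕ.^ j) (suc (2 ℕ.* r)))) (trans (pos-* 2 (n j)) (*-comm (+ 2) (+ n j)))) f′))
      where
      n : ℕ → ℕ
      n j = 2 ℕ.^ j ℕ.* suc (2 ℕ.* r)

    balanced : ∀ Xe Xo → All (ℕ._≤ h) (Xe ++ Xo) → All IsEven Xe → All IsOdd Xo → length Xe ≡ length Xo →
      ∀ {W} → Anti (+ 1) W → Ker (m ∷ m′ ∷ (Xe ++ Xo) ++ map (h ℕ.∸_) (Xe ++ Xo)) W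
    balanced Xe Xo p evens odds e {W} f = Balance.even-h f {core = core} (+ 0) (m , cong (m ℕ.+_) (sym (ℕₚ.+-identityʳ m))) p evens odds
        core≡ (trans (+-identityˡ _) (cong +_ e))
      where
      core≡ : ∀ i → Λ core W i ≡ + 0
      core≡ i with parity m′
      ... | inj₁ e@(t , _) = trans (cong₂ (λ x y → x + (y + + 0)) (Balance.c-odd f {m} (t , cong suc (proj₂ e)) i) (Balance.c-even f e i)) (eq (W i))
        where
        eq : ∀ w → - + 2 * w + (+ 2 * w + + 0) ≡ + 0
        eq = solve-∀
      ... | inj₂ o@(t , _) = trans (cong₂ (λ x y → x + (y + + 0)) (Balance.c-even f {m} (suc t , trans (cong suc (proj₂ o)) (sym (ℕₚ.*-suc 2 t))) i) (Balance.c-odd f o i)) (eq (W i))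
        where
        eq : ∀ w → + 2 * w + (- + 2 * w + + 0) ≡ + 0
        eq = solve-∀

  -- With m = b + 3, the core is {m + 1, m - 3}.
  module TwiceOdd (b r : ℕ) (m≡ : b ℕ.+ 3 ≡ suc (2 ℕ.* r)) where
    m h : ℕ
    m = b ℕ.+ 3
    h = m ℕ.+ m
    core : List ℕ
    core = b ℕ.+ 4 ∷ b ∷ []

    private
      eq₁ : ∀ b → b + + 4 + b + + 2 ≡ b + + 3 + (b + + 3)
      eq₁ = solve-∀
      module P = Pair h (b ℕ.+ 4) b (+ 4) (+ 2) refl (eq₁ (+ b))

      h≡ : h ≡ 2 ℕ.^ 1 ℕ.* suc (2 ℕ.* r)
      h≡ = trans (cong₂ ℕ._+_ m≡ m≡) (cong (suc (2 ℕ.* r) ℕ.+_) (sym (ℕₚ.+-identityʳ _)))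

      +m≡ : + m ≡ + 1 + + 2 * + r
      +m≡ = trans (cong +_ m≡) (cong (_+_ (+ 1)) (pos-* 2 r))

    -- κ = 2 divides h, so x⁴ = -1. But 2h = 4m is an odd multiple of 4, so x^(2h) = -1, against
    -- antiperiod h.
    E⁻ : ∀ {w} → Anti (+ h) w → Ker core w → ∀ i → w i ≡ + 0
    E⁻ f g = Per×Anti⇒0 (Per-≡ (trans (cong (λ x → x + x + (x + x)) +m≡) (eq (+ r))) (Anti⇒Per f))
        (Anti-odd (+ r) (P.Anti-δ (+ m) (eq₂ (+ m)) f g))
      where
      eq : ∀ r → (+ 1 + + 2 * r) + (+ 1 + + 2 * r) + ((+ 1 + + 2 * r) + (+ 1 + + 2 * r)) ≡ r * (+ 4 + + 4) + + 4
      eq = solve-∀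
      eq₂ : ∀ m → m * + 2 ≡ m + m
      eq₂ = solve-∀

    alternates : ∀ X → All (ℕ._≤ h) X → Alternates h (core ++ X ++ map (h ℕ.∸_) X)
    alternates X p = Reflected.split-kernel h core X p (λ f g → T≡0-of-0 (E⁻ f g))
      -- As h is twice an odd number, only period and antiperiod ρ occur, and the numbers of pairs
      -- are immaterial.
      (periodic-kernel h (b ℕ.+ 4) (b ∷ []) X 1 r 1 2 h≡ P.nil λ _ → λ { (s≤s ()) })

    balanced : ∀ Xe Xo → All (ℕ._≤ h) (Xe ++ Xo) → All IsEven Xe → All IsOdd Xo → IsEven b → suc (length Xe) ≡ length Xo →
      ∀ {W} → Anti (+ 1) W → Ker (core ++ (Xe ++ Xo) ++ map (h ℕ.∸_) (Xe ++ Xo)) W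
    balanced Xe Xo p evens odds eb@(t , _) e {W} f = Balance.even-h f {core = core} (+ 1) (m , cong (m ℕ.+_) (sym (ℕₚ.+-identityʳ m))) p evens odds
        (λ i → trans (cong₂ (λ x y → x + (y + + 0)) (Balance.c-even f {b ℕ.+ 4} (t ℕ.+ 2 , trans (cong (ℕ._+ 4) (proj₂ eb)) (sym (ℕₚ.*-distribˡ-+ 2 t 2))) i) (Balance.c-even f eb i)) (eq (W i)))
        (cong +_ e)
      where
      eq : ∀ w → + 2 * w + (+ 2 * w + + 0) ≡ + 4 * + 1 * w
      eq = solve-∀

  -- With m = b + 3, the core is {m - 1, m - 3}.
  module FourTimesOdd (b r : ℕ) (m≡ : b ℕ.+ 3 ≡ 2 ℕ.* suc (2 ℕ.* r)) where
    ρ m h : ℕ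
    ρ = suc (2 ℕ.* r)
    m = b ℕ.+ 3
    h = m ℕ.+ m
    core : List ℕ
    core = b ℕ.+ 2 ∷ b ∷ []

    private
      eq₁ : ∀ b → b + + 2 + b + + 4 ≡ b + + 3 + (b + + 3)
      eq₁ = solve-∀
      module P = Pair h (b ℕ.+ 2) b (+ 2) (+ 4) refl (eq₁ (+ b))

      h≡ : h ≡ 2 ℕ.^ 2 ℕ.* ρ
      h≡ = trans (cong₂ ℕ._+_ m≡ m≡) (trans (cong (2 ℕ.* ρ ℕ.+_) (sym (ℕₚ.+-identityʳ _))) (sym (ℕₚ.*-assoc 2 2 ρ)))

      ρ*4≡h : + ρ * + 4 ≡ + h
      ρ*4≡h = trans (*-comm (+ ρ) (+ 4)) (trans (sym (pos-* 4 ρ)) (cong +_ (sym h≡)))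

    -- κ = 4 divides h = 4ρ, so x² = -1; then x⁴ = 1 and x^h = 1, against x^h = -1.
    E⁻ : ∀ {w} → Anti (+ h) w → Ker core w → ∀ i → w i ≡ + 0
    E⁻ f g = Per×Anti⇒0 (Per-≡ ρ*4≡h (Per-* (+ ρ) (Anti⇒Per (P.Anti-δ (+ ρ) ρ*4≡h f g)))) f

    module _ (odd-b : IsOdd b) where
      odd-b+2 : IsOdd (b ℕ.+ 2)
      odd-b+2 = suc (proj₁ odd-b) , trans (cong (ℕ._+ 2) (proj₂ odd-b))
        (cong suc (trans (ℕₚ.+-comm (2 ℕ.* proj₁ odd-b) 2) (sym (ℕₚ.*-suc 2 (proj₁ odd-b)))))

      alternates : ∀ Xe Xo → All (ℕ._≤ h) (Xe ++ Xo) → All IsEven Xe → All IsOdd Xo → IsOdd (length Xe) →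
        Alternates h (core ++ (Xe ++ Xo) ++ map (h ℕ.∸_) (Xe ++ Xo))
      alternates Xe Xo p evens odds q@(t , _) = Reflected.split-kernel h core (Xe ++ Xo) p (λ f g → T≡0-of-0 (E⁻ f g))
          (periodic-kernel h (b ℕ.+ 2) (b ∷ []) (Xe ++ Xo) 2 r 2 1 h≡ P.nil no-odd)
        where
        no-odd : ∀ j → suc (suc j) ℕ.≤ 2 → ∀ {w} → Per (+ h) w → Anti (+ (2 ℕ.^ suc j ℕ.* ρ)) w → Ker _ w → (∀ i → Odd (w i)) → ⊥
        -- Both core elements are odd and vanish where x² = -1, so τ = 0.
        no-odd zero _ _ f g o = Fold-down.level-1 r core Xe Xo evens odds (+ 0)
          (odd (∣-resp (trans (eq (+ t)) (cong (λ x → + 0 + x - + 1) (sym (+odd q)))) (double-even (+ t))))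
          (λ {W} f i → trans (cong₂ (λ x y → x + (y + + 0)) (c-odd≡0 f odd-b+2 i) (c-odd≡0 f odd-b i)) (eq₀ (W i)))
          f g o
          where
          eq : ∀ t → + 2 * t ≡ + 0 + (+ 1 + + 2 * t) - + 1
          eq = solve-∀
          eq₀ : ∀ w → + 0 ≡ + 2 * (+ 2 * + 0 * w)
          eq₀ = solve-∀
        no-odd (suc j) (s≤s (s≤s ()))

      balanced : ∀ Xe Xo → All (ℕ._≤ h) (Xe ++ Xo) → All IsEven Xe → All IsOdd Xo → length Xe ≡ suc (length Xo) →
        ∀ {W} → Anti (+ 1) W → Ker (core ++ (Xe ++ Xo) ++ map (h ℕ.∸_) (Xe ++ Xo)) W
      balanced Xe Xo p evens odds e {W} f = Balance.even-h f {core = core} (- + 1) (m , cong (m ℕ.+_) (sym (ℕₚ.+-identityʳ m))) p evens odds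
          (λ i → trans (cong₂ (λ x y → x + (y + + 0)) (Balance.c-odd f odd-b+2 i) (Balance.c-odd f odd-b i)) (eq (W i)))
          (trans (cong (λ l → - + 1 + + l) e) refl)
        where
        eq : ∀ w → - + 2 * w + (- + 2 * w + + 0) ≡ + 4 * - + 1 * w
        eq = solve-∀

  module PowerCore (m l a r : ℕ) (h≡ : m ℕ.+ m ≡ 2 ℕ.^ a ℕ.* suc (2 ℕ.* r)) where
    ρ e : ℕ
    ρ = suc (2 ℕ.* r)
    e = 2 ℕ.^ l
    open Progression m e ρ public

    private
      2e≡ : + (2 ℕ.^ suc l) ≡ + 2 * + e
      2e≡ = pos-* 2 e

    -- For j ≥ l the antiperiod 2^(j+1) ρ is a multiple of 2e = 2^(l+1), and `no-odd-high` applies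
    -- to any X. Only the antiperiods with j < l depend on the numbers of pairs.
    alternates : ∀ Xe Xo → All (ℕ._≤ h) (Xe ++ Xo) →
      (∀ {w} → Anti (+ h) w → Anti (+ 2 * + e) w → ∀ i → w i ≡ + 0) →
      (∀ j → j ℕ.< l → suc (suc j) ℕ.≤ a → ∀ {w} → Anti (+ (2 ℕ.^ suc j ℕ.* ρ)) w → Ker (core ++ (Xe ++ Xo) ++ (Xe ++ Xo)) w → (∀ i → Odd (w i)) → ⊥) →
      Alternates h (core ++ (Xe ++ Xo) ++ map (h ℕ.∸_) (Xe ++ Xo))
    alternates Xe Xo p H low = Reflected.split-kernel h core X p (λ {w} f g → T≡0-of-0 {w} (H f (E⁻ a h≡ f g)))
        (periodic-kernel h m (e ∷ ℕ.∣ ρ - e ∣ ∷ ρ ℕ.+ e ∷ []) X a r (suc l) 0 h≡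
          (λ {w} f d i → ∣-resp (cong (λ k → T k (T (+ 1) w) i) (sym 2e≡)) (T-even-T {+ 2 * + e} {w} (+ 1) (nil a h≡ f d) i))
          no-odd)
      where
      X = Xe ++ Xo
      no-odd : ∀ j → suc (suc j) ℕ.≤ a → ∀ {w} → Per (+ h) w → Anti (+ (2 ℕ.^ suc j ℕ.* ρ)) w → Ker (core ++ X ++ X) w → (∀ i → Odd (w i)) → ⊥
      no-odd j p f f′ g o with j ℕ.<? l
      ... | yes j<l = low j j<l p f′ g o
      ... | no j≮l = no-odd-high a h≡ (+ (2 ℕ.^ (j ℕ.∸ l) ℕ.* ρ)) f (core-mod-4 core X g o) o (Anti-≡ (trans (2^-split (s≤s (ℕₚ.≮⇒≥ j≮l)) ρ) idx) f′)
        where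
        idx : + (2 ℕ.^ (j ℕ.∸ l)) * + (2 ℕ.^ suc l ℕ.* ρ) ≡ + (2 ℕ.^ (j ℕ.∸ l) ℕ.* ρ) * (+ 2 * + e)
        idx = trans (cong (+ (2 ℕ.^ (j ℕ.∸ l)) *_) (trans (pos-* (2 ℕ.^ suc l) ρ) (cong (_* + ρ) 2e≡)))
          (trans (eq (+ (2 ℕ.^ (j ℕ.∸ l))) (+ 2 * + e) (+ ρ)) (cong (_* (+ 2 * + e)) (sym (pos-* (2 ℕ.^ (j ℕ.∸ l)) ρ))))
          where
          eq : ∀ p q r → p * (q * r) ≡ p * r * q
          eq = solve-∀

    balanced : ∀ Xe Xo → All (ℕ._≤ h) (Xe ++ Xo) → All IsEven Xe → All IsOdd Xo → length Xe ≡ length Xo → IsEven m → IsEven e →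
      ∀ {W} → Anti (+ 1) W → Ker (core ++ (Xe ++ Xo) ++ map (h ℕ.∸_) (Xe ++ Xo)) W
    balanced Xe Xo p evens odds el em ee {W} f = Balance.even-h f {core = core} (+ 0) (m , cong (m ℕ.+_) (sym (ℕₚ.+-identityʳ m))) p evens odds
        core≡ (trans (+-identityˡ _) (cong +_ el))
      where
      eq : ∀ w a b → + 2 * w + (+ 2 * w + + 2 * a + + 2 * b) ≡ + 4 * w + + 2 * (a + b)
      eq = solve-∀
      eq₂ : ∀ w → + 4 * w + + 2 * (- + 2 * w) ≡ + 4 * + 0 * w
      eq₂ = solve-∀
      core≡ : ∀ i → Λ core W i ≡ + 4 * + 0 * W i
      core≡ i = trans (factor W i) (trans (cong₂ _+_ (Balance.c-even f em i) (cong₂ _+_ (cong₂ _+_ (Balance.c-even f ee i) (Balance.c-even f ee (i + + ρ))) (Balance.c-even f ee (i - + ρ))))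
        (trans (eq (W i) (W (i + + ρ)) (W (i - + ρ))) (trans (cong (λ x → + 4 * W i + + 2 * x) (Balance.c-odd f {ρ} (r , refl) i)) (eq₂ (W i)))))

-- Half connection sets for all admissible degrees and orders

module Designs where

  open import Data.Integer as ℤ using (+_)
  open import Data.List using (List; []; _∷_; _++_; length; map)
  open import Data.List.Membership.Propositional using (_∈_)
  open import Data.List.Membership.Propositional.Properties using (∈-++⁻; ∈-map⁻)
  open import Data.List.Properties using (length-++; length-map)
  open import Data.List.Relation.Unary.All as All using (All; []; _∷_)
  open import Data.List.Relation.Unary.AllPairs using ([]; _∷_)
  open import Data.List.Relation.Unary.Any using (here; there)
  open import Data.List.Relation.Unary.Unique.Propositional using (Unique)
  open import Data.Nat hiding (parity)
  open import Data.Nat.Induction using (<-rec)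
  open import Data.Nat.Properties
  open import Data.Nat.Tactic.RingSolver using (solve-∀)
  open Kernels

  -- Selecting the pairs

  ≤-witness : ∀ {a b} k → b ≡ a + k → a ≤ b
  ≤-witness {a} k refl = m≤m+n a k

  IsEven≢IsOdd : ∀ {m n} → IsEven m → IsOdd n → m ≢ n
  IsEven≢IsOdd (s , refl) (t , refl) = even≢odd s t

  -- If a does not occur, the last element is dropped instead, so that the length always falls by
  -- one.
  delete : ∀ a {r xs} → Unique xs → length xs ≡ suc r →
    ∃ λ ys → length ys ≡ r × Unique ys × All (a ≢_) ys × (∀ {P : ℕ → Set} → All P xs → All P ys)
  delete a {r} {x ∷ xs} (u ∷ us) e with a ≟ x
  ... | yes refl = xs , suc-injective e , us , u , All.tail
  delete a {zero} {x ∷ []} (u ∷ us) e | no a≢x = [] , refl , [] , [] , λ _ → []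
  delete a {suc r} {x ∷ xs} (u ∷ us) e | no a≢x with delete a {r} us (suc-injective e)
  ... | ys , e′ , us′ , avoid , sub = x ∷ ys , cong suc e′ , sub u ∷ us′ , a≢x ∷ avoid , λ { (p ∷ ps) → p ∷ sub ps }

  -- Each forbidden value spoils at most one candidate, hence the bound r + |Av| on the arguments.
  record Pick (f : ℕ → ℕ) (Av : List ℕ) (r : ℕ) : Set where
    field
      list   : List ℕ
      size   : length list ≡ r
      unique : Unique list
      values : All (λ s → ∃ λ t → s ≡ f t × t < r + length Av) list
      avoids : All (λ a → All (a ≢_) list) Av

  pick : ∀ {f} → (∀ {s t} → f s ≡ f t → s ≡ t) → ∀ Av r → Pick f Av r
  pick {f} inj [] zero = record { list = [] ; size = refl ; unique = [] ; values = [] ; avoids = [] }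
  pick {f} inj [] (suc r) = record
    { list = f r ∷ list
    ; size = cong suc size
    ; unique = All.map (λ { (t , refl , t<r+0) e → <⇒≢ (subst (t <_) (+-identityʳ r) t<r+0) (sym (inj e)) }) values ∷ unique
    ; values = (r , refl , s≤s (m≤m+n r 0)) ∷ All.map (λ (t , e , p) → t , e , m≤n⇒m≤1+n p) values
    ; avoids = []
    }
    where open Pick (pick inj [] r)
  pick {f} inj (a ∷ Av) r with pick inj Av (suc r)
  ... | P with delete a (Pick.unique P) (Pick.size P)
  ... | ys , e , us , avoid , sub = record
    { list = ys ; size = e ; unique = us
    ; values = All.map (λ {s} (t , e , p) → t , e , subst (t <_) (sym (+-suc r (length Av))) p) (sub (Pick.values P))
    ; avoids = avoid ∷ All.map sub (Pick.avoids P)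
    }

  evenAt oddAt : ℕ → ℕ
  evenAt t = 2 * suc t
  oddAt t = suc (2 * t)

  evenAt-injective : ∀ {s t} → evenAt s ≡ evenAt t → s ≡ t
  evenAt-injective {s} {t} e = suc-injective (*-cancelˡ-≡ (suc s) (suc t) 2 e)

  oddAt-injective : ∀ {s t} → oddAt s ≡ oddAt t → s ≡ t
  oddAt-injective {s} {t} e = *-cancelˡ-≡ s t 2 (suc-injective e)

  Positive<half : ℕ → ℕ → Set
  Positive<half h s = 0 < s × s + s < h

  Separated : ℕ → ℕ → ℕ → Set
  Separated h c s = c ≢ s × c + s ≢ h

  module Assembly (h : ℕ) where

    half⇒≤ : ∀ {X} → All (Positive<half h) X → All (_≤ h) X
    half⇒≤ = All.map λ {s} (_ , p) → ≤-trans (m≤m+n s s) (<⇒≤ p)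

    reflect-unique : ∀ {X} → All (Positive<half h) X → Unique X → Unique (map (h ∸_) X)
    reflect-unique [] [] = []
    reflect-unique {s ∷ X} (p ∷ ps) (u ∷ us) =
      Allₚ.map⁺ (All.map (λ (q , s≢t) e → s≢t (∸-cancelˡ-≡ (All.head (half⇒≤ (p ∷ []))) q e)) (All.zip (half⇒≤ ps , u)))
        ∷ reflect-unique ps us

    private
      at : ∀ {P : ℕ → Set} {X} → All P X → ∀ {s} → s ∈ X → P s
      at = All.lookup

    unique : ∀ {core X} → Unique core → All (Positive<half h) X → Unique X →
      All (λ c → All (Separated h c) X) core → Unique (core ++ X ++ map (h ∸_) X)
    unique {core} {X} uc px ux sep = Uniqueₚ.++⁺ uc (Uniqueₚ.++⁺ ux (reflect-unique px ux) disjoint₁) disjoint₂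
      where
      disjoint₁ : ∀ {v} → ¬ (v ∈ X × v ∈ map (h ∸_) X)
      disjoint₁ {v} (v∈X , v∈X′) with ∈-map⁻ (h ∸_) v∈X′
      ... | s , s∈X , refl = <⇒≱ (+-mono-< (proj₂ (at px v∈X)) (proj₂ (at px s∈X))) (≤-reflexive (trans
              (sym (cong₂ _+_ (m∸n+n≡m (at (half⇒≤ px) s∈X)) (m∸n+n≡m (at (half⇒≤ px) s∈X)))) (eq (h ∸ s) s)))
        where
        eq : ∀ a b → a + b + (a + b) ≡ a + a + (b + b)
        eq = solve-∀
      disjoint₂ : ∀ {v} → ¬ (v ∈ core × v ∈ X ++ map (h ∸_) X)
      disjoint₂ {v} (v∈core , v∈) with ∈-++⁻ X v∈
      ... | inj₁ v∈X = proj₁ (at (at sep v∈core) v∈X) refl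
      ... | inj₂ v∈X′ with ∈-map⁻ (h ∸_) v∈X′
      ... | s , s∈X , refl = proj₂ (at (at sep v∈core) s∈X) (m∸n+n≡m (at (half⇒≤ px) s∈X))

    bounded : ∀ {core X} → All (λ s → 0 < s × s < h) core → All (Positive<half h) X →
      All (λ s → 0 < s × s < h) (core ++ X ++ map (h ∸_) X)
    bounded {core} {X} bc px = Allₚ.++⁺ bc (Allₚ.++⁺ (All.map (λ {s} (p , q) → p , s<h {s} q) px)
        (Allₚ.map⁺ (All.map (λ {s} (p , q) → m<n⇒0<n∸m (s<h {s} q) , ∸-monoʳ-< p (<⇒≤ (s<h {s} q))) px)))
      where
      s<h : ∀ {s} → s + s < h → s < h
      s<h {s} q = ≤-<-trans (m≤m+n s s) q

    size : ∀ core X → length (core ++ X ++ map (h ∸_) X) ≡ length core + 2 * length X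
    size core X = trans (length-++ core) (cong (_+_ (length core)) (trans (length-++ X)
      (cong (_+_ (length X)) (trans (length-map (h ∸_) X) (sym (+-identityʳ (length X)))))))

  -- Designs with two core elements

  -- A half connection set of size D for the circulant graph of order 2h whose kernel is spanned by (-1)ⁱ.
  record Design (h D : ℕ) : Set where
    field
      L          : List ℕ
      size       : length L ≡ D
      unique     : Unique L
      bounded    : All (λ s → 0 < s × s < h) L
      balanced   : ∀ {W} → Anti (+ 1) W → Ker L W
      alternates : Alternates h L

  evenAt-even : ∀ t → IsEven (evenAt t)
  evenAt-even t = suc t , refl

  oddAt-odd : ∀ t → IsOdd (oddAt t)
  oddAt-odd t = t , refl

  module Chosen {Ae Ao : List ℕ} {e o : ℕ} (Pe : Pick evenAt Ae e) (Po : Pick oddAt Ao o) where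
    open Pick Pe renaming (list to Xe; size to size-e; unique to unique-e; values to values-e; avoids to avoids-e) public
    open Pick Po renaming (list to Xo; size to size-o; unique to unique-o; values to values-o; avoids to avoids-o) public

    X : List ℕ
    X = Xe ++ Xo

    evens : All IsEven Xe
    evens = All.map (λ { (t , refl , _) → evenAt-even t }) values-e

    odds : All IsOdd Xo
    odds = All.map (λ { (t , refl , _) → oddAt-odd t }) values-o

    size-X : length X ≡ e + o
    size-X = trans (length-++ Xe) (cong₂ _+_ size-e size-o)

    unique-X : Unique X
    unique-X = Uniqueₚ.++⁺ unique-e unique-o λ (p , q) → IsEven≢IsOdd (All.lookup evens p) (All.lookup odds q) refl

    bounds : ∀ {β} → 2 * (e + length Ae) < β → 2 * (o + length Ao) ≤ β → All (λ s → 0 < s × s < β) X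
    bounds {β} p q = Allₚ.++⁺
      (All.map (λ { (t , refl , t<) → s≤s z≤n , ≤-<-trans (*-monoʳ-≤ 2 t<) p }) values-e)
      (All.map (λ { (t , refl , t<) → s≤s z≤n , ≤-trans (≤-reflexive (sym (*-suc 2 t))) (≤-trans (*-monoʳ-≤ 2 t<) q) }) values-o)

  -- The number β keeps core and pairs apart: the core lies in [β, h - β], while s < β and h - s > h
  -- - β.
  module LowPairs {h β : ℕ} {core X : List ℕ} (0<β : 0 < β) (2β≤h : β + β ≤ h)
    (core-bounds : All (λ c → β ≤ c × c + β ≤ h) core) (X-bounds : All (λ s → 0 < s × s < β) X) where

    half : All (Positive<half h) X
    half = All.map (λ (p , q) → p , <-≤-trans (+-mono-< q q) 2β≤h) X-bounds

    X≤h : All (_≤ h) X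
    X≤h = Assembly.half⇒≤ h half

    separated : All (λ c → All (Separated h c) X) core
    separated = All.map (λ {c} (p , q) → All.map (λ (_ , s<β) →
      ≢-sym (<⇒≢ (<-≤-trans s<β p)) , <⇒≢ (<-≤-trans (+-monoʳ-< c s<β) q)) X-bounds) core-bounds

    core<h : All (λ s → 0 < s × s < h) core
    core<h = All.map (λ {c} (p , q) → <-≤-trans 0<β p , <-≤-trans (m<m+n c 0<β) q) core-bounds

    list-unique : Unique core → Unique X → Unique (core ++ X ++ map (h ∸_) X)
    list-unique uc ux = Assembly.unique h uc half ux separated

    list-bounded : All (λ s → 0 < s × s < h) (core ++ X ++ map (h ∸_) X)
    list-bounded = Assembly.bounded h core<h half

  pair-unique : ∀ {a b : ℕ} → a ≢ b → Unique (a ∷ b ∷ [])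
  pair-unique p = (p ∷ []) ∷ [] ∷ []

  odd-design : ∀ g′ r → r < g′ → Design (suc (2 * suc g′)) (2 + 2 * r)
  odd-design g′ r r<g′ = record
    { size = trans (Assembly.size h core X) (cong (λ n → 2 + 2 * n) size)
    ; unique = list-unique (pair-unique 1+n≢n) unique
    ; bounded = list-bounded
    ; balanced = OddOrder.balanced g′ X X≤h
    ; alternates = OddOrder.alternates g′ X X≤h
    }
    where
    h = suc (2 * suc g′)
    core = suc g′ ∷ g′ ∷ []
    open Pick (pick {suc} suc-injective [] r) renaming (list to X)
    h≡ : ∀ g → suc (2 * suc g) ≡ suc g + g + 2
    h≡ = solve-∀
    bd : All (λ c → g′ ≤ c × c + g′ ≤ h) core
    bd = (n≤1+n g′ , ≤-witness 2 (h≡ g′)) ∷ (≤-refl , ≤-witness 3 (trans (h≡ g′) (eq g′))) ∷ []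
      where
      eq : ∀ g → suc g + g + 2 ≡ g + g + 3
      eq = solve-∀
    X-bounds : All (λ s → 0 < s × s < g′) X
    X-bounds = All.map (λ { (t , refl , p) → s≤s z≤n , ≤-<-trans (subst (t <_) (+-identityʳ r) p) r<g′ }) values
    open LowPairs {h} {g′} {core} {X} (≤-<-trans z≤n r<g′) (proj₂ (All.lookup bd (there (here refl)))) bd X-bounds

  even-design : ∀ m′ a r q → suc m′ + suc m′ ≡ 2 ^ a * suc (2 * r) → 2 * q < m′ → Design (suc m′ + suc m′) (2 + 2 * (q + q))
  even-design m′ a r q h≡ 2q<m′ = record
    { size = trans (Assembly.size h core X) (cong (λ n → 2 + 2 * n) size-X)
    ; unique = list-unique (pair-unique 1+n≢n) unique-X
    ; bounded = list-bounded
    ; balanced = EvenOrder.balanced m′ a r h≡ Xe Xo X≤h evens odds (trans size-e (sym size-o))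
    ; alternates = EvenOrder.alternates m′ a r h≡ X X≤h
    }
    where
    h = suc m′ + suc m′
    core = suc m′ ∷ m′ ∷ []
    open Chosen (pick evenAt-injective [] q) (pick oddAt-injective [] q)
    2β≤h : m′ + m′ ≤ h
    2β≤h = +-mono-≤ (n≤1+n m′) (n≤1+n m′)
    open LowPairs {h} {m′} {core} {X} (≤-<-trans z≤n 2q<m′) 2β≤h
      ((n≤1+n m′ , +-monoʳ-≤ (suc m′) (n≤1+n m′)) ∷ (≤-refl , 2β≤h) ∷ [])
      (bounds (subst (λ n → 2 * n < m′) (sym (+-identityʳ q)) 2q<m′) (subst (λ n → 2 * n ≤ m′) (sym (+-identityʳ q)) (<⇒≤ 2q<m′)))

  -- Both core elements are even; one more odd than even pairs restores the balance.
  twice-odd-design : ∀ b r p → b + 3 ≡ suc (2 * r) → 2 * suc p ≤ b → Design ((b + 3) + (b + 3)) (2 + 2 * (p + suc p))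
  twice-odd-design b r p m≡ 2q≤b = record
    { size = trans (Assembly.size h core X) (cong (λ n → 2 + 2 * n) size-X)
    ; unique = list-unique (pair-unique (≢-sym (<⇒≢ (m<m+n b (s≤s z≤n))))) unique-X
    ; bounded = list-bounded
    ; balanced = TwiceOdd.balanced b r m≡ Xe Xo X≤h evens odds even-b (trans (cong suc size-e) (sym size-o))
    ; alternates = TwiceOdd.alternates b r m≡ X X≤h
    }
    where
    h = (b + 3) + (b + 3)
    core = b + 4 ∷ b ∷ []
    open Chosen (pick evenAt-injective [] p) (pick oddAt-injective [] (suc p))
    even-b : IsEven b
    even-b with parity b
    ... | inj₁ e = e
    ... | inj₂ (t , refl) = ⊥-elim (even≢odd (2 + t) r (trans (eq t) m≡))
      where
      eq : ∀ t → 2 * (2 + t) ≡ suc (2 * t) + 3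
      eq = solve-∀
    eq₁ : ∀ b → (b + 3) + (b + 3) ≡ b + 4 + b + 2
    eq₁ = solve-∀
    eq₂ : ∀ b → (b + 3) + (b + 3) ≡ b + b + 6
    eq₂ = solve-∀
    2β≤h : b + b ≤ h
    2β≤h = ≤-witness 6 (eq₂ b)
    open LowPairs {h} {b} {core} {X} (≤-trans (s≤s z≤n) 2q≤b) 2β≤h
      ((m≤m+n b 4 , ≤-witness 2 (eq₁ b)) ∷ (≤-refl , 2β≤h) ∷ [])
      (bounds (<-≤-trans (*-monoʳ-< 2 (subst (_< suc p) (sym (+-identityʳ p)) ≤-refl)) 2q≤b)
        (subst (λ n → 2 * n ≤ b) (sym (+-identityʳ (suc p))) 2q≤b))

  -- Both core elements are odd; one more even than odd pairs restores the balance. Even p then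
  -- makes the number of even pairs odd, as the fourth roots of unity require.
  four-times-odd-design : ∀ b r p → b + 3 ≡ 2 * suc (2 * r) → IsEven p → 2 * suc p < b → Design ((b + 3) + (b + 3)) (2 + 2 * (suc p + p))
  four-times-odd-design b r p m≡ (t , p≡) 2q<b = record
    { size = trans (Assembly.size h core X) (cong (λ n → 2 + 2 * n) size-X)
    ; unique = list-unique (pair-unique (≢-sym (<⇒≢ (m<m+n b (s≤s z≤n))))) unique-X
    ; bounded = list-bounded
    ; balanced = FourTimesOdd.balanced b r m≡ odd-b Xe Xo X≤h evens odds (trans size-e (cong suc (sym size-o)))
    ; alternates = FourTimesOdd.alternates b r m≡ odd-b Xe Xo X≤h evens odds (t , trans size-e (cong suc p≡))
    }
    where
    h = (b + 3) + (b + 3)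
    core = b + 2 ∷ b ∷ []
    open Chosen (pick evenAt-injective [] (suc p)) (pick oddAt-injective [] p)
    odd-b : IsOdd b
    odd-b with parity b
    ... | inj₂ o = o
    ... | inj₁ (t , refl) = ⊥-elim (even≢odd (suc (2 * r)) (suc t) (trans (sym m≡) (eq t)))
      where
      eq : ∀ t → 2 * t + 3 ≡ suc (2 * suc t)
      eq = solve-∀
    eq₁ : ∀ b → (b + 3) + (b + 3) ≡ b + 2 + b + 4
    eq₁ = solve-∀
    eq₂ : ∀ b → (b + 3) + (b + 3) ≡ b + b + 6
    eq₂ = solve-∀
    2β≤h : b + b ≤ h
    2β≤h = ≤-witness 6 (eq₂ b)
    open LowPairs {h} {b} {core} {X} (≤-<-trans z≤n 2q<b) 2β≤h
      ((m≤m+n b 2 , ≤-witness 4 (eq₁ b)) ∷ (≤-refl , 2β≤h) ∷ [])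
      (bounds (subst (λ n → 2 * n < b) (sym (+-identityʳ (suc p))) 2q<b)
        (≤-trans (*-monoʳ-≤ 2 (subst (_≤ suc p) (sym (+-identityʳ p)) (n≤1+n p))) (<⇒≤ 2q<b)))

  -- Designs with four core elements

  odd-difference : ∀ {a b c} → a + b ≡ c → IsEven b → IsOdd c → IsOdd a
  odd-difference {a} e (t , refl) (u , refl) with parity a
  ... | inj₂ o = o
  ... | inj₁ (s , refl) = ⊥-elim (even≢odd (s + t) u (trans (*-distribˡ-+ 2 s t) e))

  odd-∣-∣ : ∀ a b → IsOdd a → IsEven b → IsOdd ∣ a - b ∣
  odd-∣-∣ a b oa eb with ≤-total b a
  ... | inj₁ p = odd-difference {∣ a - b ∣} (trans (cong (_+ b) (m≤n⇒∣n-m∣≡n∸m p)) (m∸n+n≡m p)) eb oa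
  ... | inj₂ p with parity (b ∸ a)
  ...   | inj₂ o = subst IsOdd (sym (m≤n⇒∣m-n∣≡n∸m p)) o
  ...   | inj₁ e = ⊥-elim (IsEven≢IsOdd eb (odd-sum e oa) (sym (m∸n+n≡m p)))
    where
    odd-sum : ∀ {a b} → IsEven a → IsOdd b → IsOdd (a + b)
    odd-sum (s , refl) (t , refl) = s + t , trans (+-suc (2 * s) (2 * t)) (cong suc (sym (*-distribˡ-+ 2 s t)))

  ∣-∣<+ : ∀ a b → 0 < a → 0 < b → ∣ a - b ∣ < a + b
  ∣-∣<+ a b 0<a 0<b = ≤-<-trans (∣m-n∣≤m⊔n a b) (⊔-lub (m<m+n a 0<b) (m<n+m b 0<a))

  -- Antiperiods h = 2m and 2e exclude each other only if m and e contain different powers of 2, so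
  -- l must differ from a. Within this restriction, the fourth roots of unity make l depend on the
  -- parity of p.
  module PowerDesign (a l r p : ℕ) (1≤a : 1 ≤ a) (1≤l : 1 ≤ l) where
    ρ m e : ℕ
    ρ = suc (2 * r)
    m = 2 ^ a * ρ
    e = 2 ^ l

    h≡ : m + m ≡ 2 ^ suc a * ρ
    h≡ = trans (cong (_+_ m) (sym (+-identityʳ m))) (sym (*-assoc 2 (2 ^ a) ρ))

    open PowerCore m l (suc a) r h≡ using (h; core; balanced; alternates)

    even-2^ : ∀ {k} → 1 ≤ k → IsEven (2 ^ k)
    even-2^ {suc k} _ = 2 ^ k , refl

    even-e : IsEven e
    even-e = even-2^ 1≤l

    even-m : IsEven m
    even-m with even-2^ 1≤a
    ... | t , eq = t * ρ , trans (cong (_* ρ) eq) (*-assoc 2 t ρ)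

    0<e : 0 < e
    0<e = m^n>0 2 l

    ρ<m : ρ < m
    ρ<m = <-≤-trans (m<n+m ρ {ρ} (s≤s z≤n)) (≤-trans (≤-reflexive (cong (_+_ ρ) (sym (+-identityʳ ρ))))
      (*-monoˡ-≤ ρ (^-monoʳ-≤ 2 1≤a)))

    x y : ℕ
    x = ∣ ρ - e ∣
    y = ρ + e

    odd-x : IsOdd x
    odd-x = odd-∣-∣ ρ e (r , refl) even-e

    odd-y : IsOdd y
    odd-y with even-e
    ... | t , eq = r + t , cong suc (trans (cong (_+_ (2 * r)) eq) (sym (*-distribˡ-+ 2 r t)))

    Low : Set
    Low = ∀ {Xe Xo} → All IsEven Xe → All IsOdd Xo → length Xe ≡ p → length Xo ≡ p →
      ∀ j → j < l → suc (suc j) ≤ suc a → ∀ {w} → Anti (+ (2 ^ suc j * ρ)) w →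
      Ker (core ++ (Xe ++ Xo) ++ (Xe ++ Xo)) w → (∀ i → Odd (w i)) → ⊥

    module _ (e<m : e < m) (2q<m : 2 * (2 + p) ≤ m)
      (H : ∀ {w} → Anti (+ h) w → Anti (+ 2 ℤ.* + e) w → ∀ i → w i ≡ + 0) (low : Low) where

      y<h : y < h
      y<h = +-mono-< ρ<m e<m

      -- The representative below m of the pair y, h - y.
      y-low : ∃ λ y′ → (y′ ≡ y × y < m) ⊎ (y′ + y ≡ h × m ≤ y)
      y-low with y <? m
      ... | yes y<m = y , inj₁ (refl , y<m)
      ... | no y≮m = h ∸ y , inj₂ (m∸n+n≡m (<⇒≤ y<h) , ≮⇒≥ y≮m)

      y′ : ℕ
      y′ = proj₁ y-low

      -- The even elements have one forbidden value, the odd ones two; this is the origin of 2 + p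
      -- in the bound on m.
      open Chosen (pick evenAt-injective (e ∷ []) p) (pick oddAt-injective (x ∷ y′ ∷ []) p)

      X-bounds : All (λ s → 0 < s × s < m) X
      X-bounds = bounds (<-≤-trans (*-monoʳ-< 2 (≤-reflexive (cong suc (+-comm p 1)))) 2q<m)
        (≤-trans (≤-reflexive (cong (2 *_) (+-comm p 2))) 2q<m)

      half : All (Positive<half h) X
      half = All.map (λ (p , q) → p , +-mono-< q q) X-bounds

      X≤h : All (_≤ h) X
      X≤h = Assembly.half⇒≤ h half

      x<m : x < m
      x<m = ≤-<-trans (∣m-n∣≤m⊔n ρ e) (⊔-lub ρ<m e<m)

      0<x : 0 < x
      0<x = subst (0 <_) (sym (proj₂ odd-x)) (s≤s z≤n)

      core-bounds : All (λ s → 0 < s × s < h) core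
      core-bounds = (≤-<-trans z≤n ρ<m , m<m+n m (≤-<-trans z≤n ρ<m)) ∷ (0<e , <-≤-trans e<m (m≤m+n m m))
        ∷ (0<x , <-≤-trans x<m (m≤m+n m m)) ∷ (s≤s z≤n , y<h) ∷ []

      core-unique : Unique core
      core-unique = (≢-sym (<⇒≢ e<m) ∷ ≢-sym (<⇒≢ x<m) ∷ IsEven≢IsOdd even-m odd-y ∷ [])
        ∷ (IsEven≢IsOdd even-e odd-x ∷ IsEven≢IsOdd even-e odd-y ∷ [])
        ∷ (<⇒≢ (∣-∣<+ ρ e (s≤s z≤n) 0<e) ∷ []) ∷ [] ∷ []

      below : ∀ {c} → c ≤ m → All (λ s → c + s ≢ h) X
      below c≤m = All.map (λ (_ , s<m) → <⇒≢ (+-mono-≤-< c≤m s<m)) X-bounds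

      avoid-e : All (e ≢_) X
      avoid-e = Allₚ.++⁺ (All.head avoids-e) (All.map (IsEven≢IsOdd even-e) odds)

      avoid-x : All (x ≢_) X
      avoid-x = Allₚ.++⁺ (All.map (λ e → ≢-sym (IsEven≢IsOdd e odd-x)) evens) (All.head avoids-o)

      separated-y : All (Separated h y) X
      separated-y with proj₂ y-low
      ... | inj₁ (y′≡y , y<m) = All.zip (Allₚ.++⁺ (All.map (λ e → ≢-sym (IsEven≢IsOdd e odd-y)) evens)
              (subst (λ z → All (z ≢_) Xo) y′≡y (All.head (All.tail avoids-o))) , below (<⇒≤ y<m))
      ... | inj₂ (y′+y≡h , m≤y) = All.zip (All.map (λ (_ , s<m) → ≢-sym (<⇒≢ (<-≤-trans s<m m≤y))) X-bounds ,
              All.map (λ y′≢s y+s≡h → y′≢s (+-cancelʳ-≡ y y′ _ (trans y′+y≡h (trans (sym y+s≡h) (+-comm y _))))) avoid-y′)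
        where
        odd-y′ : IsOdd y′
        odd-y′ with parity y′
        ... | inj₂ o = o
        ... | inj₁ (s , eq) = ⊥-elim (even≢odd m (s + proj₁ odd-y) (trans (cong (_+_ m) (+-identityʳ m))
                (trans (sym y′+y≡h) (trans (cong₂ _+_ eq (proj₂ odd-y)) (trans (+-suc (2 * s) _) (cong suc (sym (*-distribˡ-+ 2 s (proj₁ odd-y)))))))))
        avoid-y′ : All (y′ ≢_) X
        avoid-y′ = Allₚ.++⁺ (All.map (λ e → ≢-sym (IsEven≢IsOdd e odd-y′)) evens) (All.head (All.tail avoids-o))

      separated : All (λ c → All (Separated h c) X) core
      separated = All.map (λ (_ , s<m) → ≢-sym (<⇒≢ s<m) , <⇒≢ (+-monoʳ-< m s<m)) X-bounds
        ∷ All.zip (avoid-e , below (<⇒≤ e<m)) ∷ All.zip (avoid-x , below (<⇒≤ x<m)) ∷ separated-y ∷ []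

      power-design : Design h (4 + 2 * (p + p))
      power-design = record
        { size = trans (Assembly.size h core X) (cong (λ n → 4 + 2 * n) size-X)
        ; unique = Assembly.unique h core-unique half unique-X separated
        ; bounded = Assembly.bounded h core-bounds half
        ; balanced = balanced Xe Xo X≤h evens odds (trans size-e (sym size-o)) even-m even-e
        ; alternates = alternates Xe Xo X≤h H (low evens odds size-e size-o)
        }

    -- Where x² = -1, c ρ = 0, so the core is 2μ + 2ε with the signs μ of m and ε of e.
    level-1-signs : ∀ μ ε τ → + 2 ℤ.* μ ℤ.+ + 2 ℤ.* ε ≡ + 2 ℤ.* (+ 2 ℤ.* τ) → Odd (τ ℤ.+ + p) →
      (∀ {W} → Anti (+ 2) W → ∀ i → c (+ m) W i ≡ + 2 ℤ.* μ ℤ.* W i) →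
      (∀ {W} → Anti (+ 2) W → ∀ i → c (+ e) W i ≡ + 2 ℤ.* ε ℤ.* W i) →
      ∀ {Xe Xo} → All IsEven Xe → All IsOdd Xo → length Xe ≡ p → ∀ {w} → Anti (+ (2 * ρ)) w →
      Ker (core ++ (Xe ++ Xo) ++ (Xe ++ Xo)) w → (∀ i → Odd (w i)) → ⊥
    level-1-signs μ ε τ sum odd-τ cm ce {Xe} {Xo} evens odds size = Fold-down.level-1 r core Xe Xo evens odds τ
        (subst (λ n → Odd (τ ℤ.+ + n)) (sym size) odd-τ)
        λ {W} f i → trans (Progression.factor m e ρ W i) (trans (cong₂ ℤ._+_ (cm f i) (cong₂ ℤ._+_ (cong₂ ℤ._+_ (ce f i) (ce f (i ℤ.+ + ρ))) (ce f (i ℤ.- + ρ))))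
          (trans (eq μ ε (W i) (W (i ℤ.+ + ρ)) (W (i ℤ.- + ρ))) (trans (cong₂ (λ x y → x ℤ.* W i ℤ.+ + 2 ℤ.* ε ℤ.* y) sum (c-odd≡0 f {ρ} (r , refl) i)) (eq₂ τ ε (W i)))))
      where
      eq : ∀ m e a b d → + 2 ℤ.* m ℤ.* a ℤ.+ (+ 2 ℤ.* e ℤ.* a ℤ.+ + 2 ℤ.* e ℤ.* b ℤ.+ + 2 ℤ.* e ℤ.* d) ≡ (+ 2 ℤ.* m ℤ.+ + 2 ℤ.* e) ℤ.* a ℤ.+ + 2 ℤ.* e ℤ.* (b ℤ.+ d)
      eq = ℤ-Solver.solve-∀
      eq₂ : ∀ t e a → + 2 ℤ.* (+ 2 ℤ.* t) ℤ.* a ℤ.+ + 2 ℤ.* e ℤ.* + 0 ≡ + 2 ℤ.* (+ 2 ℤ.* t ℤ.* a)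
      eq₂ = ℤ-Solver.solve-∀

  Odd-0+ : ∀ {p} → IsOdd p → Odd (+ 0 ℤ.+ + p)
  Odd-0+ o@(t , _) = odd (∣-resp (trans (eq (+ t)) (cong (λ x → + 0 ℤ.+ x ℤ.- + 1) (sym (+odd o)))) (double-even (+ t)))
    where
    eq : ∀ t → + 2 ℤ.* t ≡ + 0 ℤ.+ (+ 1 ℤ.+ + 2 ℤ.* t) ℤ.- + 1
    eq = ℤ-Solver.solve-∀

  Odd-1+ : ∀ {p} → IsEven p → Odd (+ 1 ℤ.+ + p)
  Odd-1+ o@(t , _) = odd (∣-resp (trans (eq (+ t)) (cong (λ x → + 1 ℤ.+ x ℤ.- + 1) (sym (+even o)))) (double-even (+ t)))
    where
    eq : ∀ t → + 2 ℤ.* t ≡ + 1 ℤ.+ + 2 ℤ.* t ℤ.- + 1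
    eq = ℤ-Solver.solve-∀

  +ρ : ∀ r → + suc (2 * r) ≡ + 1 ℤ.+ + 2 ℤ.* + r
  +ρ r = cong (ℤ._+_ (+ 1)) (ℤₚ.pos-* 2 r)

  +2^ : ∀ a k ρ → + (2 ^ (k + a) * ρ) ≡ + (2 ^ k) ℤ.* + (2 ^ a * ρ)
  +2^ a k ρ = trans (cong (λ n → + (n * ρ)) (^-distribˡ-+-* 2 k a)) (trans (cong +_ (*-assoc (2 ^ k) (2 ^ a) ρ)) (ℤₚ.pos-* (2 ^ k) _))

  module _ (r p : ℕ) where
    private
      ρ = suc (2 * r)

    -- For m = 2ρ, e = 2 is ruled out, so e = 4. Where x² = -1, `c m` is -2 and `c e` is 2; they
    -- cancel, so p must be odd.
    design-2ρ : IsOdd p → 4 < 2 * ρ → 2 * (2 + p) ≤ 2 * ρ → Design (2 * ρ + 2 * ρ) (4 + 2 * (p + p))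
    design-2ρ odd-p e<m 2q<m = D.power-design e<m 2q<m H low
      where
      module D = PowerDesign 1 2 r p ≤-refl (s≤s z≤n)
      m≡ : + (2 * ρ) ≡ + r ℤ.* (+ 2 ℤ.+ + 2) ℤ.+ + 2
      m≡ = trans (ℤₚ.pos-* 2 ρ) (trans (cong (+ 2 ℤ.*_) (+ρ r)) (eq (+ r)))
        where
        eq : ∀ r → + 2 ℤ.* (+ 1 ℤ.+ + 2 ℤ.* r) ≡ r ℤ.* (+ 2 ℤ.+ + 2) ℤ.+ + 2
        eq = ℤ-Solver.solve-∀
      h+h≡ : + (2 * ρ + 2 * ρ) ℤ.+ + (2 * ρ + 2 * ρ) ≡ + r ℤ.* (+ 8 ℤ.+ + 8) ℤ.+ + 8
      h+h≡ = trans (cong (λ x → x ℤ.+ x ℤ.+ (x ℤ.+ x)) m≡) (eq (+ r))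
        where
        eq : ∀ r → let m = r ℤ.* (+ 2 ℤ.+ + 2) ℤ.+ + 2 in m ℤ.+ m ℤ.+ (m ℤ.+ m) ≡ r ℤ.* (+ 8 ℤ.+ + 8) ℤ.+ + 8
        eq = ℤ-Solver.solve-∀
      H : ∀ {w} → Anti (+ (2 * ρ + 2 * ρ)) w → Anti (+ 8) w → ∀ i → w i ≡ + 0
      H f g = Per×Anti⇒0 (Anti⇒Per f) (Anti-≡ (sym h+h≡) (Anti-odd (+ r) g))
      low : D.Low
      low evens odds se so zero _ _ = D.level-1-signs (ℤ.- + 1) (+ 1) (+ 0) refl (Odd-0+ odd-p)
        (c-odd-multiple {+ 2} (+ r) m≡) (c-even-multiple {+ 2} (+ 1) refl) evens odds se
      low evens odds se so (suc j) _ (s≤s (s≤s ()))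

    -- With 4 ∣ m and e = 2 the signs are opposite again, so p must be odd; the eighth roots of
    -- unity already fall to `no-odd-high`.
    design-4ρ : ∀ k → IsOdd p → 2 < 2 ^ (k + 2) * ρ → 2 * (2 + p) ≤ 2 ^ (k + 2) * ρ →
      Design (2 ^ (k + 2) * ρ + 2 ^ (k + 2) * ρ) (4 + 2 * (p + p))
    design-4ρ k odd-p e<m 2q<m = D.power-design e<m 2q<m H low
      where
      module D = PowerDesign (k + 2) 1 r p (m≤n⇒m≤o+n k (s≤s z≤n)) ≤-refl
      K = + (2 ^ k) ℤ.* + ρ
      m≡ : + (2 ^ (k + 2) * ρ) ≡ K ℤ.* (+ 2 ℤ.+ + 2)
      m≡ = trans (+2^ 2 k ρ) (trans (cong (+ (2 ^ k) ℤ.*_) (ℤₚ.pos-* 4 ρ)) (eq (+ (2 ^ k)) (+ ρ)))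
        where
        eq : ∀ a b → a ℤ.* (+ 4 ℤ.* b) ≡ a ℤ.* b ℤ.* (+ 2 ℤ.+ + 2)
        eq = ℤ-Solver.solve-∀
      H : ∀ {w} → Anti (+ (2 ^ (k + 2) * ρ + 2 ^ (k + 2) * ρ)) w → Anti (+ 4) w → ∀ i → w i ≡ + 0
      H f g = Per×Anti⇒0 (Per-≡ (trans (eq K) (sym (cong (λ x → x ℤ.+ x) m≡))) (Per-* K (Anti⇒Per g))) f
        where
        eq : ∀ a → a ℤ.* (+ 4 ℤ.+ + 4) ≡ a ℤ.* (+ 2 ℤ.+ + 2) ℤ.+ a ℤ.* (+ 2 ℤ.+ + 2)
        eq = ℤ-Solver.solve-∀
      low : D.Low
      low evens odds se so zero _ _ = D.level-1-signs (+ 1) (ℤ.- + 1) (+ 0) refl (Odd-0+ odd-p)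
        (c-even-multiple {+ 2} K m≡) (c-odd-multiple {+ 2} (+ 0) refl) evens odds se
      low evens odds se so (suc j) (s≤s ()) _

    -- For even p the signs where x² = -1 must agree, so e = 4. The eighth roots of unity then lie
    -- below l and need `level-2`.
    design-8ρ : ∀ k → IsEven p → 4 < 2 ^ (k + 3) * ρ → 2 * (2 + p) ≤ 2 ^ (k + 3) * ρ →
      Design (2 ^ (k + 3) * ρ + 2 ^ (k + 3) * ρ) (4 + 2 * (p + p))
    design-8ρ k even-p e<m 2q<m = D.power-design e<m 2q<m H low
      where
      module D = PowerDesign (k + 3) 2 r p (m≤n⇒m≤o+n k (s≤s z≤n)) (s≤s z≤n)
      K = + (2 ^ k) ℤ.* + ρ
      m≡ : + (2 ^ (k + 3) * ρ) ≡ K ℤ.* (+ 4 ℤ.+ + 4)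
      m≡ = trans (+2^ 3 k ρ) (trans (cong (+ (2 ^ k) ℤ.*_) (ℤₚ.pos-* 8 ρ)) (eq (+ (2 ^ k)) (+ ρ)))
        where
        eq : ∀ a b → a ℤ.* (+ 8 ℤ.* b) ≡ a ℤ.* b ℤ.* (+ 4 ℤ.+ + 4)
        eq = ℤ-Solver.solve-∀
      m≡₂ : + (2 ^ (k + 3) * ρ) ≡ (K ℤ.* + 2) ℤ.* (+ 2 ℤ.+ + 2)
      m≡₂ = trans m≡ (eq K)
        where
        eq : ∀ a → a ℤ.* (+ 4 ℤ.+ + 4) ≡ a ℤ.* + 2 ℤ.* (+ 2 ℤ.+ + 2)
        eq = ℤ-Solver.solve-∀
      H : ∀ {w} → Anti (+ (2 ^ (k + 3) * ρ + 2 ^ (k + 3) * ρ)) w → Anti (+ 8) w → ∀ i → w i ≡ + 0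
      H f g = Per×Anti⇒0 (Per-≡ (trans (eq K) (sym (cong (λ x → x ℤ.+ x) m≡))) (Per-* K (Anti⇒Per g))) f
        where
        eq : ∀ a → a ℤ.* (+ 8 ℤ.+ + 8) ≡ a ℤ.* (+ 4 ℤ.+ + 4) ℤ.+ a ℤ.* (+ 4 ℤ.+ + 4)
        eq = ℤ-Solver.solve-∀
      low : D.Low
      low evens odds se so zero _ _ = D.level-1-signs (+ 1) (+ 1) (+ 1) refl (Odd-1+ even-p)
        (c-even-multiple {+ 2} (K ℤ.* + 2) m≡₂) (c-even-multiple {+ 2} (+ 1) refl) evens odds se
      low evens odds se so (suc zero) _ _ = Fold-down.level-2 r D.m 4 _ _ evens odds (+ 1) (ℤ.- + 1) odd-1 odd--1
        (subst IsEven (sym so) even-p) (c-even-multiple {+ 4} K m≡) (c-odd-multiple {+ 4} (+ 0) refl)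
      low evens odds se so (suc (suc j)) (s≤s (s≤s ())) _

    -- For m = 4ρ, e = 4 contains the same power of 2 as m, and e = 2 has the wrong sign for even p;
    -- e = 8 remains, at the price of 8 < 4ρ.
    design-4ρ-8 : IsEven p → 8 < 4 * ρ → 2 * (2 + p) ≤ 4 * ρ → Design (4 * ρ + 4 * ρ) (4 + 2 * (p + p))
    design-4ρ-8 even-p e<m 2q<m = D.power-design e<m 2q<m H low
      where
      module D = PowerDesign 2 3 r p (s≤s z≤n) (s≤s z≤n)
      m≡₂ : + (4 * ρ) ≡ + ρ ℤ.* (+ 2 ℤ.+ + 2)
      m≡₂ = trans (ℤₚ.pos-* 4 ρ) (ℤₚ.*-comm (+ 4) (+ ρ))
      m≡ : + (4 * ρ) ≡ + r ℤ.* (+ 4 ℤ.+ + 4) ℤ.+ + 4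
      m≡ = trans (ℤₚ.pos-* 4 ρ) (trans (cong (+ 4 ℤ.*_) (+ρ r)) (eq (+ r)))
        where
        eq : ∀ r → + 4 ℤ.* (+ 1 ℤ.+ + 2 ℤ.* r) ≡ r ℤ.* (+ 4 ℤ.+ + 4) ℤ.+ + 4
        eq = ℤ-Solver.solve-∀
      h+h≡ : + (4 * ρ + 4 * ρ) ℤ.+ + (4 * ρ + 4 * ρ) ≡ + r ℤ.* (+ 16 ℤ.+ + 16) ℤ.+ + 16
      h+h≡ = trans (cong (λ x → x ℤ.+ x ℤ.+ (x ℤ.+ x)) m≡) (eq (+ r))
        where
        eq : ∀ r → let m = r ℤ.* (+ 4 ℤ.+ + 4) ℤ.+ + 4 in m ℤ.+ m ℤ.+ (m ℤ.+ m) ≡ r ℤ.* (+ 16 ℤ.+ + 16) ℤ.+ + 16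
        eq = ℤ-Solver.solve-∀
      H : ∀ {w} → Anti (+ (4 * ρ + 4 * ρ)) w → Anti (+ 16) w → ∀ i → w i ≡ + 0
      H f g = Per×Anti⇒0 (Anti⇒Per f) (Anti-≡ (sym h+h≡) (Anti-odd (+ r) g))
      low : D.Low
      low evens odds se so zero _ _ = D.level-1-signs (+ 1) (+ 1) (+ 1) refl (Odd-1+ even-p)
        (c-even-multiple {+ 2} (+ ρ) m≡₂) (c-even-multiple {+ 2} (+ 2) refl) evens odds se
      low evens odds se so (suc zero) _ _ = Fold-down.level-2 r D.m 8 _ _ evens odds (ℤ.- + 1) (+ 1) odd--1 odd-1
        (subst IsEven (sym so) even-p) (c-odd-multiple {+ 4} (+ r) m≡) (c-even-multiple {+ 4} (+ 1) refl)
      low evens odds se so (suc (suc j)) _ (s≤s (s≤s (s≤s ())))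

  -- Designs for all orders

  two-adic : ∀ m → 0 < m → ∃₂ λ a r → m ≡ 2 ^ a * suc (2 * r)
  two-adic = <-rec (λ m → 0 < m → ∃₂ λ a r → m ≡ 2 ^ a * suc (2 * r)) step
    where
    step : ∀ m → (∀ {t} → t < m → 0 < t → ∃₂ λ a r → t ≡ 2 ^ a * suc (2 * r)) → 0 < m → ∃₂ λ a r → m ≡ 2 ^ a * suc (2 * r)
    step m rec 0<m with parity m
    ... | inj₂ (r , refl) = 0 , r , sym (*-identityˡ _)
    ... | inj₁ (suc t , refl) with rec {suc t} (subst (suc t <_) (*-comm (suc t) 2) (m<m*n (suc t) 2 (s≤s (s≤s z≤n)))) (s≤s z≤n)
    ...   | a , r , eq = suc a , r , trans (cong (2 *_) eq) (sym (*-assoc 2 (2 ^ a) (suc (2 * r))))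

  2*-cancel-< : ∀ {a b} → 2 * a < 2 * b → a < b
  2*-cancel-< {a} {b} = *-cancelˡ-< 2 a b

  Design-≡ : ∀ {h h′ D D′} → h ≡ h′ → D ≡ D′ → Design h D → Design h′ D′
  Design-≡ refl refl d = d

  m+m≡2*m : ∀ m → m + m ≡ 2 * m
  m+m≡2*m m = cong (_+_ m) (sym (+-identityʳ m))

  -- Here d = 8p + 4, and 4p + 4 is (d + 4)/2.
  design-4mod8 : ∀ p h → 4 * p + 4 ≤ h → Design h (2 + 2 * (p + p))
  design-4mod8 p h le with parity h
  ... | inj₂ (t , refl) = build t (2*-cancel-< (le₁ t le))
    where
    eq : ∀ p → suc (2 * suc (p + p)) ≡ 3 + 4 * p
    eq = solve-∀
    le₁ : ∀ t → 4 * p + 4 ≤ suc (2 * t) → 2 * suc (p + p) < 2 * t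
    le₁ t le = ≤-trans (≤-reflexive (eq p)) (s≤s⁻¹ (≤-trans (≤-reflexive (+-comm 4 (4 * p))) le))
    build : ∀ t → suc (p + p) < t → Design (suc (2 * t)) (2 + 2 * (p + p))
    build (suc g′) (s≤s lt) = odd-design g′ (p + p) lt
  ... | inj₁ (t , refl) = build t (2*-cancel-< (≤-trans (≤-trans (≤-reflexive (eq p)) (n≤1+n (3 + 4 * p))) (≤-trans (≤-reflexive (+-comm 4 (4 * p))) le)))
    where
    eq : ∀ p → suc (2 * suc (p + p)) ≡ 3 + 4 * p
    eq = solve-∀
    build : ∀ t → suc (p + p) < t → Design (2 * t) (2 + 2 * (p + p))
    build (suc m′) (s≤s lt) with two-adic (suc m′) (s≤s z≤n)
    ... | a , r , e = Design-≡ (m+m≡2*m (suc m′)) refl (even-design m′ (suc a) r p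
            (trans (m+m≡2*m (suc m′)) (trans (cong (2 *_) e) (sym (*-assoc 2 (2 ^ a) _)))) (subst (_< m′) (m+m≡2*m p) lt))

  odd≤even-strict : ∀ {a b} → IsOdd a → IsEven b → b ≤ a → b < a
  odd≤even-strict oa eb p = ≤∧≢⇒< p (IsEven≢IsOdd eb oa)

  -- Here d = 8p + 8, and 4p + 7 is (d + 6)/2; the exception is order 16 for degree 8.
  design-8∣ : ∀ p h → 4 * p + 7 ≤ h → (p ≡ 0 → h ≢ 8) → Design h (4 + 2 * (p + p))
  design-8∣ p h le exc with parity h
  ... | inj₂ (t , refl) = build t (2*-cancel-< (le₁ t le))
    where
    eq : ∀ p → suc (2 * (2 + (p + p))) ≡ 5 + 4 * p
    eq = solve-∀
    eq₂ : ∀ p → 7 + 4 * p ≡ 4 * p + 7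
    eq₂ = solve-∀
    le₁ : ∀ t → 4 * p + 7 ≤ suc (2 * t) → 2 * (2 + (p + p)) < 2 * t
    le₁ t le = ≤-trans (≤-reflexive (eq p)) (≤-trans (n≤1+n _) (s≤s⁻¹ (≤-trans (≤-reflexive (eq₂ p)) le)))
    eq₃ : ∀ p → 2 + 2 * suc (p + p) ≡ 4 + 2 * (p + p)
    eq₃ = solve-∀
    build : ∀ t → 2 + (p + p) < t → Design (suc (2 * t)) (4 + 2 * (p + p))
    build (suc g′) (s≤s lt) = Design-≡ refl (eq₃ p) (odd-design g′ (suc (p + p)) lt)
  ... | inj₁ (m , refl) = build (two-adic m (≤-<-trans z≤n 2q<m)) exc
    where
    le₁ : 2 * (2 * p + 3) < 2 * m
    le₁ = ≤-trans (≤-reflexive (eq p)) le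
      where
      eq : ∀ p → suc (2 * (2 * p + 3)) ≡ 4 * p + 7
      eq = solve-∀
    2q<m : 2 * p + 3 < m
    2q<m = 2*-cancel-< le₁
    2[2+p]≤m : 2 * (2 + p) ≤ m
    2[2+p]≤m = ≤-trans (≤-reflexive (eq p)) 2q<m
      where
      eq : ∀ p → 2 * (2 + p) ≡ suc (2 * p + 3)
      eq = solve-∀
    Goal : ℕ → Set
    Goal m = Design (2 * m) (4 + 2 * (p + p))

    odd-half : ∀ r → 2 * (2 + p) < suc (2 * r) → Goal (suc (2 * r))
    odd-half r lt = Design-≡ (trans (m+m≡2*m (b + 3)) (cong (2 *_) b+3)) (eq₂ p) (twice-odd-design b r p b+3 (+-cancelʳ-≤ 3 (2 * suc p) b (≤-trans (≤-trans (≤-reflexive (eq p)) lt) (≤-reflexive (sym b+3)))))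
      where
      eq : ∀ p → 2 * suc p + 3 ≡ suc (2 * (2 + p))
      eq = solve-∀
      eq₂ : ∀ p → 2 + 2 * (p + suc p) ≡ 4 + 2 * (p + p)
      eq₂ = solve-∀
      b = suc (2 * r) ∸ 3
      b+3 : b + 3 ≡ suc (2 * r)
      b+3 = m∸n+n≡m (≤-trans (≤-trans (m≤n+m 3 (2 * suc p)) (≤-reflexive (eq p))) lt)

    -- r = 0 means m = 4, where e = 8 is too large; the bound leaves only p = 0, which is the
    -- exception.
    four : ∀ r → IsEven p → 2 * (2 + p) ≤ 4 * suc (2 * r) → (p ≡ 0 → 2 * (4 * suc (2 * r)) ≢ 8) → Goal (4 * suc (2 * r))
    four (suc r) even-p le exc = Design-≡ (m+m≡2*m (4 * suc (2 * suc r))) refl (design-4ρ-8 (suc r) p even-p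
      (≤-trans (m≤m+n 9 3) (*-monoʳ-≤ 4 {3} (s≤s (*-monoʳ-≤ 2 {1} (s≤s z≤n))))) le)
    four zero _ le exc = ⊥-elim (exc (n≤0⇒n≡0 (s≤s⁻¹ (s≤s⁻¹ (*-cancelˡ-≤ {2 + p} {2} 2 le)))) refl)

    module _ (r : ℕ) where
      ρ = suc (2 * r)

      twice : 2 * (2 + p) ≤ 2 * ρ → Goal (2 * ρ)
      twice le with parity p
      ... | inj₂ odd-p@(t , _) = Design-≡ (m+m≡2*m (2 * ρ)) refl (design-2ρ r p odd-p (<-≤-trans
              (*-monoʳ-< 2 (s≤s (s≤s (subst (0 <_) (sym (proj₂ odd-p)) (s≤s z≤n))))) le) le)
      ... | inj₁ (t , p≡) = Design-≡ (trans (m+m≡2*m (b + 3)) (cong (2 *_) b+3)) (eq₂ p)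
              (four-times-odd-design b r p b+3 (t , p≡) (+-cancelʳ-≤ 3 _ b (≤-trans big (≤-reflexive (sym b+3)))))
        where
        eq : ∀ p → suc (2 * suc p) + 3 ≡ 2 * (3 + p)
        eq = solve-∀
        eq₁ : ∀ t → 2 + 2 * t ≡ 2 * suc t
        eq₁ = solve-∀
        eq₂ : ∀ p → 2 + 2 * (suc p + p) ≡ 4 + 2 * (p + p)
        eq₂ = solve-∀
        big : suc (2 * suc p) + 3 ≤ 2 * ρ
        -- 2 + p is even and ρ is odd, so 2 + p ≤ ρ is strict; the core element m - 3 needs this
        -- room.
        big = ≤-trans (≤-reflexive (eq p)) (*-monoʳ-≤ 2 (odd≤even-strict (r , refl) (suc t , trans (cong (_+_ 2) p≡) (eq₁ t)) (*-cancelˡ-≤ 2 le)))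
        b = 2 * ρ ∸ 3
        b+3 : b + 3 ≡ 2 * ρ
        b+3 = m∸n+n≡m (≤-trans (m≤n+m 3 (suc (2 * suc p))) big)

      power : ∀ k → 2 * (2 + p) ≤ 2 ^ (k + 2) * ρ → (p ≡ 0 → 2 * (2 ^ (k + 2) * ρ) ≢ 8) → Goal (2 ^ (k + 2) * ρ)
      power k le exc with parity p
      ... | inj₂ odd-p = Design-≡ (m+m≡2*m (2 ^ (k + 2) * ρ)) refl (design-4ρ r p k odd-p (<-≤-trans (s≤s (s≤s (s≤s z≤n))) (≤-trans (*-monoʳ-≤ 2 (m≤m+n 2 p)) le)) le)
      ... | inj₁ even-p = even-case k le exc
        where
        even-case : ∀ k → 2 * (2 + p) ≤ 2 ^ (k + 2) * ρ → (p ≡ 0 → 2 * (2 ^ (k + 2) * ρ) ≢ 8) → Goal (2 ^ (k + 2) * ρ)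
        even-case (suc k) le _ = subst (λ n → 2 * (2 + p) ≤ 2 ^ n * ρ → Goal (2 ^ n * ρ)) (+-suc k 2)
          (λ le → Design-≡ (m+m≡2*m (2 ^ (k + 3) * ρ)) refl (design-8ρ r p k even-p
            (≤-trans (m≤m+n 5 3) (≤-trans (^-monoʳ-≤ 2 (m≤n+m 3 k)) (m≤m*n (2 ^ (k + 3)) ρ))) le)) le
        even-case zero le exc = four r even-p le exc

    build : (∃₂ λ a r → m ≡ 2 ^ a * suc (2 * r)) → (p ≡ 0 → 2 * m ≢ 8) → Goal m
    build (zero , r , e) exc = subst Goal (trans (sym (*-identityˡ _)) (sym e)) (odd-half r
      (odd≤even-strict (r , refl) (2 + p , refl) (subst (2 * (2 + p) ≤_) (trans e (*-identityˡ _)) 2[2+p]≤m)))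
    build (suc zero , r , e) exc = subst Goal (sym e) (twice r (subst (2 * (2 + p) ≤_) e 2[2+p]≤m))
    build (suc (suc k) , r , e) exc = subst Goal (sym e′) (power r k (subst (2 * (2 + p) ≤_) e′ 2[2+p]≤m) (λ p0 → subst (λ n → 2 * n ≢ 8) e′ (exc p0)))
      where
      e′ : m ≡ 2 ^ (k + 2) * suc (2 * r)
      e′ = trans e (cong (λ n → 2 ^ n * suc (2 * r)) (+-comm 2 k))

-- Passage between rational kernels of circulant graphs and integer sequences

module Graphs where

  open import Data.Bool.Properties using (∨-comm; ∨-identityʳ)
  open import Data.Fin.Properties using (toℕ-injective; toℕ-fromℕ<; toℕ<n)
  open import Data.Integer hiding (suc)
  open import Data.Integer.DivMod using (a≡a%ℕn+[a/ℕn]*n; n%ℕd<d)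
  open import Data.Integer.Divisibility.Signed
  open import Data.Integer.Properties
  open import Data.Integer.Tactic.RingSolver using (solve-∀)
  open import Data.List using (List; []; _∷_; map)
  open import Data.List.Relation.Unary.All as All using (All; []; _∷_)
  open import Data.List.Relation.Unary.AllPairs using ([]; _∷_)
  open import Data.List.Relation.Unary.Unique.Propositional using (Unique)
  open import Data.Nat using (ℕ; suc)
  open import Data.Rational as ℚ using (ℚ; 0ℚ; 1ℚ; mkℚ; ↥_; ↧_)
  open import Data.Rational.Unnormalised using (*≡*)
  open import Relation.Nullary.Decidable using (toWitness; _×-dec_; _⊎-dec_; _→-dec_)
  open Kernels
  open Designs

  -- Integral kernel vectors

  -- Given in lowest terms, so that the numerator returns the integer by computation.
  ι : ℤ → ℚ
  ι z = mkℚ z 0 (Coprimality.sym (Coprimality.1-coprimeTo ∣ z ∣))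

  ι-injective : ∀ {a b} → ι a ≡ ι b → a ≡ b
  ι-injective = cong ↥_

  ι-+ : ∀ a b → ι (a + b) ≡ ι a ℚ.+ ι b
  ι-+ a b = ℚₚ.toℚᵘ-injective (ℚᵘₚ.≃-trans (*≡* (eq a b)) (ℚᵘₚ.≃-sym (ℚₚ.toℚᵘ-homo-+ (ι a) (ι b))))
    where
    eq : ∀ a b → (a + b) * + 1 ≡ (a * + 1 + b * + 1) * + 1
    eq = solve-∀

  ι-* : ∀ a b → ι (a * b) ≡ ι a ℚ.* ι b
  ι-* a b = ℚₚ.toℚᵘ-injective (ℚᵘₚ.≃-sym (ℚₚ.toℚᵘ-homo-* (ι a) (ι b)))

  clear-denominator : ∀ p → ι (↧ p) ℚ.* p ≡ ι (↥ p)
  clear-denominator p@(mkℚ n d-1 _) = ℚₚ.toℚᵘ-injective (ℚᵘₚ.≃-trans (ℚₚ.toℚᵘ-homo-* (ι (↧ p)) p) (*≡* (eq (↧ p) n)))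
    where
    eq : ∀ d n → d * n * + 1 ≡ n * (+ 1 * d)
    eq = solve-∀

  ℚ-cancelˡ : ∀ {d p q} → d ≢ 0ℚ → d ℚ.* p ≡ d ℚ.* q → p ≡ q
  ℚ-cancelˡ {d} {p} {q} d≢0 e = trans (undo p) (trans (cong (ℚ.1/ d ℚ.*_) e) (sym (undo q)))
    where
    instance
      nz = ℚ.≢-nonZero d≢0
    undo : ∀ p → p ≡ ℚ.1/ d ℚ.* (d ℚ.* p)
    undo p = sym (trans (sym (ℚₚ.*-assoc (ℚ.1/ d) d p)) (trans (cong (ℚ._* p) (ℚₚ.*-inverseˡ d)) (ℚₚ.*-identityˡ p)))

  *-≢0 : ∀ {a b} → a ≢ + 0 → b ≢ + 0 → a * b ≢ + 0
  *-≢0 {a} a≢0 b≢0 e with i*j≡0⇒i≡0∨j≡0 a e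
  ... | inj₁ a≡0 = a≢0 a≡0
  ... | inj₂ b≡0 = b≢0 b≡0

  record Integral {n} (x : Fin n → ℚ) : Set where
    field
      D   : ℤ
      D≢0 : D ≢ + 0
      z   : Fin n → ℤ
      Dx≡z : ∀ j → ι D ℚ.* x j ≡ ι (z j)

  integral : ∀ {n} (x : Fin n → ℚ) → Integral x
  integral {zero} x = record { D = + 1 ; D≢0 = λ () ; z = λ () ; Dx≡z = λ () }
  integral {suc n} x = record
    { D = ↧ p * D
    ; D≢0 = *-≢0 {↧ p} (λ ()) D≢0
    ; z = λ { fzero → D * ↥ p ; (fsuc j) → ↧ p * z j }
    ; Dx≡z = λ
        { fzero → trans (cong (ℚ._* p) (trans (cong ι (*-comm (↧ p) D)) (ι-* D (↧ p)))) (trans (ℚₚ.*-assoc (ι D) (ι (↧ p)) p)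
            (trans (cong (ι D ℚ.*_) (clear-denominator p)) (sym (ι-* D (↥ p)))))
        ; (fsuc j) → trans (cong (ℚ._* x (fsuc j)) (ι-* (↧ p) D)) (trans (ℚₚ.*-assoc (ι (↧ p)) (ι D) (x (fsuc j)))
            (trans (cong (ι (↧ p) ℚ.*_) (Dx≡z j)) (sym (ι-* (↧ p) (z j)))))
        }
    }
    where
    p = x fzero
    open Integral (integral (λ j → x (fsuc j)))

  ∑ℤ : (n : ℕ) → (Fin n → ℤ) → ℤ
  ∑ℤ zero f = + 0
  ∑ℤ (suc n) f = f fzero + ∑ℤ n (λ i → f (fsuc i))

  ∑ℤ-cong : ∀ n {f g} → (∀ j → f j ≡ g j) → ∑ℤ n f ≡ ∑ℤ n g
  ∑ℤ-cong zero e = refl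
  ∑ℤ-cong (suc n) e = cong₂ _+_ (e fzero) (∑ℤ-cong n λ j → e (fsuc j))

  ∑ℚ-integral : ∀ n D (b : Fin n → Bool) (x : Fin n → ℚ) (z : Fin n → ℤ) → (∀ j → ι D ℚ.* x j ≡ ι (z j)) →
    ι D ℚ.* ∑ℚ n (λ j → (if b j then 1ℚ else 0ℚ) ℚ.* x j) ≡ ι (∑ℤ n (λ j → if b j then z j else + 0))
  ∑ℚ-integral zero D b x z e = ℚₚ.*-zeroʳ (ι D)
  ∑ℚ-integral (suc n) D b x z e = trans (ℚₚ.*-distribˡ-+ (ι D) ((if b fzero then 1ℚ else 0ℚ) ℚ.* x fzero) (∑ℚ n λ j → (if b (fsuc j) then 1ℚ else 0ℚ) ℚ.* x (fsuc j)))
      (trans (cong₂ ℚ._+_ (term (b fzero)) (∑ℚ-integral n D (λ j → b (fsuc j)) (λ j → x (fsuc j)) (λ j → z (fsuc j)) λ j → e (fsuc j)))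
        (sym (ι-+ (if b fzero then z fzero else + 0) (∑ℤ n λ j → if b (fsuc j) then z (fsuc j) else + 0))))
    where
    term : ∀ b → ι D ℚ.* ((if b then 1ℚ else 0ℚ) ℚ.* x fzero) ≡ ι (if b then z fzero else + 0)
    term true = trans (cong (ι D ℚ.*_) (ℚₚ.*-identityˡ (x fzero))) (e fzero)
    term false = trans (cong (ι D ℚ.*_) (ℚₚ.*-zeroˡ (x fzero))) (ℚₚ.*-zeroʳ (ι D))

  ∑ℕ-indicator : ∀ n (b : Fin n → Bool) → + ∑ℕ n (λ j → if b j then 1 else 0) ≡ ∑ℤ n (λ j → if b j then + 1 else + 0)
  ∑ℕ-indicator zero b = refl
  ∑ℕ-indicator (suc n) b = trans (pos-+ (if b fzero then 1 else 0) _) (cong₂ _+_ (head (b fzero)) (∑ℕ-indicator n λ j → b (fsuc j)))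
    where
    head : ∀ b → + (if b then 1 else 0) ≡ (if b then + 1 else + 0)
    head true = refl
    head false = refl

  residue-unique : ∀ n .{{_ : ℕ.NonZero n}} a b → + n ∣ a - b → a %ℕ n ≡ b %ℕ n
  residue-unique n a b d = conclude (ℕₚ.≤-total ra rb)
    where
    ra = a %ℕ n
    rb = b %ℕ n
    eq : ∀ a b q q′ n → a + q * n - (b + q′ * n) - (q - q′) * n ≡ a - b
    eq = solve-∀
    d′ : + n ∣ + ra - + rb
    d′ = ∣-resp (trans (cong₂ (λ x y → x - y - (a /ℕ n - b /ℕ n) * + n) (a≡a%ℕn+[a/ℕn]*n a n) (a≡a%ℕn+[a/ℕn]*n b n))
      (eq (+ ra) (+ rb) (a /ℕ n) (b /ℕ n) (+ n))) (∣m∣n⇒∣m-n d (divides (a /ℕ n - b /ℕ n) refl))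
    close : ∀ {p q} → p ℕ.≤ q → q ℕ.< n → + n ∣ + q - + p → p ≡ q
    close {p} {q} p≤q q<n dv with q ℕ.∸ p in e
    ... | zero = ℕₚ.≤-antisym p≤q (ℕₚ.m∸n≡0⇒m≤n e)
    ... | suc k = ⊥-elim (ℕₚ.<⇒≱ (ℕₚ.≤-<-trans (ℕₚ.m∸n≤m q p) q<n)
        (ℕ∣.∣⇒≤ {{ℕ.≢-nonZero λ q∸p≡0 → ℕₚ.1+n≢0 (trans (sym e) q∸p≡0)}} (∣⇒∣ᵤ (∣-resp (trans (m-n≡m⊖n q p) (⊖-≥ p≤q)) dv))))
    conclude : ra ℕ.≤ rb ⊎ rb ℕ.≤ ra → ra ≡ rb
    conclude (inj₁ p) = close p (n%ℕd<d b n) (∣-resp (neg-sub (+ ra) (+ rb)) (∣m⇒∣-m d′))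
      where
      neg-sub : ∀ a b → - (a - b) ≡ b - a
      neg-sub = solve-∀
    conclude (inj₂ p) = sym (close p (n%ℕd<d a n) d′)

  residue-small : ∀ {n k} .{{_ : ℕ.NonZero n}} → k ℕ.< n → (+ k) %ℕ n ≡ k
  residue-small p = ℕ/.m<n⇒m%n≡m p

  ∣-residue : ∀ n .{{_ : ℕ.NonZero n}} t → + n ∣ t - + (t %ℕ n)
  ∣-residue n t = divides (t /ℕ n) (trans (cong (_- + (t %ℕ n)) (a≡a%ℕn+[a/ℕn]*n t n)) (eq (+ (t %ℕ n)) (t /ℕ n * + n)))
    where
    eq : ∀ a b → a + b - a ≡ b
    eq = solve-∀

  δ : (n : ℕ) .{{_ : ℕ.NonZero n}} → Seq
  δ n t = if (t %ℕ n) ℕ.≡ᵇ 0 then + 1 else + 0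

  Per-δ : ∀ n .{{_ : ℕ.NonZero n}} → Per (+ n) (δ n)
  Per-δ n = mk λ i → cong (λ r → if r ℕ.≡ᵇ 0 then + 1 else + 0) (residue-unique n (i + + n) i (divides (+ 1) (eq i (+ n))))
    where
    eq : ∀ i n → i + n - i ≡ + 1 * n
    eq = solve-∀

  -- Test vectors: by nullity one, a kernel vector with a zero entry vanishes.
  module _ (p : ℕ) .{{_ : ℕ.NonZero (p ℕ.+ p)}} where
    -- It is 1 at multiples of 2p, -1 at odd multiples of p, and zero elsewhere. For p = 1 this is
    -- the alternating sequence; for p ≥ 2 it vanishes at 1.
    wave : Seq
    wave t = δ (p ℕ.+ p) t - δ (p ℕ.+ p) (t - + p)

    wave-Anti : Anti (+ p) wave
    wave-Anti = mk λ i → trans (cong₂ (λ x y → δ (p ℕ.+ p) x - δ (p ℕ.+ p) y) (i₁ i (+ p)) (i₂ i (+ p)))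
        (trans (cong (_- δ (p ℕ.+ p) i) (per (Per-δ (p ℕ.+ p)) (i - + p))) (eq (δ (p ℕ.+ p) (i - + p)) (δ (p ℕ.+ p) i)))
      where
      i₁ : ∀ i p → i + p ≡ i - p + (p + p)
      i₁ = solve-∀
      i₂ : ∀ i p → i + p - p ≡ i
      i₂ = solve-∀
      eq : ∀ a b → a - b ≡ - (b - a)
      eq = solve-∀

  wave-at-0 : ∀ p → wave (suc p) (+ 0) ≡ + 1
  wave-at-0 p = trans (cong (λ r → + 1 - (if r ℕ.≡ᵇ 0 then + 1 else + 0)) r≡) refl
    where
    n = suc p ℕ.+ suc p
    eq : ∀ p → + 0 - p - p ≡ - + 1 * (p + p)
    eq = solve-∀
    r≡ : (+ 0 - + suc p) %ℕ n ≡ suc p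
    r≡ = trans (residue-unique n (+ 0 - + suc p) (+ suc p) (divides (- + 1) (eq (+ suc p)))) (residue-small {n} (ℕₚ.m<m+n (suc p) (s≤s z≤n)))

  wave-at-1 : ∀ p → wave (suc (suc p)) (+ 1) ≡ + 0
  wave-at-1 p = cong₂ (λ x y → (if x ℕ.≡ᵇ 0 then + 1 else + 0) - (if y ℕ.≡ᵇ 0 then + 1 else + 0))
      (residue-small {n} {1} (s≤s (s≤s z≤n))) r≡
    where
    q = suc (suc p)
    n = q ℕ.+ q
    eq : ∀ p → + 1 - p - (+ 1 + p) ≡ - + 1 * (p + p)
    eq = solve-∀
    r≡ : (+ 1 - + q) %ℕ n ≡ suc q
    r≡ = trans (residue-unique n (+ 1 - + q) (+ suc q) (divides (- + 1) (eq (+ q)))) (residue-small {n} (s≤s (s≤s (ℕₚ.m≤n+m q p))))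

  -- Circulant graphs as connection sets

  Fold-cong : ∀ σ p k {w v} → w ≗ v → Fold σ p k w ≗ Fold σ p k v
  Fold-cong σ p zero e i = refl
  Fold-cong σ p (suc k) e i = cong₂ (λ x y → x + σ * y) (e i) (Fold-cong σ p k e (i + p))

  Fold-shift : ∀ σ p k m w i → Fold σ p k (shift m w) i ≡ Fold σ p k w (i + m)
  Fold-shift σ p zero m w i = refl
  Fold-shift σ p (suc k) m w i = cong (λ x → w (i + m) + σ * x)
      (trans (Fold-shift σ p k m w (i + p)) (cong (Fold σ p k w) (eq i p m)))
    where
    eq : ∀ i p m → i + p + m ≡ i + m + p
    eq = solve-∀

  Sum : ℕ → Seq → Seq
  Sum = Fold (+ 1) (+ 1)

  ∑ℤ-Sum : ∀ n F i → ∑ℤ n (λ j → F (+ toℕ j + i)) ≡ Sum n F i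
  ∑ℤ-Sum zero F i = refl
  ∑ℤ-Sum (suc n) F i = cong₂ _+_ (cong F (+-identityˡ i)) (trans (∑ℤ-cong n λ j → cong F (eq (+ toℕ j) i))
      (trans (∑ℤ-Sum n F (i + + 1)) (sym (*-identityˡ _))))
    where
    eq : ∀ j i → + 1 + j + i ≡ j + (i + + 1)
    eq = solve-∀

  Sum-last : ∀ n F i → Sum (suc n) F i ≡ Sum n F i + F (i + + n)
  Sum-last n F i = trans (cong (_+_ (F i)) (Fold-step (+ 1) (+ 1) n F i))
      (trans (cong₂ (λ s j → F i + (Sum n F i - F i + s * F (i + j))) (^-zeroˡ n) (*-identityʳ (+ n))) (eq (F i) (Sum n F i) (F (i + + n))))
    where
    eq : ∀ a s b → a + (s - a + + 1 * b) ≡ s + b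
    eq = solve-∀

  Sum-window : ∀ {n F} → Per (+ n) F → ∀ i → Sum n F i ≡ Sum n F (+ 0)
  Sum-window {n} {F} f i = trans (cong (Sum n F) (eq i))
      (per (Per-* i (Per-Fold (+ 1) n (Per-≡ (sym (*-identityʳ (+ n))) f))) (+ 0))
    where
    eq : ∀ i → i ≡ + 0 + i * + 1
    eq = solve-∀

  Σ₁ : ℕ → (ℕ → ℤ) → ℤ
  Σ₁ zero g = + 0
  Σ₁ (suc k) g = g (suc k) + Σ₁ k g

  Σ₁-cong : ∀ k {f g} → (∀ s → 0 ℕ.< s → s ℕ.≤ k → f s ≡ g s) → Σ₁ k f ≡ Σ₁ k g
  Σ₁-cong zero e = refl
  Σ₁-cong (suc k) e = cong₂ _+_ (e (suc k) (s≤s z≤n) ℕₚ.≤-refl) (Σ₁-cong k λ s p q → e s p (ℕₚ.m≤n⇒m≤1+n q))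

  Σ₁-+ : ∀ k f g → Σ₁ k (λ s → f s + g s) ≡ Σ₁ k f + Σ₁ k g
  Σ₁-+ zero f g = refl
  Σ₁-+ (suc k) f g = trans (cong (_+_ (f (suc k) + g (suc k))) (Σ₁-+ k f g)) (eq (f (suc k)) (g (suc k)) (Σ₁ k f) (Σ₁ k g))
    where
    eq : ∀ a b c d → a + b + (c + d) ≡ a + c + (b + d)
    eq = solve-∀

  Σ₁-* : ∀ k x f → Σ₁ k (λ s → x * f s) ≡ x * Σ₁ k f
  Σ₁-* zero x f = sym (*-zeroʳ x)
  Σ₁-* (suc k) x f = trans (cong (_+_ (x * f (suc k))) (Σ₁-* k x f)) (sym (*-distribˡ-+ x (f (suc k)) _))

  Σ₁-0 : ∀ k → Σ₁ k (λ _ → + 0) ≡ + 0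
  Σ₁-0 zero = refl
  Σ₁-0 (suc k) = trans (+-identityˡ _) (Σ₁-0 k)

  Sum-symmetric : ∀ k F → Sum (suc (2 ℕ.* k)) F (- + k) ≡ F (+ 0) + Σ₁ k (λ s → F (+ s) + F (- + s))
  Sum-symmetric zero F = refl
  Sum-symmetric (suc k) F = trans (cong (λ n → Sum (suc n) F (- + suc k)) (ℕₚ.*-suc 2 k)) (trans
      (Sum-last (suc (suc (2 ℕ.* k))) F (- + suc k))
      (trans (cong₂ (λ x y → F (- + suc k) + + 1 * x + F y) (trans (cong (Sum (suc (2 ℕ.* k)) F) (i₁ (+ k))) (Sum-symmetric k F))
          (trans (cong (λ x → - + suc k + (+ 2 + x)) (pos-* 2 k)) (i₂ (+ k))))
        (eq (F (- + suc k)) (F (+ 0)) (Σ₁ k (λ s → F (+ s) + F (- + s))) (F (+ suc k)))))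
    where
    i₁ : ∀ k → - (+ 1 + k) + + 1 ≡ - k
    i₁ = solve-∀
    i₂ : ∀ k → - (+ 1 + k) + (+ 2 + + 2 * k) ≡ + 1 + k
    i₂ = solve-∀
    eq : ∀ a b c d → a + + 1 * (b + c) + d ≡ b + (d + a + c)
    eq = solve-∀

  -- The window from -k to k + 1 pairs s with -s and leaves 0 and k + 1, half the period, unpaired.
  Sum-halves : ∀ k F → Per (+ (suc k ℕ.+ suc k)) F →
    Sum (suc k ℕ.+ suc k) F (+ 0) ≡ F (+ 0) + F (+ suc k) + Σ₁ k (λ s → F (+ s) + F (- + s))
  Sum-halves k F f = trans (sym (Sum-window f (- + k))) (trans (cong (λ n → Sum n F (- + k)) n≡)
      (trans (Sum-last (suc (2 ℕ.* k)) F (- + k)) (trans (cong₂ (λ x j → x + F j) (Sum-symmetric k F)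
        (trans (cong (λ x → - + k + (+ 1 + x)) (pos-* 2 k)) (i₁ (+ k)))) (eq (F (+ 0)) _ (F (+ suc k))))))
    where
    n≡ : suc k ℕ.+ suc k ≡ suc (suc (2 ℕ.* k))
    n≡ = cong suc (trans (ℕₚ.+-suc k k) (cong (λ x → suc (k ℕ.+ x)) (sym (ℕₚ.+-identityʳ k))))
    i₁ : ∀ k → - k + (+ 1 + + 2 * k) ≡ + 1 + k
    i₁ = solve-∀
    eq : ∀ a s b → a + s + b ≡ a + b + s
    eq = solve-∀

  -- The sum over the neighbours of i, for the connection set {t : χ t}.
  Conv : ℕ → (ℤ → Bool) → Seq → Seq
  Conv n χ Z i = Sum n (λ t → if χ t then Z (i + t) else + 0) (+ 0)

  Conv-neighbour-Per : ∀ {n} (χ : ℤ → Bool) {Z} → (∀ t → χ (t + + n) ≡ χ t) → Per (+ n) Z → ∀ i → Per (+ n) (λ t → if χ t then Z (i + t) else + 0)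
  Conv-neighbour-Per {n} χ {Z} χ-per f i = mk λ t → cong₂ (λ b x → if b then x else + 0) (χ-per t)
    (trans (cong Z (sym (+-assoc i t (+ n)))) (per f (i + t)))

  row-sum : ∀ {n χ Z} → (∀ t → χ (t + + n) ≡ χ t) → Per (+ n) Z → ∀ i →
    ∑ℤ n (λ j → if χ (+ toℕ j - i) then Z (+ toℕ j) else + 0) ≡ Conv n χ Z i
  row-sum {n} {χ} {Z} χ-per f i = trans (∑ℤ-cong n (λ j → cong F (sym (+-identityʳ (+ toℕ j))))) (trans (∑ℤ-Sum n F (+ 0))
      (trans (sym (Sum-window per-F (+ 0 + i))) (trans (sym (Fold-shift (+ 1) (+ 1) n i F (+ 0)))
        (Fold-cong (+ 1) (+ 1) n (λ t → cong₂ (λ x y → if χ x then Z y else + 0) (eq t i) (+-comm t i)) (+ 0)))))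
    where
    F : Seq
    F t = if χ (t - i) then Z t else + 0
    eq : ∀ t i → t + i - i ≡ t
    eq = solve-∀
    eq₁ : ∀ t n i → t + n - i ≡ t - i + n
    eq₁ = solve-∀
    per-F : Per (+ n) F
    per-F = mk λ t → cong₂ (λ b x → if b then x else + 0) (trans (cong χ (eq₁ t (+ n) i)) (χ-per (t - i))) (per f t)

  Conv-half : ∀ {k χ Z} → let n = suc k ℕ.+ suc k in (∀ t → χ (t + + n) ≡ χ t) → (∀ t → χ (- t) ≡ χ t) → χ (+ 0) ≡ false → Per (+ n) Z → ∀ i →
    Conv n χ Z i ≡ (if χ (+ suc k) then Z (i + + suc k) else + 0) + Σ₁ k (λ s → if χ (+ s) then c (+ s) Z i else + 0)
  Conv-half {k} {χ} {Z} χ-per χ-neg χ-0 f i = trans (Sum-halves k F (Conv-neighbour-Per χ χ-per f i))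
      (cong₂ _+_ (trans (cong (λ b → (if b then Z (i + + 0) else + 0) + F (+ suc k)) χ-0) (+-identityˡ (F (+ suc k))))
        (Σ₁-cong k λ s _ _ → pair (+ s)))
    where
    F : Seq
    F t = if χ t then Z (i + t) else + 0
    pair : ∀ s → F s + F (- s) ≡ (if χ s then c s Z i else + 0)
    pair s rewrite χ-neg s with χ s
    ... | true = refl
    ... | false = refl

  record Connection {n} (G : Graph n) (χ : ℤ → Bool) : Set where
    field
      adj≡  : ∀ i j → adj G i j ≡ χ (+ toℕ j - + toℕ i)
      χ-per : ∀ t → χ (t + + n) ≡ χ t
      χ-neg : ∀ t → χ (- t) ≡ χ t
      χ-0   : χ (+ 0) ≡ false

  module _ {n : ℕ} .{{_ : ℕ.NonZero n}} where

    idx : ℤ → Fin n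
    idx t = fromℕ< (n%ℕd<d t n)

    toℕ-idx : ∀ t → toℕ (idx t) ≡ t %ℕ n
    toℕ-idx t = toℕ-fromℕ< (n%ℕd<d t n)

    idx-cong : ∀ s t → + n ∣ s - t → idx s ≡ idx t
    idx-cong s t d = toℕ-injective (trans (toℕ-idx s) (trans (residue-unique n s t d) (sym (toℕ-idx t))))

    idx-toℕ : ∀ j → idx (+ toℕ j) ≡ j
    idx-toℕ j = toℕ-injective (trans (toℕ-idx (+ toℕ j)) (residue-small (toℕ<n j)))

    module _ (G : Graph n) (circ : Circulant G) where
      jump : ℤ → Bool
      jump t = adj G (idx (+ 0)) (idx t)

      private
        0%n : (+ 0) %ℕ n ≡ 0
        0%n = residue-small (ℕₚ.n≢0⇒n>0 (ℕ.≢-nonZero⁻¹ n))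

      adj-jump : ∀ i j t → + n ∣ (+ toℕ j - + toℕ i) - t → adj G i j ≡ jump t
      adj-jump i j t d = circ i j (idx (+ 0)) (idx t) (∣⇒∣ᵤ (∣-resp
          (trans (eq (+ toℕ j - + toℕ i) t (+ (t %ℕ n))) (sym (cong₂ (λ x y → + toℕ j - + toℕ i - (+ x - + y)) (toℕ-idx t) (trans (toℕ-idx (+ 0)) 0%n))))
          (∣m∣n⇒∣m+n d (∣-residue n t))))
        where
        eq : ∀ a t r → a - t + (t - r) ≡ a - (r - + 0)
        eq = solve-∀

      connection : Connection G jump
      connection = record
        { adj≡ = λ i j → adj-jump i j (+ toℕ j - + toℕ i) (∣-resp (sym (+-inverseʳ (+ toℕ j - + toℕ i))) (divides (+ 0) refl))
        ; χ-per = λ t → cong (adj G (idx (+ 0))) (idx-cong (t + + n) t (divides (+ 1) (eq₁ t (+ n))))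
        ; χ-neg = λ t → sym (trans (adj-sym G (idx (+ 0)) (idx t)) (adj-jump (idx t) (idx (+ 0)) (- t)
            (∣-resp (sym (trans (cong₂ (λ x y → + x - + y - - t) (trans (toℕ-idx (+ 0)) 0%n) (toℕ-idx t)) (eq₂ (+ (t %ℕ n)) t))) (∣-residue n t))))
        ; χ-0 = adj-irr G (idx (+ 0))
        }
        where
        eq₁ : ∀ t n → t + n - t ≡ + 1 * n
        eq₁ = solve-∀
        eq₂ : ∀ r t → + 0 - r - - t ≡ t - r
        eq₂ = solve-∀

    Conv-residue : ∀ χ {Z} → Per (+ n) Z → ∀ i → Conv n χ Z i ≡ Conv n χ Z (+ toℕ (idx i))
    Conv-residue χ {Z} f i = Fold-cong (+ 1) (+ 1) n (λ t → cong (λ x → if χ t then x else + 0)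
        (trans (cong Z (trans (cong (_+ t) (a≡a%ℕn+[a/ℕn]*n i n)) (trans (eq (+ (i %ℕ n)) (i /ℕ n * + n) t) (cong (λ r → + r + t + i /ℕ n * + n) (sym (toℕ-idx i))))))
          (per (Per-* (i /ℕ n) f) (+ toℕ (idx i) + t)))) (+ 0)
      where
      eq : ∀ a b t → a + b + t ≡ a + t + b
      eq = solve-∀

    extend : (Fin n → ℤ) → Seq
    extend z t = z (idx t)

    Per-extend : ∀ z → Per (+ n) (extend z)
    Per-extend z = mk λ t → cong z (idx-cong (t + + n) t (divides (+ 1) (eq t (+ n))))
      where
      eq : ∀ t n → t + n - t ≡ + 1 * n
      eq = solve-∀

    module _ {G : Graph n} {χ : ℤ → Bool} (conn : Connection G χ) where
      open Connection conn

      ∑ℤ-row : ∀ {Z} → Per (+ n) Z → ∀ i → ∑ℤ n (λ j → if adj G i j then Z (+ toℕ j) else + 0) ≡ Conv n χ Z (+ toℕ i)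
      ∑ℤ-row {Z} f i = trans (∑ℤ-cong n λ j → cong (λ b → if b then Z (+ toℕ j) else + 0) (adj≡ i j)) (row-sum χ-per f (+ toℕ i))

      kernel⇒Conv : ∀ {x} (I : Integral x) → InKernel G x → ∀ i → Conv n χ (extend (Integral.z I)) i ≡ + 0
      kernel⇒Conv {x} I k i = trans (Conv-residue χ (Per-extend z) i) (trans (sym (∑ℤ-row (Per-extend z) (idx i)))
          (trans (∑ℤ-cong n λ j → cong (λ y → if adj G (idx i) j then z y else + 0) (idx-toℕ j))
            (ι-injective (trans (sym (∑ℚ-integral n D (adj G (idx i)) x z Dx≡z)) (trans (cong (ι D ℚ.*_) (k (idx i))) (ℚₚ.*-zeroʳ (ι D)))))))
        where
        open Integral I

      Conv⇒kernel : ∀ {Z} → Per (+ n) Z → (∀ i → Conv n χ Z i ≡ + 0) → InKernel G (λ j → ι (Z (+ toℕ j)))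
      Conv⇒kernel {Z} f k i = trans (sym (ℚₚ.*-identityˡ _)) (trans (∑ℚ-integral n (+ 1) (adj G i) (λ j → ι (Z (+ toℕ j))) (λ j → Z (+ toℕ j)) λ j → ℚₚ.*-identityˡ (ι (Z (+ toℕ j))))
        (cong ι (trans (∑ℤ-row f i) (k (+ toℕ i)))))

      degree≡Conv : ∀ i → + degree G i ≡ Conv n χ (λ _ → + 1) (+ toℕ i)
      degree≡Conv i = trans (∑ℕ-indicator n (adj G i)) (∑ℤ-row {λ _ → + 1} (mk λ _ → refl) i)

  -- From designs to nut graphs

  mem : ℕ → List ℕ → Bool
  mem s [] = false
  mem s (a ∷ L) = (s ℕ.≡ᵇ a) ∨ mem s L

  ≡ᵇ-cases : ∀ s a → (s ≡ a × (s ℕ.≡ᵇ a) ≡ true) ⊎ (s ≢ a × (s ℕ.≡ᵇ a) ≡ false)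
  ≡ᵇ-cases zero zero = inj₁ (refl , refl)
  ≡ᵇ-cases zero (suc a) = inj₂ ((λ ()) , refl)
  ≡ᵇ-cases (suc s) zero = inj₂ ((λ ()) , refl)
  ≡ᵇ-cases (suc s) (suc a) with ≡ᵇ-cases s a
  ... | inj₁ (e , b) = inj₁ (cong suc e , b)
  ... | inj₂ (ne , b) = inj₂ ((λ e → ne (ℕₚ.suc-injective e)) , b)

  ∉⇒mem : ∀ {s L} → All (s ≢_) L → mem s L ≡ false
  ∉⇒mem [] = refl
  ∉⇒mem {s} {a ∷ L} (p ∷ ps) with ≡ᵇ-cases s a
  ... | inj₁ (e , _) = ⊥-elim (p e)
  ... | inj₂ (_ , b) rewrite b = ∉⇒mem ps

  Σ₁-delta : ∀ k a (g : ℕ → ℤ) → 0 ℕ.< a → a ℕ.≤ k → Σ₁ k (λ s → if s ℕ.≡ᵇ a then g s else + 0) ≡ g a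
  Σ₁-delta zero zero g () q
  Σ₁-delta (suc k) a g p q with ≡ᵇ-cases (suc k) a
  ... | inj₁ (refl , b) rewrite b = trans (cong (_+_ (g (suc k))) (trans (Σ₁-cong k vanish) (Σ₁-0 k))) (+-identityʳ _)
    where
    vanish : ∀ s → 0 ℕ.< s → s ℕ.≤ k → (if s ℕ.≡ᵇ suc k then g s else + 0) ≡ + 0
    vanish s _ s≤k with ≡ᵇ-cases s (suc k)
    ... | inj₁ (refl , _) = ⊥-elim (ℕₚ.<-irrefl refl s≤k)
    ... | inj₂ (_ , b) rewrite b = refl
  ... | inj₂ (ne , b) rewrite b = trans (+-identityˡ _) (Σ₁-delta k a g p (ℕₚ.≤-pred (ℕₚ.≤∧≢⇒< q (λ e → ne (sym e)))))

  Σ₁-mem : ∀ k L Z i → Unique L → All (λ s → 0 ℕ.< s × s ℕ.< suc k) L →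
    Σ₁ k (λ s → if mem s L then c (+ s) Z i else + 0) ≡ Λ L Z i
  Σ₁-mem k [] Z i u b = Σ₁-0 k
  Σ₁-mem k (a ∷ L) Z i (a∉L ∷ u) ((0<a , s≤s a≤k) ∷ b) = trans (Σ₁-cong k λ s _ _ → split s) (trans
      (Σ₁-+ k (λ s → if s ℕ.≡ᵇ a then g s else + 0) (λ s → if mem s L then g s else + 0))
      (cong₂ _+_ (Σ₁-delta k a g 0<a a≤k) (Σ₁-mem k L Z i u b)))
    where
    g : ℕ → ℤ
    g s = c (+ s) Z i
    split : ∀ s → (if (s ℕ.≡ᵇ a) ∨ mem s L then g s else + 0) ≡ (if s ℕ.≡ᵇ a then g s else + 0) + (if mem s L then g s else + 0)
    split s with ≡ᵇ-cases s a
    ... | inj₁ (refl , b) rewrite b | ∉⇒mem a∉L = sym (+-identityʳ (g s))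
    ... | inj₂ (_ , b) rewrite b = sym (+-identityˡ _)

  square≡1⇒≢0 : ∀ {a} → a * a ≡ + 1 → a ≢ + 0
  square≡1⇒≢0 () refl

  module Realisation (k d : ℕ) (design : Design (suc k) d) where
    open Design design
    h n : ℕ
    h = suc k
    n = h ℕ.+ h

    χ : ℤ → Bool
    χ t = mem (t %ℕ n) L ∨ mem ((- t) %ℕ n) L

    χ-cong : ∀ s t → + n ∣ s - t → χ s ≡ χ t
    χ-cong s t d = cong₂ (λ x y → mem x L ∨ mem y L) (residue-unique n s t d)
        (residue-unique n (- s) (- t) (∣-resp (eq s t) (∣m⇒∣-m d)))
      where
      eq : ∀ s t → - (s - t) ≡ - s - - t
      eq = solve-∀

    large∉L : ∀ {s} → h ℕ.≤ s → mem s L ≡ false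
    large∉L h≤s = ∉⇒mem (All.map (λ (_ , a<h) → ≢-sym (ℕₚ.<⇒≢ (ℕₚ.<-≤-trans a<h h≤s))) bounded)

    -residue : ∀ {s} → 0 ℕ.< s → s ℕ.≤ h → (- + s) %ℕ n ≡ n ℕ.∸ s
    -residue {s} 0<s s≤h = trans (residue-unique n (- + s) (+ (n ℕ.∸ s)) (divides (- + 1)
        (trans (cong (λ x → - + s - x) (trans (sym (⊖-≥ s≤n)) (sym (m-n≡m⊖n n s)))) (eq (+ s) (+ n)))))
        (residue-small (ℕₚ.∸-monoʳ-< 0<s s≤n))
      where
      s≤n : s ℕ.≤ n
      s≤n = ℕₚ.≤-trans s≤h (ℕₚ.m≤m+n h h)
      eq : ∀ s n → - s - (n - s) ≡ - + 1 * n
      eq = solve-∀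

    h≤n∸ : ∀ {s} → s ℕ.≤ h → h ℕ.≤ n ℕ.∸ s
    h≤n∸ {s} s≤h = ℕₚ.≤-trans (ℕₚ.≤-reflexive (sym (ℕₚ.m+n∸n≡m h h))) (ℕₚ.∸-monoʳ-≤ n s≤h)

    -- The residue of -s is n - s ≥ h, beyond all elements of `L`. The range includes s = h, whose
    -- absence must be known as well.
    χ-small : ∀ s → 0 ℕ.< s → s ℕ.≤ h → χ (+ s) ≡ mem s L
    χ-small s 0<s s≤h = trans (cong₂ (λ x y → mem x L ∨ mem y L) (residue-small (ℕₚ.≤-<-trans s≤h (ℕₚ.m<m+n h (s≤s z≤n)))) (-residue 0<s s≤h))
      (trans (cong (mem s L ∨_) (large∉L (h≤n∸ s≤h))) (∨-identityʳ _))

    χ-neg : ∀ t → χ (- t) ≡ χ t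
    χ-neg t = trans (cong (λ x → mem ((- t) %ℕ n) L ∨ mem (x %ℕ n) L) (neg-involutive t)) (∨-comm (mem ((- t) %ℕ n) L) _)

    χ-0 : χ (+ 0) ≡ false
    χ-0 = trans (cong₂ (λ x y → mem x L ∨ mem y L) r r) (cong₂ _∨_ 0∉L 0∉L)
      where
      r : (+ 0) %ℕ n ≡ 0
      r = residue-small {n} (s≤s z≤n)
      0∉L : mem 0 L ≡ false
      0∉L = ∉⇒mem (All.map (λ (0<a , _) → ℕₚ.<⇒≢ 0<a) bounded)

    graph : Graph n
    graph = record
      { adj = λ i j → χ (+ toℕ j - + toℕ i)
      ; adj-sym = λ i j → trans (cong χ (eq (+ toℕ i) (+ toℕ j))) (χ-neg (+ toℕ i - + toℕ j))
      ; adj-irr = λ i → trans (cong χ (+-inverseʳ (+ toℕ i))) χ-0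
      }
      where
      eq : ∀ i j → j - i ≡ - (i - j)
      eq = solve-∀

    circulant : Circulant graph
    circulant i j k l d = χ-cong (diff i j) (diff k l) (∣ᵤ⇒∣ d)

    conn : Connection graph χ
    conn = record { adj≡ = λ _ _ → refl ; χ-per = λ t → χ-cong (t + + n) t (divides (+ 1) (eq t (+ n))) ; χ-neg = χ-neg ; χ-0 = χ-0 }
      where
      eq : ∀ t n → t + n - t ≡ + 1 * n
      eq = solve-∀

    Conv≡Λ : ∀ {Z} → Per (+ n) Z → ∀ i → Conv n χ Z i ≡ Λ L Z i
    Conv≡Λ {Z} f i = trans (Conv-half (Connection.χ-per conn) χ-neg χ-0 f i) (trans
      (cong₂ _+_ (cong (λ b → if b then Z (i + + h) else + 0) (trans (χ-small h (s≤s z≤n) ℕₚ.≤-refl) (large∉L ℕₚ.≤-refl)))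
        (trans (Σ₁-cong k λ s p q → cong (λ b → if b then c (+ s) Z i else + 0) (χ-small s p (ℕₚ.m≤n⇒m≤1+n q))) (Σ₁-mem k L Z i unique bounded)))
      (+-identityˡ _))

    regular : Regular (2 ℕ.* d) graph
    regular i = +-injective (trans (degree≡Conv conn i) (trans (Conv≡Λ {λ _ → + 1} (mk λ _ → refl) (+ toℕ i))
      (trans (Λ-const L (mk λ _ → refl) (+ toℕ i)) (trans (*-identityʳ _) (cong (λ l → + (2 ℕ.* l)) size)))))

    Anti-1⇒Per-n : ∀ {Z} → Anti (+ 1) Z → Per (+ n) Z
    Anti-1⇒Per-n f = Per-≡ (eq (+ h)) (Per-* (+ h) (Anti⇒Per f))
      where
      eq : ∀ h → h * (+ 1 + + 1) ≡ h + h
      eq = solve-∀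

    alt : Seq
    alt = wave 1

    alternating-product : ∀ {w v} → Anti (+ 1) w → Anti (+ 1) v → ∀ i → w i * v i ≡ w (+ 0) * v (+ 0)
    alternating-product {w} {v} f g i = trans (cong (λ j → w j * v j) (eq i)) (per (Per-* {w = λ t → w t * v t} i
        (mk λ j → trans (cong₂ _*_ (anti f j) (anti g j)) (eq₂ (w j) (v j)))) (+ 0))
      where
      eq : ∀ i → i ≡ + 0 + i * + 1
      eq = solve-∀
      eq₂ : ∀ a b → - a * - b ≡ a * b
      eq₂ = solve-∀

    alt²≡1 : ∀ i → alt i * alt i ≡ + 1
    alt²≡1 i = trans (alternating-product (wave-Anti 1) (wave-Anti 1) i) refl

    alternating : ∀ {z} → Anti (+ 1) z → ∀ i → z i ≡ alt i * z (+ 0)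
    alternating {z} f i = trans (sym (*-identityˡ (z i))) (trans (cong (_* z i) (sym (alt²≡1 i)))
      (trans (*-assoc (alt i) (alt i) (z i)) (cong (alt i *_) (trans (alternating-product (wave-Anti 1) f i) (*-identityˡ _)))))

    x : Fin n → ℚ
    x j = ι (alt (+ toℕ j))

    x≢0 : ∀ j → x j ≢ 0ℚ
    x≢0 j e = square≡1⇒≢0 (alt²≡1 (+ toℕ j)) (ι-injective {alt (+ toℕ j)} {+ 0} e)

    spans : ∀ y → InKernel graph y → ∃ λ q → ∀ j → y j ≡ q ℚ.* x j
    -- `alt` is 1 at 0, so the coefficient is the entry of `y` at 0.
    spans y ker = y fzero , λ j → trans (ℚ-cancelˡ ιD≢0 (begin
        ι D ℚ.* y j                          ≡⟨ Dx≡z j ⟩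
        ι (z j)                              ≡⟨ cong (λ j → ι (z j)) (sym (idx-toℕ j)) ⟩
        ι (extend z (+ toℕ j))               ≡⟨ cong ι (alternating anti-z (+ toℕ j)) ⟩
        ι (alt (+ toℕ j) * extend z (+ 0))   ≡⟨ ι-* (alt (+ toℕ j)) (extend z (+ 0)) ⟩
        x j ℚ.* ι (extend z (+ 0))           ≡⟨ cong (λ i → x j ℚ.* ι (z i)) (idx-toℕ fzero) ⟩
        x j ℚ.* ι (z fzero)                  ≡⟨ cong (x j ℚ.*_) (sym (Dx≡z fzero)) ⟩
        x j ℚ.* (ι D ℚ.* y fzero)            ≡⟨ sym (ℚₚ.*-assoc (x j) (ι D) (y fzero)) ⟩
        x j ℚ.* ι D ℚ.* y fzero              ≡⟨ cong (ℚ._* y fzero) (ℚₚ.*-comm (x j) (ι D)) ⟩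
        ι D ℚ.* x j ℚ.* y fzero              ≡⟨ ℚₚ.*-assoc (ι D) (x j) (y fzero) ⟩
        ι D ℚ.* (x j ℚ.* y fzero)            ∎)) (ℚₚ.*-comm (x j) (y fzero))
      where
      open ≡-Reasoning
      I = integral y
      open Integral I
      ιD≢0 : ι D ≢ 0ℚ
      ιD≢0 e = D≢0 (ι-injective {D} {+ 0} e)
      ker-z : Ker L (extend z)
      ker-z = mk λ i → trans (sym (Conv≡Λ (Per-extend z) i)) (kernel⇒Conv conn I ker i)
      anti-z : Anti (+ 1) (extend z)
      anti-z = mk λ i → i+j≡0⇒i≡-j (alternates (Per-extend z) ker-z i)


    realised : InN (2 ℕ.* d) n
    realised = s≤s z≤n , graph , circulant , regular , ℕₚ.+-mono-≤ {1} {h} {1} {h} (s≤s z≤n) (s≤s z≤n) ,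
      x , (Conv⇒kernel conn per-alt (λ i → trans (Conv≡Λ per-alt i) (Λ≡0 (balanced (wave-Anti 1)) i)) , (fzero , x≢0 fzero) , spans) , x≢0
      where
      per-alt : Per (+ n) alt
      per-alt = Anti-1⇒Per-n (wave-Anti 1)

  -- Nullity one

  1≢0 : + 1 ≢ + 0
  1≢0 ()

  Fold-⊡ : ∀ σ p k x w i → Fold σ p k (x ⊡ w) i ≡ x * Fold σ p k w i
  Fold-⊡ σ p zero x w i = sym (*-zeroʳ x)
  Fold-⊡ σ p (suc k) x w i = trans (cong (λ y → x * w i + σ * y) (Fold-⊡ σ p k x w (i + p))) (eq x (w i) σ (Fold σ p k w (i + p)))
    where
    eq : ∀ x a s b → x * a + s * (x * b) ≡ x * (a + s * b)
    eq = solve-∀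

  Sum-zero : ∀ n {F} → (∀ i → F i ≡ + 0) → ∀ i → Sum n F i ≡ + 0
  Sum-zero zero z i = refl
  Sum-zero (suc n) z i = cong₂ (λ x y → x + + 1 * y) (z i) (Sum-zero n z (i + + 1))

  Sum-reverse : ∀ n F i → Sum n (λ t → F (- t)) i ≡ Sum n F (- i - + n + + 1)
  Sum-reverse zero F i = refl
  Sum-reverse (suc n) F i = trans (cong (λ x → F (- i) + + 1 * x) (trans (Sum-reverse n F (i + + 1)) (cong (Sum n F) (i₁ i (+ n)))))
      (trans (eq (F (- i)) (Sum n F j)) (trans (cong (λ x → Sum n F j + F x) (sym (i₂ i (+ n)))) (sym (Sum-last n F j))))
    where
    j = - i - + suc n + + 1
    i₁ : ∀ i n → - (i + + 1) - n + + 1 ≡ - i - (+ 1 + n) + + 1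
    i₁ = solve-∀
    i₂ : ∀ i n → - i - (+ 1 + n) + + 1 + n ≡ - i
    i₂ = solve-∀
    eq : ∀ a b → a + + 1 * b ≡ b + a
    eq = solve-∀

  Anti⇒Sum≡0 : ∀ {n p W} → Per (+ n) W → Anti p W → ∀ i → Sum n W i ≡ + 0
  Anti⇒Sum≡0 {n} {p} {W} f g = Per×Anti⇒0 (mk λ i → trans (Sum-window f (i + p)) (sym (Sum-window f i))) (Anti-Fold (+ 1) (+ 1) n g)

  Conv-shift : ∀ n χ m Z i → Conv n χ (shift m Z) i ≡ Conv n χ Z (i + m)
  Conv-shift n χ m Z i = Fold-cong (+ 1) (+ 1) n (λ t → cong (λ j → if χ t then Z j else + 0) (eq i t m)) (+ 0)
    where
    eq : ∀ i t m → i + t + m ≡ i + m + t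
    eq = solve-∀

  Conv-reflect : ∀ {n χ Z} → (∀ t → χ (t + + n) ≡ χ t) → (∀ t → χ (- t) ≡ χ t) → Per (+ n) Z → ∀ i →
    Conv n χ (λ t → Z (- t)) i ≡ Conv n χ Z (- i)
  Conv-reflect {n} {χ} {Z} χ-per χ-neg f i = trans (Fold-cong (+ 1) (+ 1) n (λ t → cong₂ (λ b j → if b then Z j else + 0) (sym (χ-neg t)) (neg-distrib-+ i t)) (+ 0))
    (trans (Sum-reverse n (λ t → if χ t then Z (- i + t) else + 0) (+ 0)) (Sum-window (Conv-neighbour-Per χ χ-per f (- i)) _))

  squares-equal : ∀ {a b} → a * a ≡ b * b → a ≡ b ⊎ a ≡ - b
  squares-equal {a} {b} e with i*j≡0⇒i≡0∨j≡0 (a - b) (trans (eq a b) (trans (cong (_- b * b) e) (+-inverseʳ (b * b))))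
    where
    eq : ∀ a b → (a - b) * (a + b) ≡ a * a - b * b
    eq = solve-∀
  ... | inj₁ e₁ = inj₁ (i-j≡0⇒i≡j a b e₁)
  ... | inj₂ e₂ = inj₂ (trans (eq a b) (trans (cong (_- b) e₂) (+-identityˡ (- b))))
    where
    eq : ∀ a b → a ≡ a + b - b
    eq = solve-∀

  module Nullity-one {n′ : ℕ} {G : Graph (suc n′)} (circ : Circulant G) (2≤n : 2 ℕ.≤ suc n′) {x : Fin (suc n′) → ℚ}
    (spans : SpansKernel G x) (x≢0 : ∀ i → x i ≢ 0ℚ) where

    n : ℕ
    n = suc n′

    χ : ℤ → Bool
    χ = jump G circ

    conn : Connection G χ
    conn = connection G circ

    open Connection conn

    private
      I = integral x
    open Integral I

    X : Seq
    X = extend z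

    Per-X : Per (+ n) X
    Per-X = Per-extend z

    Conv-X : ∀ i → Conv n χ X i ≡ + 0
    Conv-X = kernel⇒Conv conn I (proj₁ spans)

    X≢0 : ∀ i → X i ≢ + 0
    X≢0 i e = x≢0 (idx i) (ℚ-cancelˡ {ι D} (λ e → D≢0 (ι-injective {D} {+ 0} e)) (trans (Dx≡z (idx i)) (trans (cong ι e) (sym (ℚₚ.*-zeroʳ (ι D))))))

    cancel-X : ∀ i {a b} → X i * a ≡ X i * b → a ≡ b
    cancel-X i {a} {b} = *-cancelˡ-≡ (X i) a b {{≢-nonZero (X≢0 i)}}

    -- D Z(i) X(j) equals q X(i) X(j), which is symmetric in i and j. The cross-multiplied form
    -- stays within ℤ.
    proportional : ∀ {Z} → Per (+ n) Z → (∀ i → Conv n χ Z i ≡ + 0) → ∀ i j → Z i * X j ≡ Z j * X i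
    proportional {Z} f k i j = subst₂ (λ a b → a * X j ≡ b * X i) (at i) (at j) (*-cancelˡ-≡ D _ _ {{≢-nonZero D≢0}} (ι-injective
        (trans (lhs (idx i) (idx j)) (trans swap (sym (lhs (idx j) (idx i)))))))
      where
      at : ∀ t → Z (+ toℕ (idx t)) ≡ Z t
      at t = sym (trans (cong Z (trans (a≡a%ℕn+[a/ℕn]*n t n) (cong (λ r → + r + t /ℕ n * + n) (sym (toℕ-idx t))))) (per (Per-* (t /ℕ n) f) (+ toℕ (idx t))))
      q : ℚ
      q = proj₁ (proj₂ (proj₂ spans) (λ j → ι (Z (+ toℕ j))) (Conv⇒kernel conn f k))
      Z≡qx : ∀ j → ι (Z (+ toℕ j)) ≡ q ℚ.* x j
      Z≡qx = proj₂ (proj₂ (proj₂ spans) (λ j → ι (Z (+ toℕ j))) (Conv⇒kernel conn f k))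
      lhs : ∀ a b → ι (D * (Z (+ toℕ a) * z b)) ≡ q ℚ.* (ι (z a) ℚ.* ι (z b))
      lhs a b = trans (cong ι (sym (*-assoc D (Z (+ toℕ a)) (z b)))) (trans (ι-* (D * Z (+ toℕ a)) (z b)) (trans (cong (ℚ._* ι (z b))
          (trans (ι-* D (Z (+ toℕ a))) (trans (cong (ι D ℚ.*_) (Z≡qx a)) (trans (sym (ℚₚ.*-assoc (ι D) q (x a)))
            (trans (cong (ℚ._* x a) (ℚₚ.*-comm (ι D) q)) (trans (ℚₚ.*-assoc q (ι D) (x a)) (cong (q ℚ.*_) (Dx≡z a))))))))
          (ℚₚ.*-assoc q (ι (z a)) (ι (z b)))))
      swap : q ℚ.* (ι (z (idx i)) ℚ.* ι (z (idx j))) ≡ q ℚ.* (ι (z (idx j)) ℚ.* ι (z (idx i)))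
      swap = cong (q ℚ.*_) (ℚₚ.*-comm (ι (z (idx i))) (ι (z (idx j))))

    vanishes : ∀ {Z} → Per (+ n) Z → (∀ i → Conv n χ Z i ≡ + 0) → Z (+ 1) ≡ + 0 → Z (+ 0) ≡ + 0
    vanishes {Z} f k e = cancel-X (+ 1) (trans (*-comm (X (+ 1)) (Z (+ 0))) (trans (proportional f k (+ 0) (+ 1))
      (trans (cong (_* X (+ 0)) e) (sym (*-zeroʳ (X (+ 1)))))))

    no-wave : ∀ p → Per (+ n) (wave (suc (suc p))) → ¬ (∀ i → Conv n χ (wave (suc (suc p))) i ≡ + 0)
    no-wave p f k = 1≢0 (trans (sym (wave-at-0 (suc p))) (vanishes {wave (suc (suc p))} f k (wave-at-1 p)))

    -- The reflected vector agrees with X at 0, where X is nonzero, so the factor of proportionality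
    -- is 1.
    even-X : ∀ i → X (- i) ≡ X i
    even-X i = cancel-X (+ 0) (trans (*-comm (X (+ 0)) (X (- i))) (proportional {λ t → X (- t)} per-R
        (λ i → trans (Conv-reflect χ-per χ-neg Per-X i) (Conv-X (- i))) i (+ 0)))
      where
      per-R : Per (+ n) (λ t → X (- t))
      per-R = mk λ t → trans (sym (per Per-X (- (t + + n)))) (cong X (eq t (+ n)))
        where
        eq : ∀ t n → - (t + n) + n ≡ - t
        eq = solve-∀

    ratio : ∀ i j → X (i + + 1) * X j ≡ X (j + + 1) * X i
    ratio = proportional {shift (+ 1) X} (Per-shift (+ 1) Per-X) λ i → trans (Conv-shift n χ (+ 1) X i) (Conv-X (i + + 1))

    -- `ratio` at 0 and -1 reads X(1) X(-1) = X(0)², and X is even.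
    X1≡±X0 : X (+ 1) ≡ X (+ 0) ⊎ X (+ 1) ≡ - X (+ 0)
    X1≡±X0 = squares-equal (trans (cong (X (+ 1) *_) (sym (even-X (+ 1)))) (ratio (+ 0) (- + 1)))

    module _ {d : ℕ} (reg : Regular d G) where

      Conv-1 : Conv n χ (λ _ → + 1) (+ 0) ≡ + d
      Conv-1 = trans (sym (degree≡Conv conn fzero)) (cong +_ (reg fzero))

      -- For d = 0 the matrix is zero, and its kernel contains the indicator of 0, which vanishes at
      -- 1.
      d≢0 : d ≢ 0
      d≢0 refl = 1≢0 (trans (sym (δ-at 0 (ℕₚ.≤-trans (s≤s z≤n) 2≤n))) (vanishes {δ n} (Per-δ n) (λ i → Sum-zero n (λ t → cong (λ b → if b then δ n (i + t) else + 0) (χ≡false t)) (+ 0)) (δ-at 1 2≤n)))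
        where
        δ-at : ∀ k → k ℕ.< n → δ n (+ k) ≡ (if k ℕ.≡ᵇ 0 then + 1 else + 0)
        δ-at k p = cong (λ r → if r ℕ.≡ᵇ 0 then + 1 else + 0) (residue-small {n} p)
        all-false : ∀ m (b : Fin m → Bool) → ∑ℕ m (λ j → if b j then 1 else 0) ≡ 0 → ∀ j → b j ≡ false
        all-false (suc m) b e fzero with b fzero
        ... | false = refl
        all-false (suc m) b e (fsuc j) = all-false m (λ j → b (fsuc j)) (ℕₚ.m+n≡0⇒n≡0 (if b fzero then 1 else 0) e) j
        χ≡false : ∀ t → χ t ≡ false
        χ≡false t = all-false n (adj G (idx (+ 0))) (reg (idx (+ 0))) (idx t)

      anti-X : Anti (+ 1) X
      anti-X = case X1≡±X0
        where
        case : X (+ 1) ≡ X (+ 0) ⊎ X (+ 1) ≡ - X (+ 0) → Anti (+ 1) X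
        case (inj₂ e) = mk λ i → cancel-X (+ 0) (trans (*-comm (X (+ 0)) (X (i + + 1))) (trans (ratio i (+ 0))
            (trans (cong (_* X i) e) (eq (X (+ 0)) (X i)))))
          where
          eq : ∀ a b → - a * b ≡ a * - b
          eq = solve-∀
        -- A constant X would give d X(0) = 0.
        case (inj₁ e) = ⊥-elim (*-≢0 (X≢0 (+ 0)) (λ d≡0 → d≢0 (+-injective d≡0)) (trans (cong (X (+ 0) *_) (sym Conv-1))
            (trans (sym (Fold-⊡ (+ 1) (+ 1) n (X (+ 0)) _ (+ 0))) (trans (Fold-cong (+ 1) (+ 1) n term (+ 0)) (Conv-X (+ 0))))))
          where
          per-1 : Per (+ 1) X
          per-1 = mk λ i → cancel-X (+ 0) (trans (*-comm (X (+ 0)) (X (i + + 1))) (trans (ratio i (+ 0)) (cong (_* X i) e)))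
          const : ∀ t → X (+ 0 + t) ≡ X (+ 0)
          const t = trans (cong (λ j → X (+ 0 + j)) (sym (*-identityʳ t))) (per (Per-* t per-1) (+ 0))
          term : ∀ t → X (+ 0) * (if χ t then + 1 else + 0) ≡ (if χ t then X (+ 0 + t) else + 0)
          term t with χ t
          ... | true = trans (*-identityʳ _) (sym (const t))
          ... | false = *-zeroʳ (X (+ 0))

      even-order : IsEven n
      even-order with parity n
      ... | inj₁ e = e
      ... | inj₂ o@(t , _) = ⊥-elim (X≢0 (+ 0) (Per×Anti⇒0 Per-X (Anti-≡ (trans (eq (+ t)) (sym (+odd o))) (Anti-odd (+ t) anti-X)) (+ 0)))
        where
        eq : ∀ t → t * (+ 1 + + 1) + + 1 ≡ + 1 + + 2 * t
        eq = solve-∀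

  -- Counting the missing elements

  v : Bool → ℤ
  v b = if b then + 1 else + 0

  v* : ∀ b x → v b * x ≡ (if b then x else + 0)
  v* true x = *-identityˡ x
  v* false x = refl

  # : ℕ → (ℕ → Bool) → ℕ
  # zero p = 0
  # (suc k) p = (if p (suc k) then 1 else 0) ℕ.+ # k p

  +# : ∀ k p → + # k p ≡ Σ₁ k (λ s → v (p s))
  +# zero p = refl
  +# (suc k) p = trans (pos-+ (if p (suc k) then 1 else 0) (# k p)) (cong₂ _+_ (head (p (suc k))) (+# k p))
    where
    head : ∀ b → + (if b then 1 else 0) ≡ v b
    head true = refl
    head false = refl

  #≡0 : ∀ k p → # k p ≡ 0 → ∀ s → 0 ℕ.< s → s ℕ.≤ k → p s ≡ false
  #≡0 zero p e (suc s) _ ()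
  #≡0 (suc k) p e s 0<s s≤ with ℕₚ.m≤n⇒m<n∨m≡n s≤
  ... | inj₁ (s≤s s≤k) = #≡0 k p (ℕₚ.m+n≡0⇒n≡0 (if p (suc k) then 1 else 0) e) s 0<s s≤k
  ... | inj₂ refl = head (p (suc k)) (ℕₚ.m+n≡0⇒m≡0 (if p (suc k) then 1 else 0) e)
    where
    head : ∀ b → (if b then 1 else 0) ≡ 0 → b ≡ false
    head false _ = refl

  odd? : ℕ → Bool
  odd? zero = false
  odd? (suc s) = not (odd? s)

  odd?-spec : ∀ s → (odd? s ≡ false × IsEven s) ⊎ (odd? s ≡ true × IsOdd s)
  odd?-spec zero = inj₁ (refl , 0 , refl)
  odd?-spec (suc s) with odd?-spec s
  ... | inj₁ (b , t , e) = inj₂ (cong not b , t , cong suc e)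
  ... | inj₂ (b , t , e) = inj₁ (cong not b , suc t , trans (cong suc e) (sym (ℕₚ.*-suc 2 t)))

  sgn : Bool → ℤ
  sgn b = if b then - + 1 else + 1

  ε : ℕ → ℤ
  ε s = sgn (odd? s)

  sgn-not : ∀ b → sgn (not b) ≡ - sgn b
  sgn-not true = refl
  sgn-not false = refl

  Σ₁-ε : ∀ k → Σ₁ k ε ≡ - v (odd? k)
  Σ₁-ε zero = refl
  Σ₁-ε (suc k) = trans (cong (_+_ (ε (suc k))) (Σ₁-ε k)) (step (odd? k))
    where
    step : ∀ b → sgn (not b) + - v b ≡ - v (not b)
    step true = refl
    step false = refl

  alternating-value : ∀ {W} → Anti (+ 1) W → ∀ s → W (+ s) ≡ ε s * W (+ 0)
  alternating-value {W} f zero = sym (*-identityˡ _)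
  alternating-value {W} f (suc s) = trans (cong W (cong +_ (sym (ℕₚ.+-comm s 1)))) (trans (anti f (+ s))
    (trans (cong -_ (alternating-value f s)) (trans (neg-distribˡ-* (ε s) (W (+ 0))) (cong (_* W (+ 0)) (sym (sgn-not (odd? s)))))))

  c-alternating : ∀ {W} → Anti (+ 1) W → ∀ s i → c (+ s) W i ≡ + 2 * W i * ε s
  c-alternating {W} f s i with odd?-spec s
  ... | inj₁ (b , e@(t , _)) rewrite b = trans (c-even-multiple {+ 1} (+ t) (trans (+even e) (*-comm (+ 2) (+ t))) f i) (sym (*-identityʳ (+ 2 * W i)))
  ... | inj₂ (b , o@(t , _)) rewrite b = trans (c-odd-multiple {+ 1} (+ t) (trans (+odd o) (eq (+ t))) f i) (eq₂ (W i))
    where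
    eq : ∀ t → + 1 + + 2 * t ≡ t * (+ 1 + + 1) + + 1
    eq = solve-∀
    eq₂ : ∀ w → - + 2 * w ≡ + 2 * w * - + 1
    eq₂ = solve-∀

  true≢false : true ≢ false
  true≢false ()

  module Even-order-nut (k : ℕ) {G : Graph (suc k ℕ.+ suc k)} (circ : Circulant G) {x : Fin (suc k ℕ.+ suc k) → ℚ}
    (spans : SpansKernel G x) (x≢0 : ∀ i → x i ≢ 0ℚ) {d : ℕ} (reg : Regular d G) where

    h n : ℕ
    h = suc k
    n = h ℕ.+ h

    private
      2≤n : 2 ℕ.≤ n
      2≤n = ℕₚ.+-mono-≤ {1} {h} {1} {h} (s≤s z≤n) (s≤s z≤n)
      module N = Nullity-one {k ℕ.+ h} {G} circ 2≤n {x} spans x≢0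

    open N using (χ; conn; X; X≢0; Per-X; Conv-X; no-wave) public

    p : ℕ → Bool
    p s = χ (+ s)

    open Connection conn

    Conv-p : ∀ {Z} → Per (+ n) Z → ∀ i → Conv n χ Z i ≡ v (p h) * Z (i + + h) + Σ₁ k (λ s → v (p s) * c (+ s) Z i)
    Conv-p {Z} f i = trans (Conv-half χ-per χ-neg χ-0 f i)
      (cong₂ _+_ (sym (v* (p h) (Z (i + + h)))) (Σ₁-cong k λ s _ _ → sym (v* (p s) (c (+ s) Z i))))

    private
      bal : ℤ
      bal = Σ₁ k (λ s → v (p s) * ε s)

      balance-eq : v (p h) * ε h + + 2 * bal ≡ + 0
      balance-eq = *-cancelˡ-≡ (X (+ 0)) _ _ {{≢-nonZero (X≢0 (+ 0))}} (trans (eq (X (+ 0)) (v (p h)) (ε h) bal) (trans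
          (cong₂ (λ a b → v (p h) * a + b) (sym (alternating-value (N.anti-X reg) h))
            (trans (sym (Σ₁-* k (+ 2 * X (+ 0)) (λ s → v (p s) * ε s))) (Σ₁-cong k λ s _ _ → trans (eq₂ (+ 2 * X (+ 0)) (v (p s)) (ε s))
              (cong (v (p s) *_) (sym (c-alternating (N.anti-X reg) s (+ 0)))))))
          (trans (sym (Conv-p Per-X (+ 0))) (trans (Conv-X (+ 0)) (sym (*-zeroʳ (X (+ 0))))))))
        where
        eq : ∀ x v e a → x * (v * e + + 2 * a) ≡ v * (e * x) + + 2 * x * a
        eq = solve-∀
        eq₂ : ∀ x v e → x * (v * e) ≡ v * (x * e)
        eq₂ = solve-∀

      -- `v b` is 0 or 1 and `sgn c` is a unit, so the equation makes `v b` even.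
      unit-sum≢0 : ∀ b c a → v b * sgn c + + 2 * a ≡ + 0 → b ≡ false
      unit-sum≢0 false c a e = refl
      unit-sum≢0 true true a e = ⊥-elim (2∤1 (divides a (trans (eq a) (trans (cong (λ x → - x + a * + 2) e) (+-identityˡ _)))))
        where
        eq : ∀ a → + 1 ≡ - (+ 1 * - + 1 + + 2 * a) + a * + 2
        eq = solve-∀
      unit-sum≢0 true false a e = ⊥-elim (2∤1 (divides (- a) (trans (eq a) (trans (cong (_+ - a * + 2) e) (+-identityˡ _)))))
        where
        eq : ∀ a → + 1 ≡ + 1 * + 1 + + 2 * a + - a * + 2
        eq = solve-∀

    p-h : p h ≡ false
    p-h = unit-sum≢0 (p h) (odd? h) bal balance-eq

    balanced : Σ₁ k (λ s → v (p s) * ε s) ≡ + 0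
    balanced = 2*x≡0⇒x≡0 (trans (sym (+-identityˡ _)) (trans (cong (λ b → v b * ε h + + 2 * bal) (sym p-h)) balance-eq))

    P O Q Qe : ℕ
    P = # k p
    O = # k (λ s → p s ∧ odd? s)
    Q = # k (λ s → not (p s))
    Qe = # k (λ s → not (p s) ∧ not (odd? s))

    d≡2P : d ≡ 2 ℕ.* P
    d≡2P = +-injective (trans (sym (N.Conv-1 reg)) (trans (Conv-p {λ _ → + 1} (mk λ _ → refl) (+ 0)) (trans
      (cong (λ b → v b * + 1 + Σ₁ k (λ s → v (p s) * + 2)) p-h) (trans (+-identityˡ _) (trans
      (trans (Σ₁-cong k λ s _ _ → *-comm (v (p s)) (+ 2)) (Σ₁-* k (+ 2) (λ s → v (p s)))) (trans (cong (+ 2 *_) (sym (+# k p))) (sym (pos-* 2 P))))))))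

    -- Counting without signs exceeds counting with signs by 2 for each odd element, and the signed
    -- count is zero.
    P≡2O : P ≡ 2 ℕ.* O
    P≡2O = +-injective (trans (+# k p) (trans (Σ₁-cong k λ s _ _ → split (p s) (odd? s)) (trans
        (Σ₁-+ k (λ s → v (p s) * ε s) (λ s → + 2 * v (p s ∧ odd? s))) (trans (cong₂ _+_ balanced
          (trans (Σ₁-* k (+ 2) (λ s → v (p s ∧ odd? s))) (trans (cong (+ 2 *_) (sym (+# k _))) (sym (pos-* 2 O))))) (+-identityˡ _)))))
      where
      split : ∀ a b → v a ≡ v a * sgn b + + 2 * v (a ∧ b)
      split true true = refl
      split true false = refl
      split false b = refl

    d≡4O : d ≡ 4 ℕ.* O
    d≡4O = trans d≡2P (trans (cong (2 ℕ.*_) P≡2O) (sym (ℕₚ.*-assoc 2 2 O)))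

    P+Q≡k : P ℕ.+ Q ≡ k
    P+Q≡k = count k p
      where
      count : ∀ k p → # k p ℕ.+ # k (λ s → not (p s)) ≡ k
      count zero p = refl
      count (suc k) p with p (suc k)
      ... | true = cong suc (count k p)
      ... | false = trans (ℕₚ.+-suc (# k p) _) (cong suc (count k p))

    -- The signs over 1, ..., k sum to -1 or 0 as k is odd or even, and those of the present
    -- elements to 0. So among the missing elements the odd ones outnumber the even ones by 1 or 0.
    Q-parity : + Q - v (odd? k) ≡ + 2 * + Qe
    Q-parity = trans (cong (_+_ (+ Q)) (trans (sym (Σ₁-ε k)) (trans (Σ₁-cong k λ s _ _ → split (p s) (ε s))
        (trans (Σ₁-+ k (λ s → v (p s) * ε s) (λ s → v (not (p s)) * ε s)) (trans (cong (_+ M) balanced) (+-identityˡ M))))))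
        (trans (cong (_+ M) (+# k (λ s → not (p s)))) (trans (sym (Σ₁-+ k (λ s → v (not (p s))) (λ s → v (not (p s)) * ε s)))
          (trans (Σ₁-cong k λ s _ _ → double (not (p s)) (odd? s)) (trans (Σ₁-* k (+ 2) (λ s → v (not (p s) ∧ not (odd? s))))
            (cong (+ 2 *_) (sym (+# k (λ s → not (p s) ∧ not (odd? s)))))))))
      where
      M : ℤ
      M = Σ₁ k (λ s → v (not (p s)) * ε s)
      split : ∀ a e → e ≡ v a * e + v (not a) * e
      split true e = eq e
        where
        eq : ∀ e → e ≡ + 1 * e + + 0 * e
        eq = solve-∀
      split false e = eq e
        where
        eq : ∀ e → e ≡ + 0 * e + + 1 * e
        eq = solve-∀
      double : ∀ a b → v a + v a * sgn b ≡ + 2 * v (a ∧ not b)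
      double true true = refl
      double true false = refl
      double false b = refl

    n≡d+2+2Q : n ≡ d ℕ.+ 2 ℕ.+ 2 ℕ.* Q
    n≡d+2+2Q = trans (cong (λ k → suc k ℕ.+ suc k) (sym P+Q≡k)) (trans (eq P Q) (cong (λ m → m ℕ.+ 2 ℕ.+ 2 ℕ.* Q) (sym d≡2P)))
      where
      eq : ∀ P Q → suc (P ℕ.+ Q) ℕ.+ suc (P ℕ.+ Q) ≡ 2 ℕ.* P ℕ.+ 2 ℕ.+ 2 ℕ.* Q
      eq = ℕ-Solver.solve-∀

    -- The full connection set kills antiperiodic sequences, so only the missing elements matter.
    Conv-missing : ∀ {q W} → Per (+ n) W → Anti q W → Anti (+ h) W →
      (∀ s → 0 ℕ.< s → s ℕ.≤ k → p s ≡ false → ∀ i → c (+ s) W i ≡ + 0) → ∀ i → Conv n χ W i ≡ + 0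
    Conv-missing {q} {W} f g g-h missing i = trans (Conv-p f i) (cong₂ (λ b x → v b * W (i + + h) + x) p-h
        (trans (Σ₁-cong k λ s 0<s s≤k → drop s 0<s s≤k (p s) refl) (trans (sym total) Sum≡0)))
      where
      F : Seq
      F t = W (i + t)
      per-F : Per (+ n) F
      per-F = mk λ t → trans (cong W (sym (+-assoc i t (+ n)))) (per f (i + t))
      anti-F : Anti q F
      anti-F = mk λ t → trans (cong W (sym (+-assoc i t q))) (anti g (i + t))
      Sum≡0 : Sum n F (+ 0) ≡ + 0
      Sum≡0 = Anti⇒Sum≡0 per-F anti-F (+ 0)
      total : Sum n F (+ 0) ≡ Σ₁ k (λ s → c (+ s) W i)
      total = trans (Sum-halves k F per-F) (trans (cong (_+ Σ₁ k (λ s → c (+ s) W i))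
        (trans (cong₂ _+_ (cong W (+-identityʳ i)) (anti g-h i)) (+-inverseʳ (W i)))) (+-identityˡ _))
      drop : ∀ s → 0 ℕ.< s → s ℕ.≤ k → ∀ b → p s ≡ b → v b * c (+ s) W i ≡ c (+ s) W i
      drop s 0<s s≤k true e = *-identityˡ _
      drop s 0<s s≤k false e = sym (missing s 0<s s≤k e i)

    -- If only 0 and h are missing, all h-antiperiodic sequences are in the kernel. Since h = 1
    -- would mean d = 0, `wave h` vanishes at 1.
    Q≢0 : Q ≢ 0
    Q≢0 Q≡0 = full k refl
      where
      not-false : ∀ {b} → not b ≡ false → b ≢ false
      not-false () refl
      per-W : Per (+ n) (wave h)
      per-W = Anti⇒Per (wave-Anti h)
      conv : ∀ i → Conv n χ (wave h) i ≡ + 0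
      conv = Conv-missing per-W (wave-Anti h) (wave-Anti h)
        λ s 0<s s≤k ps → ⊥-elim (not-false (#≡0 k (λ s → not (p s)) Q≡0 s 0<s s≤k) ps)
      full : ∀ j → k ≡ j → ⊥
      full zero k≡0 = N.d≢0 reg (trans d≡2P (cong (λ j → 2 ℕ.* # j p) k≡0))
      full (suc j) e = no-wave j (subst (λ m → Per (+ n) (wave (suc m))) e per-W)
        (subst (λ m → ∀ i → Conv n χ (wave (suc m)) i ≡ + 0) e conv)

    -- Here k = 4O′ + 1 is odd, so by `Q-parity` the one missing element is odd and vanishes where
    -- x² = -1. Also h is an odd multiple of 2, so x^h = -1 there.
    Q≢1 : ∀ O′ → O ≡ 2 ℕ.* O′ → Q ≢ 1
    Q≢1 O′ O≡ Q≡1 = no-wave 0 per-W (Conv-missing per-W (wave-Anti 2) anti-h missing)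
      where
      k≡ : k ≡ suc (2 ℕ.* (2 ℕ.* O′))
      k≡ = trans (sym P+Q≡k) (trans (cong₂ ℕ._+_ (trans P≡2O (cong (2 ℕ.*_) O≡)) Q≡1) (ℕₚ.+-comm _ 1))
      +h≡ : + h ≡ + O′ * (+ 2 + + 2) + + 2
      +h≡ = trans (cong (λ j → + suc j) k≡) (trans (cong (_+_ (+ 2)) (trans (pos-* 2 (2 ℕ.* O′)) (cong (+ 2 *_) (pos-* 2 O′)))) (eq (+ O′)))
        where
        eq : ∀ o → + 2 + + 2 * (+ 2 * o) ≡ o * (+ 2 + + 2) + + 2
        eq = solve-∀
      anti-h : Anti (+ h) (wave 2)
      anti-h = Anti-≡ (sym +h≡) (Anti-odd (+ O′) (wave-Anti 2))
      per-W : Per (+ n) (wave 2)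
      per-W = Anti⇒Per anti-h
      odd-k : odd? k ≡ true
      odd-k with odd?-spec k
      ... | inj₂ (b , _) = b
      ... | inj₁ (_ , t , e) = ⊥-elim (ℕₚ.even≢odd t (2 ℕ.* O′) (trans (sym e) k≡))
      Qe≡0 : Qe ≡ 0
      Qe≡0 = +-injective (2*x≡0⇒x≡0 (trans (sym Q-parity) (cong₂ (λ q b → + q - v b) Q≡1 odd-k)))
      missing : ∀ s → 0 ℕ.< s → s ℕ.≤ k → p s ≡ false → ∀ i → c (+ s) (wave 2) i ≡ + 0
      missing s 0<s s≤k ps = c-odd≡0 (wave-Anti 2) (is-odd (odd?-spec s))
        where
        none : not (p s) ∧ not (odd? s) ≡ false
        none = #≡0 k (λ s → not (p s) ∧ not (odd? s)) Qe≡0 s 0<s s≤k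
        is-odd : (odd? s ≡ false × IsEven s) ⊎ (odd? s ≡ true × IsOdd s) → IsOdd s
        is-odd (inj₂ (_ , o)) = o
        is-odd (inj₁ (b , _)) = ⊥-elim (true≢false (trans (sym (cong₂ (λ a b → not a ∧ not b) ps b)) none))

  -- Order 16

  ∀-Bool? : ∀ {P : Bool → Set} → (∀ b → Dec (P b)) → Dec (∀ b → P b)
  ∀-Bool? d with d true | d false
  ... | yes t | yes f = yes λ { true → t ; false → f }
  ... | no ¬t | _ = no λ p → ¬t (p true)
  ... | yes _ | no ¬f = no λ p → ¬f (p false)

  -- The vanishing of the connection set {±s : bₛ} of order 16 at the primitive fourth, eighth or
  -- sixteenth roots of unity.
  Vanishing : (b₁ b₂ b₃ b₄ b₅ b₆ b₇ : Bool) → Set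
  Vanishing b₁ b₂ b₃ b₄ b₅ b₆ b₇ =
    - v b₂ + v b₄ - v b₆ ≡ + 0
    ⊎ (v b₄ ≡ + 0 × v b₁ - v b₃ - v b₅ + v b₇ ≡ + 0)
    ⊎ (v b₁ ≡ v b₇ × v b₂ ≡ v b₆ × v b₃ ≡ v b₅)

  -- Decided over all 128 subsets of {1, ..., 7}. The sums are written as `Σ₁ 7` unfolds, so the two
  -- counts apply without rewriting.
  order-16 : ∀ b₁ b₂ b₃ b₄ b₅ b₆ b₇ →
    v b₇ + (v b₆ + (v b₅ + (v b₄ + (v b₃ + (v b₂ + (v b₁ + + 0)))))) ≡ + 4 →
    v b₇ * - + 1 + (v b₆ * + 1 + (v b₅ * - + 1 + (v b₄ * + 1 + (v b₃ * - + 1 + (v b₂ * + 1 + (v b₁ * - + 1 + + 0)))))) ≡ + 0 →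
    Vanishing b₁ b₂ b₃ b₄ b₅ b₆ b₇
  order-16 = toWitness {a? = ∀-Bool? λ b₁ → ∀-Bool? λ b₂ → ∀-Bool? λ b₃ → ∀-Bool? λ b₄ → ∀-Bool? λ b₅ → ∀-Bool? λ b₆ → ∀-Bool? λ b₇ →
    (_ ≟ _) →-dec ((_ ≟ _) →-dec ((_ ≟ _) ⊎-dec ((_ ≟ _) ×-dec (_ ≟ _)) ⊎-dec ((_ ≟ _) ×-dec (_ ≟ _) ×-dec (_ ≟ _))))} _

  c-+-antiperiod : ∀ {p W} s → Anti p W → ∀ i → c (s + p) W i ≡ - c s W i
  c-+-antiperiod {p} {W} s f i = trans (cong₂ _+_ (trans (cong W (sym (+-assoc i s p))) (anti f (i + s)))
      (trans (sym (neg-involutive _)) (cong -_ (trans (sym (anti f (i - (s + p)))) (cong W (eq i s p))))))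
      (sym (neg-distrib-+ (W (i + s)) (W (i - s))))
    where
    eq : ∀ i s p → i - (s + p) + p ≡ i - s
    eq = solve-∀

  -- The unfolded form of `Σ₁ 7`, with the weights and values as variables for the ring solver.
  S₇ : (x₁ x₂ x₃ x₄ x₅ x₆ x₇ y₁ y₂ y₃ y₄ y₅ y₆ y₇ : ℤ) → ℤ
  S₇ x₁ x₂ x₃ x₄ x₅ x₆ x₇ y₁ y₂ y₃ y₄ y₅ y₆ y₇ = x₇ * y₇ + (x₆ * y₆ + (x₅ * y₅ + (x₄ * y₄ + (x₃ * y₃ + (x₂ * y₂ + (x₁ * y₁ + + 0))))))

  S₇-cong : ∀ x₁ x₂ x₃ x₄ x₅ x₆ x₇ {y₁ y₂ y₃ y₄ y₅ y₆ y₇ z₁ z₂ z₃ z₄ z₅ z₆ z₇} →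
    y₁ ≡ z₁ → y₂ ≡ z₂ → y₃ ≡ z₃ → y₄ ≡ z₄ → y₅ ≡ z₅ → y₆ ≡ z₆ → y₇ ≡ z₇ →
    S₇ x₁ x₂ x₃ x₄ x₅ x₆ x₇ y₁ y₂ y₃ y₄ y₅ y₆ y₇ ≡ S₇ x₁ x₂ x₃ x₄ x₅ x₆ x₇ z₁ z₂ z₃ z₄ z₅ z₆ z₇
  S₇-cong x₁ x₂ x₃ x₄ x₅ x₆ x₇ refl refl refl refl refl refl refl = refl

  Λ₇ : (x₁ x₂ x₃ x₄ x₅ x₆ x₇ : ℤ) → Seq → Seq
  Λ₇ x₁ x₂ x₃ x₄ x₅ x₆ x₇ W i = S₇ x₁ x₂ x₃ x₄ x₅ x₆ x₇ (c (+ 1) W i) (c (+ 2) W i) (c (+ 3) W i) (c (+ 4) W i) (c (+ 5) W i) (c (+ 6) W i) (c (+ 7) W i)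

  -- Where x² = -1: c 2 = c 6 = -2, c 4 = 2, and the odd ones are zero.
  fourth : ∀ {W} → Anti (+ 2) W → ∀ i x₁ x₂ x₃ x₄ x₅ x₆ x₇ → - x₂ + x₄ - x₆ ≡ + 0 → Λ₇ x₁ x₂ x₃ x₄ x₅ x₆ x₇ W i ≡ + 0
  fourth {W} f i x₁ x₂ x₃ x₄ x₅ x₆ x₇ e = trans (S₇-cong x₁ x₂ x₃ x₄ x₅ x₆ x₇
      (c-odd≡0 f {1} (0 , refl) i) (c-odd-multiple {+ 2} {W} {+ 2} (+ 0) refl f i) (c-odd≡0 f {3} (1 , refl) i)
      (c-even-multiple {+ 2} {W} {+ 4} (+ 1) refl f i) (c-odd≡0 f {5} (2 , refl) i)
      (c-odd-multiple {+ 2} {W} {+ 6} (+ 1) refl f i) (c-odd≡0 f {7} (3 , refl) i))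
    (trans (eq x₁ x₂ x₃ x₄ x₅ x₆ x₇ (W i)) (trans (cong (λ y → + 2 * W i * y) e) (*-zeroʳ (+ 2 * W i))))
    where
    eq : ∀ a b c d e f g w → g * + 0 + (f * (- + 2 * w) + (e * + 0 + (d * (+ 2 * w) + (c * + 0 + (b * (- + 2 * w) + (a * + 0 + + 0))))))
      ≡ + 2 * w * (- b + d - f)
    eq = solve-∀

  -- Where x⁴ = -1: c 2 = c 6 = 0, c 3 = c 5 = -c 1 and c 7 = c 1.
  eighth : ∀ {W} → Anti (+ 4) W → ∀ i x₁ x₂ x₃ x₄ x₅ x₆ x₇ → x₄ ≡ + 0 → x₁ - x₃ - x₅ + x₇ ≡ + 0 → Λ₇ x₁ x₂ x₃ x₄ x₅ x₆ x₇ W i ≡ + 0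
  eighth {W} f i x₁ x₂ x₃ x₄ x₅ x₆ x₇ e₄ e = trans (S₇-cong x₁ x₂ x₃ x₄ x₅ x₆ x₇
      refl (c-half-odd-multiple {+ 4} {W} {+ 2} (+ 0) refl f i) c₃
      refl (c-+-antiperiod (+ 1) f i)
      (c-half-odd-multiple {+ 4} {W} {+ 6} (+ 1) refl f i) (trans (c-+-antiperiod (+ 3) f i) (cong -_ c₃)))
    (trans (eq x₁ x₂ x₃ x₄ x₅ x₆ x₇ (c (+ 1) W i) (c (+ 4) W i)) (trans (cong₂ (λ y z → c (+ 1) W i * y + z * c (+ 4) W i) e e₄)
      (cong (_+ + 0 * c (+ 4) W i) (*-zeroʳ (c (+ 1) W i)))))
    where
    c₃ : c (+ 3) W i ≡ - c (+ 1) W i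
    c₃ = trans (c-+-antiperiod (- + 1) f i) (cong -_ (c-neg (+ 1) W i))
    eq : ∀ a b c d e f g u w → g * - - u + (f * + 0 + (e * - u + (d * w + (c * - u + (b * + 0 + (a * u + + 0)))))) ≡ u * (a - c - e + g) + d * w
    eq = solve-∀

  -- Where x⁸ = -1: c (8 - s) = -c s, so equal weights at s and 8 - s cancel.
  sixteenth : ∀ {W} → Anti (+ 8) W → ∀ i x₁ x₂ x₃ x₄ x₅ x₆ x₇ → x₁ ≡ x₇ → x₂ ≡ x₆ → x₃ ≡ x₅ → Λ₇ x₁ x₂ x₃ x₄ x₅ x₆ x₇ W i ≡ + 0
  sixteenth {W} f i x₁ x₂ x₃ x₄ x₅ x₆ x₇ refl refl refl = trans (S₇-cong x₁ x₂ x₃ x₄ x₅ x₆ x₇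
      refl refl refl (c-half-odd-multiple {+ 8} {W} {+ 4} (+ 0) refl f i)
      (mirror (+ 3)) (mirror (+ 2)) (mirror (+ 1)))
    (eq x₁ x₂ x₃ x₄ (c (+ 1) W i) (c (+ 2) W i) (c (+ 3) W i))
    where
    mirror : ∀ s → c (- s + + 8) W i ≡ - c s W i
    mirror s = trans (c-+-antiperiod (- s) f i) (cong -_ (c-neg s W i))
    eq : ∀ a b c d u v w → a * - u + (b * - v + (c * - w + (d * + 0 + (c * w + (b * v + (a * u + + 0)))))) ≡ + 0
    eq = solve-∀

  Killed : (ℕ → Bool) → ℕ → Set
  Killed p q = ∀ {W} → Anti (+ q) W → ∀ i → Σ₁ 7 (λ s → v (p s) * c (+ s) W i) ≡ + 0

  order-16-kernel : ∀ p → # 7 p ≡ 4 → Σ₁ 7 (λ s → v (p s) * ε s) ≡ + 0 → Killed p 2 ⊎ Killed p 4 ⊎ Killed p 8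
  order-16-kernel p P≡4 bal = conclude (order-16 (p 1) (p 2) (p 3) (p 4) (p 5) (p 6) (p 7) (trans (sym (+# 7 p)) (cong +_ P≡4)) bal)
    where
    conclude : Vanishing (p 1) (p 2) (p 3) (p 4) (p 5) (p 6) (p 7) → Killed p 2 ⊎ Killed p 4 ⊎ Killed p 8
    conclude (inj₁ e) = inj₁ λ f i → fourth f i (v (p 1)) (v (p 2)) (v (p 3)) (v (p 4)) (v (p 5)) (v (p 6)) (v (p 7)) e
    conclude (inj₂ (inj₁ (e , e′))) = inj₂ (inj₁ λ f i → eighth f i (v (p 1)) (v (p 2)) (v (p 3)) (v (p 4)) (v (p 5)) (v (p 6)) (v (p 7)) e e′)
    conclude (inj₂ (inj₂ (e , e′ , e″))) = inj₂ (inj₂ λ f i → sixteenth f i (v (p 1)) (v (p 2)) (v (p 3)) (v (p 4)) (v (p 5)) (v (p 6)) (v (p 7)) e e′ e″)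

  module Order-16 {G : Graph 16} (circ : Circulant G) {x : Fin 16 → ℚ} (spans : SpansKernel G x) (x≢0 : ∀ i → x i ≢ 0ℚ) (reg : Regular 8 G) where
    open Even-order-nut 7 {G} circ {x} spans x≢0 reg

    Conv-7 : ∀ {W} → Per (+ 16) W → ∀ i → Σ₁ 7 (λ s → v (p s) * c (+ s) W i) ≡ + 0 → Conv 16 χ W i ≡ + 0
    Conv-7 {W} f i e = trans (Conv-p f i) (cong₂ (λ b y → v b * W (i + + 8) + y) p-h e)

    impossible : ⊥
    impossible = conclude (order-16-kernel p P≡4 balanced)
      where
      P≡4 : P ≡ 4
      P≡4 = sym (ℕₚ.*-cancelˡ-≡ 4 P 2 d≡2P)
      excluded : ∀ j → Killed p (suc (suc j)) → Per (+ 16) (wave (suc (suc j))) → ⊥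
      excluded j g per-W = no-wave j per-W λ i → Conv-7 per-W i (g (wave-Anti (suc (suc j))) i)
      conclude : Killed p 2 ⊎ Killed p 4 ⊎ Killed p 8 → ⊥
      conclude (inj₁ g) = excluded 0 g (Per-* (+ 4) (Anti⇒Per (wave-Anti 2)))
      conclude (inj₂ (inj₁ g)) = excluded 2 g (Per-* (+ 2) (Anti⇒Per (wave-Anti 4)))
      conclude (inj₂ (inj₂ g)) = excluded 6 g (Anti⇒Per (wave-Anti 8))

-- The four cases of the degree

open import Data.Nat hiding (parity)
open import Data.Nat.Divisibility using (_∣_; divides)
open import Data.Nat.DivMod using (m≡m%n+[m/n]*n)
open import Data.Nat.Properties
open import Data.Nat.Tactic.RingSolver using (solve-∀)
open import Function.Bundles using (_⇔_; mk⇔)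
open Kernels
open Designs
open Graphs

even-order : ∀ {d n} → InN d n → ∃ λ k → n ≡ suc k + suc k
even-order {d} {suc n} (_ , G , circ , reg , 2≤n , x , spans , x≢0) = halve (Nullity-one.even-order {n} {G} circ 2≤n {x} spans x≢0 {d} reg)
  where
  halve : ∀ {n} → IsEven (suc n) → ∃ λ k → suc n ≡ suc k + suc k
  halve (suc k , e) = k , trans e (sym (m+m≡2*m (suc k)))

-- d = 4O and 2Q is the number of vertices, beyond 0 and n/2, missing from the connection set.
Necessary : ℕ → ℕ → Set
Necessary d n = d ≢ 0 × ∃₂ λ O Q → d ≡ 4 * O × n ≡ d + 2 + 2 * Q × Q ≢ 0 × (∀ O′ → O ≡ 2 * O′ → Q ≢ 1)

necessary : ∀ {d n} → InN d n → Necessary d n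
necessary {d} inN@(_ , G , circ , reg , 2≤n , x , spans , x≢0) with even-order inN
... | k , refl = Nullity-one.d≢0 {k + suc k} {G} circ 2≤n {x} spans x≢0 {d} reg , E.O , E.Q , E.d≡4O , E.n≡d+2+2Q , E.Q≢0 , E.Q≢1
  where
  module E = Even-order-nut k {G} circ {x} spans x≢0 {d} reg

¬InN-8-16 : ¬ InN 8 16
¬InN-8-16 (_ , G , circ , reg , _ , x , spans , x≢0) = Order-16.impossible {G} circ {x} spans x≢0 reg

order-even : ∀ {d n} → Necessary d n → 2 ∣ n
order-even {d} (_ , O , Q , d≡ , n≡ , _) = divides (2 * O + 1 + Q) (trans n≡ (trans (cong (λ d → d + 2 + 2 * Q) d≡) (eq O Q)))
  where
  eq : ∀ O Q → 4 * O + 2 + 2 * Q ≡ (2 * O + 1 + Q) * 2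
  eq = solve-∀

order-bound : ∀ {d n} q → n ≡ d + 2 + 2 * q → ∀ {r} → r ≤ q → d + (2 + 2 * r) ≤ n
order-bound {d} q refl {r} r≤q = ≤-trans (≤-reflexive (sym (+-assoc d 2 (2 * r)))) (+-monoʳ-≤ (d + 2) (*-monoʳ-≤ 2 r≤q))

exists : ∀ {d n h D} → Design h D → 0 < h → d ≡ 2 * D → n ≡ h * 2 → InN d n
exists {h = suc k} {D} design _ refl refl = subst (InN (2 * D)) (trans (m+m≡2*m (suc k)) (*-comm 2 (suc k))) (Realisation.realised k D design)

exists-8∣ : ∀ {d n} p h → d ≡ suc p * 8 → n ≡ h * 2 → d + 6 ≤ n → (p ≡ 0 → h ≢ 8) → InN d n
exists-8∣ p h refl refl le exc = exists (design-8∣ p h bound exc) (≤-trans (s≤s z≤n) (≤-trans (m≤n+m 7 (4 * p)) bound)) (eq₂ p) refl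
  where
  eq : ∀ p → (4 * p + 7) * 2 ≡ suc p * 8 + 6
  eq = solve-∀
  eq₂ : ∀ p → suc p * 8 ≡ 2 * (4 + 2 * (p + p))
  eq₂ = solve-∀
  bound : 4 * p + 7 ≤ h
  bound = *-cancelʳ-≤ (4 * p + 7) h 2 (≤-trans (≤-reflexive (eq p)) le)

zero-or-not-4∣ : ∀ d → d ≡ 0 ⊎ ¬ (4 ∣ d) → ∀ n → ¬ InN d n
zero-or-not-4∣ d (inj₁ d≡0) n inN = proj₁ (necessary inN) d≡0
zero-or-not-4∣ d (inj₂ 4∤d) n inN with necessary inN
... | _ , O , _ , d≡4O , _ = 4∤d (divides O (trans d≡4O (*-comm 4 O)))

4-mod-8 : ∀ d → d % 8 ≡ 4 → ∀ n → InN d n ⇔ (2 ∣ n × d + 4 ≤ n)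
4-mod-8 d d%8≡4 n = mk⇔ only-if if
  where
  only-if : InN d n → 2 ∣ n × d + 4 ≤ n
  only-if inN with necessary inN
  ... | nec@(_ , _ , Q , _ , n≡ , Q≢0 , _) = order-even nec , order-bound Q n≡ (n≢0⇒n>0 Q≢0)
  if : 2 ∣ n × d + 4 ≤ n → InN d n
  if (divides h n≡ , le) = exists (design-4mod8 p h bound) (≤-trans (s≤s z≤n) (≤-trans (m≤n+m 4 (4 * p)) bound)) (trans d≡ (eq₂ p)) n≡
    where
    p = d / 8
    d≡ : d ≡ 4 + p * 8
    d≡ = trans (m≡m%n+[m/n]*n d 8) (cong (λ r → r + p * 8) d%8≡4)
    eq : ∀ p → (4 * p + 4) * 2 ≡ 4 + p * 8 + 4
    eq = solve-∀
    eq₂ : ∀ p → 4 + p * 8 ≡ 2 * (2 + 2 * (p + p))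
    eq₂ = solve-∀
    bound : 4 * p + 4 ≤ h
    bound = *-cancelʳ-≤ (4 * p + 4) h 2 (≤-trans (≤-reflexive (trans (eq p) (cong (λ d → d + 4) (sym d≡)))) (≤-trans le (≤-reflexive n≡)))

degree-8 : ∀ d → d ≡ 8 → ∀ n → InN d n ⇔ (n ≡ 14 ⊎ (2 ∣ n × 18 ≤ n))
degree-8 d refl n = mk⇔ (λ inN → only-if inN (necessary inN)) if
  where
  only-if : InN 8 n → Necessary 8 n → n ≡ 14 ⊎ (2 ∣ n × 18 ≤ n)
  -- n = 10 + 2Q: Q = 2 gives 14, Q = 3 the excluded order 16, and Q ≥ 4 gives n ≥ 18.
  only-if inN nec@(_ , O , 0 , 8≡4O , n≡ , Q≢0 , Q≢1) = ⊥-elim (Q≢0 refl)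
  only-if inN nec@(_ , O , 1 , 8≡4O , n≡ , Q≢0 , Q≢1) = ⊥-elim (Q≢1 1 (*-cancelˡ-≡ O 2 4 (sym 8≡4O)) refl)
  only-if inN nec@(_ , O , 2 , 8≡4O , n≡ , Q≢0 , Q≢1) = inj₁ n≡
  only-if inN nec@(_ , O , 3 , 8≡4O , n≡ , Q≢0 , Q≢1) = ⊥-elim (¬InN-8-16 (subst (InN 8) n≡ inN))
  only-if inN nec@(_ , O , Q@(suc (suc (suc (suc q)))) , 8≡4O , n≡ , Q≢0 , Q≢1) = inj₂ (order-even nec , order-bound {8} Q n≡ {4} (m≤m+n 4 q))
  if : n ≡ 14 ⊎ (2 ∣ n × 18 ≤ n) → InN 8 n
  if (inj₁ n≡14) = exists-8∣ 0 7 refl n≡14 (≤-reflexive (sym n≡14)) λ _ ()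
  if (inj₂ (divides h n≡ , 18≤n)) = exists-8∣ 0 h refl n≡ (≤-trans (m≤m+n 14 4) 18≤n)
    λ _ h≡8 → <⇒≱ (m≤m+n 17 1) (≤-trans 18≤n (≤-reflexive (trans n≡ (cong (_* 2) h≡8))))

multiple-of-8 : ∀ d → 8 ∣ d → 16 ≤ d → ∀ n → InN d n ⇔ (2 ∣ n × d + 6 ≤ n)
multiple-of-8 d (divides q d≡) 16≤d n = mk⇔ (λ inN → only-if (necessary inN)) if
  where
  only-if : Necessary d n → 2 ∣ n × d + 6 ≤ n
  only-if nec@(_ , O , Q , d≡4O , n≡ , Q≢0 , Q≢1) = order-even nec , order-bound Q n≡ (≤∧≢⇒< (n≢0⇒n>0 Q≢0) (≢-sym (Q≢1 q
      (*-cancelˡ-≡ O (2 * q) 4 (trans (sym d≡4O) (trans d≡ (eq q)))))))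
    where
    eq : ∀ q → q * 8 ≡ 4 * (2 * q)
    eq = solve-∀
  if : 2 ∣ n × d + 6 ≤ n → InN d n
  if (divides h n≡ , le) = build q d≡
    where
    build : ∀ q → d ≡ q * 8 → InN d n
    build zero d≡0 = ⊥-elim (<⇒≱ (s≤s z≤n) (≤-trans 16≤d (≤-reflexive d≡0)))
    build (suc zero) d≡8 = ⊥-elim (<⇒≱ (m≤m+n 9 7) (≤-trans 16≤d (≤-reflexive d≡8)))
    -- From d = 16 on, the parameter d/8 - 1 is positive and the exception for degree 8 is void.
    build (suc (suc p)) d≡ = exists-8∣ (suc p) h d≡ n≡ le λ ()

theorem1p5 : (d : ℕ) →
    ((d ≡ 0 ⊎ ¬ (4 ∣ d)) → ∀ n → ¬ InN d n)
    × (d % 8 ≡ 4 → ∀ n → InN d n ⇔ (2 ∣ n × d + 4 ≤ n))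
    × (d ≡ 8 → ∀ n → InN d n ⇔ (n ≡ 14 ⊎ (2 ∣ n × 18 ≤ n)))
    × (8 ∣ d → 16 ≤ d → ∀ n → InN d n ⇔ (2 ∣ n × d + 6 ≤ n))
theorem1p5 d = zero-or-not-4∣ d , 4-mod-8 d , degree-8 d , multiple-of-8 d
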